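{- Asymptotically almost surely, $H(\mathcal{G}_{n,3}) \le (1+o(1))\, n/3$.
   Context: Hopping forcing: given a graph $G$ with each vertex coloured blue or white, the hopping forcing rule allows a blue vertex $b$ to force (recolour blue) a white vertex $w$ at distance exactly two from $b$, provided that every neighbour of $b$ is blue and $b$ has not previously performed a force (each vertex can perform at most one force). A set $B\subseteq V(G)$ is feasible if, starting with exactly the vertices of $B$ blue, repeated sequential applications of the rule can make all vertices blue. The hopping forcing number $H(G)$ is the minimum size of a feasible set. $\mathcal{G}_{n,3}$ is a uniformly random $3$-regular simple graph on $n$ labelled vertices ($n$ even), $n\to\infty$. An event holds asymptotically almost surely (a.a.s.) if its probability tends to $1$ as $n\to\infty$. -}

module Defs where

open import Data.Nat using (ℕ; zero; suc; _≟_)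
open import Data.Bool using (Bool; true; false)
open import Data.Fin using (Fin)
open import Data.Fin.Subset using (Subset; _∈_; _∉_; _∪_; ⁅_⁆; ⊥; ∣_∣)
open import Data.Fin.Subset.Properties using (_∈?_)
open import Data.Fin.Properties using (all?)
open import Data.Vec using (Vec; []; _∷_; lookup)
open import Data.List using (List; []; _∷_; concatMap; map; filter; length)
open import Data.Product using (_×_; _,_; ∃; ∃-syntax)
open import Relation.Nullary using (¬_; Dec; yes; no)
open import Relation.Nullary.Decidable using (_×-dec_; _→-dec_)
open import Relation.Binary.PropositionalEquality using (_≡_)

-- A graph on the labelled vertex set Fin n, given by its adjacency rows:
-- row v is the set of neighbours of v.
Graph : ℕ → Set
Graph n = Vec (Subset n) n

Adj : ∀ {n} → Graph n → Fin n → Fin n → Set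
Adj G u v = v ∈ lookup G u

adj? : ∀ {n} (G : Graph n) u v → Dec (Adj G u v)
adj? G u v = v ∈? lookup G u

Cubic : ∀ {n} → Graph n → Set
Cubic {n} G =
  (∀ u v → Adj G u v → Adj G v u) × (∀ v → ¬ Adj G v v) × (∀ v → ∣ lookup G v ∣ ≡ 3)

cubic? : ∀ {n} (G : Graph n) → Dec (Cubic G)
cubic? {n} G =
  all? (λ u → all? (λ v → adj? G u v →-dec adj? G v u))
  ×-dec (all? (λ v → (adj? G v v) →-dec (no λ ())))
  ×-dec all? (λ v → ∣ lookup G v ∣ ≟ 3)

Dist2 : ∀ {n} → Graph n → Fin n → Fin n → Set
Dist2 G b w = ¬ (b ≡ w) × ¬ Adj G b w × ∃[ c ] (Adj G b c × Adj G c w)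

-- CanFinish G blue used : starting from blue set 'blue', where the vertices
-- in 'used' have already performed their (single) force, some sequence of
-- hopping forces makes every vertex blue.
data CanFinish {n} (G : Graph n) : Subset n → Subset n → Set where
  done : ∀ {blue used} → (∀ v → v ∈ blue) → CanFinish G blue used
  step : ∀ {blue used} (b w : Fin n) →
         b ∈ blue →
         (∀ u → Adj G b u → u ∈ blue) →
         b ∉ used →
         w ∉ blue →
         Dist2 G b w →
         CanFinish G (blue ∪ ⁅ w ⁆) (used ∪ ⁅ b ⁆) →
         CanFinish G blue used

Feasible : ∀ {n} → Graph n → Subset n → Set
Feasible G B = CanFinish G B ⊥

allVecs : ∀ {A : Set} → List A → (m : ℕ) → List (Vec A m)
allVecs xs zero = [] ∷ []
allVecs xs (suc m) = concatMap (λ x → map (x ∷_) (allVecs xs m)) xs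

allGraphs : (n : ℕ) → List (Graph n)
allGraphs n = allVecs (allVecs (true ∷ false ∷ []) n) n

numCubic : ℕ → ℕ
numCubic n = length (filter cubic? (allGraphs n))

{-# OPTIONS --safe #-}
-- Cut almost all of the graph into long paths ("segments") and
-- process the segments one after another, each from its first to its last vertex.
-- Every interior vertex has one chord, its edge off the segment.  If v precedes w
-- on a segment and the chord of v goes back to an earlier segment, then its other
-- end is complete once v is blue and can hop onto w; if the chord of the
-- predecessor u of v goes back, then u itself can hop onto w.  So w has to be
-- coloured in advance only if both chords go forward.  The segments of v and of
-- the other ends of the two chords are distinct when there are no short cycles
-- nearby, so in a random order of the segments this happens with probability 1/3.
--
-- The segments come from a maximum matching M: if there are few short cycles, then
-- counting vertices reached by alternating paths shows that M misses few vertices,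
-- so G − M is essentially a union of long paths and cycles.  That almost every
-- cubic graph has few short cycles is a first-moment computation, the probability
-- of a closing edge being bounded by a switching argument.
module Submission where

open import Defs
open import Data.Nat using (ℕ; zero; suc; _+_; _*_; _∸_; _^_; _≤_; _<_; z≤n; s≤s; s≤s⁻¹; _≟_; _≤?_; _<?_; >-nonZero)
open import Data.Nat.Properties
open import Data.Nat.Tactic.RingSolver using (solve-∀)
open import Data.Bool using (Bool; true; false; if_then_else_; not; _xor_)
open import Data.Fin using (Fin; zero; suc; fromℕ<)
import Data.Fin.Properties as Fin
open import Data.Fin.Subset using (Subset; ∣_∣; ⁅_⁆; _∪_) renaming (_∈_ to _∈ₛ_; _∉_ to _∉ₛ_)
open import Data.Fin.Subset.Properties using (drop-there; x∈p∪q⁺; x∈p∪q⁻; x∈⁅x⁆; x∈⁅y⁆⇒x≡y; ∉⊥) renaming (_∈?_ to _∈?ₛ_)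
open import Data.Vec using (Vec; []; _∷_)
import Data.Vec as Vec
import Data.Vec.Properties as Vec
open import Data.List using (List; []; _∷_; _++_; length; map; filter; concatMap; concat; _ʳ++_; allFin)
import Data.List as List
import Data.List.Properties as List
open import Data.List.Membership.Propositional using (_∈_; _∉_; find)
open import Data.List.Membership.Propositional.Properties
open import Data.List.Relation.Unary.Any using (Any; here; there; any?)
import Data.List.Relation.Unary.Any as Any
open import Data.List.Relation.Unary.All using (All; []; _∷_)
import Data.List.Relation.Unary.All as All
import Data.List.Relation.Unary.All.Properties as All
open import Data.List.Relation.Unary.AllPairs using ([]; _∷_)
open import Data.List.Relation.Unary.Linked using (Linked; []; [-]; _∷_; linked?)
import Data.List.Relation.Unary.Linked as Linked
open import Data.List.Relation.Unary.Unique.Propositional using (Unique)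
import Data.List.Relation.Unary.Unique.Propositional.Properties as Unique
open import Data.List.Extrema ≤-totalOrder using (argmin; argmin-all; f[argmin]≤f[xs])
open import Data.Product using (_×_; _,_; ∃-syntax; proj₁; proj₂)
open import Data.Sum using (_⊎_; inj₁; inj₂)
open import Data.Empty using (⊥)
open import Data.Maybe using (Maybe; just; nothing)
open import Data.Unit using (tt)
open import Function using (_∘_; id; case_of_)
open import Relation.Nullary using (¬_; Dec; yes; no; does; contradiction)
open import Relation.Nullary.Decidable using (_×-dec_; _⊎-dec_; _→-dec_; ¬?; dec-true; dec-false)
open import Relation.Binary.Definitions using (tri<; tri≈; tri>)
open import Relation.Binary.PropositionalEquality
  using (_≡_; _≢_; refl; sym; trans; cong; cong₂; subst; subst₂)

-- Counting in lists

-- The only probabilistic input is that few vertices lie near short cycles; everything after it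
-- holds for each single graph with that property. This is why a maximum matching takes the place of
-- a perfect matching or a Hamilton cycle: a deficiency of a small fraction of n is affordable, and
-- bounding it needs only local tree-likeness. The segment length ℓ answers two opposing demands. It
-- must be large, because vertices near the ends of segments are all charged to the starting set;
-- and it must not depend on n, because only then does a coincidence among the three segments at a
-- vertex produce a cycle of bounded length, which is rare. Hence the order of choice: the error
-- 1/A, then ℓ, then the cycle bound L = 2ℓ, and n last. The two chances to colour w are what beats
-- n/2: with the chord of v alone, a random order would leave w uncoloured with probability 1/2.

private variable
  A A′ : Set
  P Q R : Set

ind : Dec P → ℕ
ind d = if does d then 1 else 0

ind-elim : (X : ℕ → Set) (d : Dec P) → (P → X 1) → (¬ P → X 0) → X (ind d)
ind-elim X (yes p) f g = f p
ind-elim X (no ¬p) f g = g ¬p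

ind-yes : (d : Dec P) → P → ind d ≡ 1
ind-yes (yes _) _ = refl
ind-yes (no ¬p) p = contradiction p ¬p

ind-no : (d : Dec P) → ¬ P → ind d ≡ 0
ind-no (yes p) ¬p = contradiction p ¬p
ind-no (no _) _ = refl

ind-mono : (d : Dec P) (e : Dec Q) → (P → Q) → ind d ≤ ind e
ind-mono (no _) e f = z≤n
ind-mono (yes p) e f = ≤-reflexive (sym (ind-yes e (f p)))

ind-cong : (d : Dec P) (e : Dec Q) → (P → Q) → (Q → P) → ind d ≡ ind e
ind-cong d e f g = ≤-antisym (ind-mono d e f) (ind-mono e d g)

ind-≤1 : (d : Dec P) → ind d ≤ 1
ind-≤1 (yes _) = ≤-refl
ind-≤1 (no _) = z≤n

ind-≤ : ∀ {k} (d : Dec P) → (P → 1 ≤ k) → ind d ≤ k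
ind-≤ (yes p) f = f p
ind-≤ (no _) f = z≤n

ind-⊎ : (d : Dec P) (e : Dec Q) (f : Dec R) → (P → Q ⊎ R) → ind d ≤ ind e + ind f
ind-⊎ (no _) e f g = z≤n
ind-⊎ (yes p) e f g with g p
... | inj₁ q = ≤-trans (≤-reflexive (sym (ind-yes e q))) (m≤m+n _ _)
... | inj₂ r = ≤-trans (≤-reflexive (sym (ind-yes f r))) (m≤n+m _ _)

ind-× : (d : Dec P) (e : Dec Q) → ind (d ×-dec e) ≡ ind d * ind e
ind-× (yes _) (yes _) = refl
ind-× (yes _) (no _) = refl
ind-× (no _) e = refl

∑ : List A → (A → ℕ) → ℕ
∑ [] f = 0
∑ (x ∷ xs) f = f x + ∑ xs f

count : {P : A → Set} → (∀ x → Dec (P x)) → List A → ℕ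
count P? xs = ∑ xs (λ x → ind (P? x))

∑-mono : (xs : List A) {f g : A → ℕ} → (∀ x → x ∈ xs → f x ≤ g x) → ∑ xs f ≤ ∑ xs g
∑-mono [] h = z≤n
∑-mono (x ∷ xs) h = +-mono-≤ (h x (here refl)) (∑-mono xs (λ y y∈ → h y (there y∈)))

∑-mono′ : (xs : List A) {f g : A → ℕ} → (∀ x → f x ≤ g x) → ∑ xs f ≤ ∑ xs g
∑-mono′ xs h = ∑-mono xs (λ x _ → h x)

∑-cong : (xs : List A) {f g : A → ℕ} → (∀ x → f x ≡ g x) → ∑ xs f ≡ ∑ xs g
∑-cong [] h = refl
∑-cong (x ∷ xs) h = cong₂ _+_ (h x) (∑-cong xs h)

∑-zero : (xs : List A) → ∑ xs (λ _ → 0) ≡ 0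
∑-zero [] = refl
∑-zero (x ∷ xs) = ∑-zero xs

interchange : ∀ a b c d → (a + b) + (c + d) ≡ (a + c) + (b + d)
interchange = solve-∀

∑-+ : (xs : List A) (f g : A → ℕ) → ∑ xs (λ x → f x + g x) ≡ ∑ xs f + ∑ xs g
∑-+ [] f g = refl
∑-+ (x ∷ xs) f g = trans (cong (f x + g x +_) (∑-+ xs f g)) (interchange (f x) (g x) _ _)

∑-*ˡ : (xs : List A) (c : ℕ) (f : A → ℕ) → ∑ xs (λ x → c * f x) ≡ c * ∑ xs f
∑-*ˡ [] c f = sym (*-zeroʳ c)
∑-*ˡ (x ∷ xs) c f = trans (cong (c * f x +_) (∑-*ˡ xs c f)) (sym (*-distribˡ-+ c (f x) _))

∑-*ʳ : (xs : List A) (c : ℕ) (f : A → ℕ) → ∑ xs (λ x → f x * c) ≡ ∑ xs f * c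
∑-*ʳ xs c f = trans (∑-cong xs (λ x → *-comm (f x) c)) (trans (∑-*ˡ xs c f) (*-comm c _))

∑-const : (xs : List A) (c : ℕ) → ∑ xs (λ _ → c) ≡ length xs * c
∑-const [] c = refl
∑-const (x ∷ xs) c = cong (c +_) (∑-const xs c)

∑-swap : (xs : List A) (ys : List A′) (f : A → A′ → ℕ) →
         ∑ xs (λ x → ∑ ys (f x)) ≡ ∑ ys (λ y → ∑ xs (λ x → f x y))
∑-swap [] ys f = sym (∑-zero ys)
∑-swap (x ∷ xs) ys f =
  trans (cong (∑ ys (f x) +_) (∑-swap xs ys f)) (sym (∑-+ ys (f x) _))

∑-++ : (xs ys : List A) (f : A → ℕ) → ∑ (xs ++ ys) f ≡ ∑ xs f + ∑ ys f
∑-++ [] ys f = refl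
∑-++ (x ∷ xs) ys f = trans (cong (f x +_) (∑-++ xs ys f)) (sym (+-assoc (f x) _ _))

∑-map : (g : A → A′) (xs : List A) (f : A′ → ℕ) → ∑ (map g xs) f ≡ ∑ xs (f ∘ g)
∑-map g [] f = refl
∑-map g (x ∷ xs) f = cong (f (g x) +_) (∑-map g xs f)

∑-concatMap : (g : A → List A′) (xs : List A) (f : A′ → ℕ) →
              ∑ (concatMap g xs) f ≡ ∑ xs (λ x → ∑ (g x) f)
∑-concatMap g [] f = refl
∑-concatMap g (x ∷ xs) f = trans (∑-++ (g x) _ f) (cong (∑ (g x) f +_) (∑-concatMap g xs f))

∈⇒≤∑ : {xs : List A} {x : A} (f : A → ℕ) → x ∈ xs → f x ≤ ∑ xs f
∈⇒≤∑ f (here refl) = m≤m+n _ _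
∈⇒≤∑ f (there x∈) = ≤-trans (∈⇒≤∑ f x∈) (m≤n+m _ _)

length-filter-count : {P : A → Set} (P? : ∀ x → Dec (P x)) (xs : List A) →
                      length (filter P? xs) ≡ count P? xs
length-filter-count P? [] = refl
length-filter-count P? (x ∷ xs) with P? x
... | yes _ = cong suc (length-filter-count P? xs)
... | no _ = length-filter-count P? xs

count-mono : {P Q : A → Set} (P? : ∀ x → Dec (P x)) (Q? : ∀ x → Dec (Q x)) (xs : List A) →
             (∀ x → P x → Q x) → count P? xs ≤ count Q? xs
count-mono P? Q? xs h = ∑-mono′ xs (λ x → ind-mono (P? x) (Q? x) (h x))

count-⊎ : {P Q R : A → Set} (P? : ∀ x → Dec (P x)) (Q? : ∀ x → Dec (Q x)) (R? : ∀ x → Dec (R x))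
          (xs : List A) → (∀ x → P x → Q x ⊎ R x) → count P? xs ≤ count Q? xs + count R? xs
count-⊎ P? Q? R? xs h =
  ≤-trans (∑-mono′ xs (λ x → ind-⊎ (P? x) (Q? x) (R? x) (h x))) (≤-reflexive (∑-+ xs _ _))

Unique-⊆⇒length≤ : {xs ys : List A} → Unique xs → (∀ {x} → x ∈ xs → x ∈ ys) → length xs ≤ length ys
Unique-⊆⇒length≤ [] h = z≤n
Unique-⊆⇒length≤ {xs = x ∷ xs} (x∉ ∷ u) h with ∈-∃++ (h (here refl))
... | as , bs , refl = subst (suc (length xs) ≤_) (sym lem) (s≤s (Unique-⊆⇒length≤ u sub))
  where
  lem : length (as ++ x ∷ bs) ≡ suc (length (as ++ bs))
  lem = trans (List.length-++ as) (trans (+-suc _ _) (cong suc (sym (List.length-++ as))))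
  sub : ∀ {y} → y ∈ xs → y ∈ as ++ bs
  sub {y} y∈ with ∈-++⁻ as (h (there y∈))
  ... | inj₁ p = ∈-++⁺ˡ p
  ... | inj₂ (here refl) = contradiction refl (All.lookup x∉ y∈)
  ... | inj₂ (there p) = ∈-++⁺ʳ as p

Unique-map : (f : A → A′) {xs : List A} → (∀ {x y} → x ∈ xs → y ∈ xs → f x ≡ f y → x ≡ y) →
             Unique xs → Unique (map f xs)
Unique-map f inj [] = []
Unique-map f inj (x∉ ∷ u) =
  All.map⁺ (All.tabulate (λ y∈ e → All.lookup x∉ y∈ (inj (here refl) (there y∈) e)))
  ∷ Unique-map f (λ p q → inj (there p) (there q)) u

count-injection : {P : A → Set} {Q : A′ → Set} (P? : ∀ x → Dec (P x)) (Q? : ∀ y → Dec (Q y))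
  {xs : List A} {ys : List A′} (f : A → A′) → Unique xs →
  (∀ x → x ∈ xs → P x → f x ∈ ys × Q (f x)) →
  (∀ x x′ → P x → P x′ → f x ≡ f x′ → x ≡ x′) → count P? xs ≤ count Q? ys
count-injection P? Q? {xs} {ys} f u h inj = subst₂ _≤_
  (trans (List.length-map f (filter P? xs)) (length-filter-count P? xs)) (length-filter-count Q? ys)
  (Unique-⊆⇒length≤
    (Unique-map f (λ p q → inj _ _ (proj₂ (∈-filter⁻ P? {xs = xs} p)) (proj₂ (∈-filter⁻ P? {xs = xs} q)))
      (Unique.filter⁺ P? u))
    λ y∈ → sub (∈-map⁻ f y∈))
  where
  sub : ∀ {y} → ∃[ x ] (x ∈ filter P? xs × y ≡ f x) → y ∈ filter Q? ys
  sub (x , x∈ , refl) with ∈-filter⁻ P? {xs = xs} x∈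
  ... | x∈xs , px with h x x∈xs px
  ... | fx∈ , q = ∈-filter⁺ Q? fx∈ q

countᶠ : ∀ {n} {P : Fin n → Set} → (∀ v → Dec (P v)) → ℕ
countᶠ {n} P? = count P? (allFin n)

countᶠ-mono : ∀ {n} {P Q : Fin n → Set} (P? : ∀ x → Dec (P x)) (Q? : ∀ x → Dec (Q x)) →
              (∀ x → P x → Q x) → countᶠ P? ≤ countᶠ Q?
countᶠ-mono P? Q? h = count-mono P? Q? (allFin _) h

countᶠ-injection : ∀ {m n} {P : Fin m → Set} {Q : Fin n → Set} (P? : ∀ x → Dec (P x)) (Q? : ∀ x → Dec (Q x))
  (f : Fin m → Fin n) → (∀ x → P x → Q (f x)) → (∀ x x′ → P x → P x′ → f x ≡ f x′ → x ≡ x′) →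
  countᶠ P? ≤ countᶠ Q?
countᶠ-injection P? Q? f h inj =
  count-injection P? Q? f (Unique.allFin⁺ _) (λ x _ p → ∈-allFin _ , h x p) inj

count-≤length : {P : A → Set} (P? : ∀ x → Dec (P x)) (xs : List A) → count P? xs ≤ length xs
count-≤length P? xs = ≤-trans (∑-mono′ xs (λ x → ind-≤1 (P? x)))
  (≤-reflexive (trans (∑-const xs 1) (*-identityʳ _)))

length-allFin : ∀ n → length (allFin n) ≡ n
length-allFin n = List.length-tabulate id

countᶠ-≤ : ∀ {n} {P : Fin n → Set} (P? : ∀ v → Dec (P v)) → countᶠ P? ≤ n
countᶠ-≤ {n} P? = ≤-trans (count-≤length P? (allFin n)) (≤-reflexive (length-allFin n))

1≤countᶠ : ∀ {n} {P : Fin n → Set} (P? : ∀ v → Dec (P v)) {v} → P v → 1 ≤ countᶠ P?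
1≤countᶠ P? {v} p = ≤-trans (≤-reflexive (sym (ind-yes (P? v) p))) (∈⇒≤∑ (ind ∘ P?) (∈-allFin v))

∑-allFin-suc : ∀ {n} (f : Fin (suc n) → ℕ) → ∑ (allFin (suc n)) f ≡ f zero + ∑ (allFin n) (f ∘ suc)
∑-allFin-suc {n} f = cong (f zero +_)
  (trans (cong (λ xs → ∑ xs f) (sym (List.map-tabulate id suc))) (∑-map suc (allFin n) f))

-- Splits off one counted element. This is how a change at a single vertex becomes a strict
-- inequality, and how a row is compared before and after one exchange.
count-≢ : ∀ {P : A → Set} (_≟_ : ∀ (x y : A) → Dec (x ≡ y)) (P? : ∀ x → Dec (P x)) {xs a} →
          Unique xs → a ∈ xs → P a → count P? xs ≡ suc (count (λ x → P? x ×-dec ¬? (x ≟ a)) xs)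
count-≢ {P = P} _≟_ P? {a ∷ xs} (x∉ ∷ u) (here refl) p =
  cong₂ _+_ (ind-yes (P? a) p)
    (trans (lem xs x∉) (cong (_+ count (λ x → P? x ×-dec ¬? (x ≟ a)) xs)
      (sym (ind-no (P? a ×-dec ¬? (a ≟ a)) (λ q → proj₂ q refl)))))
  where
  lem : ∀ xs → All (a ≢_) xs → count P? xs ≡ count (λ x → P? x ×-dec ¬? (x ≟ a)) xs
  lem [] [] = refl
  lem (x ∷ xs) (n ∷ ns) = cong₂ _+_
    (ind-cong (P? x) (P? x ×-dec ¬? (x ≟ a)) (λ q → q , λ e → n (sym e)) proj₁) (lem xs ns)
count-≢ {P = P} _≟_ P? {a = a} (_∷_ {x} x∉ u) (there a∈) p =
  trans (cong₂ _+_ (ind-cong (P? x) (P? x ×-dec ¬? (x ≟ a)) (λ q → q , All.lookup x∉ a∈) proj₁)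
    (count-≢ _≟_ P? u a∈ p)) (+-suc _ _)

∣∣≡countᶠ : ∀ {n} (p : Subset n) → ∣ p ∣ ≡ countᶠ (λ v → v ∈?ₛ p)
∣∣≡countᶠ [] = refl
∣∣≡countᶠ (x ∷ p) = trans (head-split x) (sym (∑-allFin-suc (λ v → ind (v ∈?ₛ (x ∷ p)))))
  where
  tail-eq : ∣ p ∣ ≡ ∑ (allFin _) (λ v → ind (suc v ∈?ₛ (x ∷ p)))
  tail-eq = trans (∣∣≡countᶠ p)
    (∑-cong (allFin _) λ v → ind-cong (v ∈?ₛ p) (suc v ∈?ₛ (x ∷ p)) Vec.there drop-there)
  head-split : ∀ y → ∣ y ∷ p ∣ ≡ ind (zero ∈?ₛ (y ∷ p)) + ∑ (allFin _) (λ v → ind (suc v ∈?ₛ (x ∷ p)))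
  head-split true = cong suc tail-eq
  head-split false = tail-eq

count-complement : {P : A → Set} (P? : ∀ x → Dec (P x)) (xs : List A) →
                   count P? xs + count (λ x → ¬? (P? x)) xs ≡ length xs
count-complement P? xs = trans (sym (∑-+ xs _ _))
  (trans (∑-cong xs λ x → ind-elim (λ k → k + ind (¬? (P? x)) ≡ 1) (P? x)
      (λ p → cong (1 +_) (ind-no (¬? (P? x)) (λ ¬p → ¬p p))) (ind-yes (¬? (P? x))))
    (trans (∑-const xs 1) (*-identityʳ _)))

∑-filter : {P : A → Set} (P? : ∀ x → Dec (P x)) (xs : List A) (f : A → ℕ) →
           ∑ (filter P? xs) f ≡ ∑ xs (λ x → ind (P? x) * f x)
∑-filter P? [] f = refl
∑-filter P? (x ∷ xs) f with P? x
... | yes _ = cong₂ _+_ (sym (+-identityʳ (f x))) (∑-filter P? xs f)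
... | no _ = ∑-filter P? xs f

-- Vertices near short cycles

_∈?ᶠ_ : ∀ {n} (v : Fin n) xs → Dec (v ∈ xs)
v ∈?ᶠ xs = any? (λ y → v Fin.≟ y) xs

module CubicGraph {n : ℕ} (G : Graph n) (cubic : Cubic G) where

  adj-sym : ∀ {u v} → Adj G u v → Adj G v u
  adj-sym = proj₁ cubic _ _

  adj-irrefl : ∀ {v} → ¬ Adj G v v
  adj-irrefl = proj₁ (proj₂ cubic) _

  adj-≢ : ∀ {u v} → Adj G u v → u ≢ v
  adj-≢ a refl = adj-irrefl a

  degree : ∀ v → countᶠ (adj? G v) ≡ 3
  degree v = trans (sym (∣∣≡countᶠ (Vec.lookup G v))) (proj₂ (proj₂ cubic) v)

  nbrs : Fin n → List (Fin n)
  nbrs v = filter (adj? G v) (allFin n)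

  length-nbrs : ∀ v → length (nbrs v) ≡ 3
  length-nbrs v = trans (length-filter-count (adj? G v) (allFin n)) (degree v)

  ∈-nbrs⁺ : ∀ {v u} → Adj G v u → u ∈ nbrs v
  ∈-nbrs⁺ {v} {u} = ∈-filter⁺ (adj? G v) (∈-allFin u)

  ∈-nbrs⁻ : ∀ {v u} → u ∈ nbrs v → Adj G v u
  ∈-nbrs⁻ {v} u∈ = proj₂ (∈-filter⁻ (adj? G v) {xs = allFin n} u∈)

  unique-nbrs-≤3 : ∀ {v xs} → Unique xs → All (Adj G v) xs → length xs ≤ 3
  unique-nbrs-≤3 {v} {xs} u as = subst (length xs ≤_) (length-nbrs v)
    (Unique-⊆⇒length≤ u (λ x∈ → ∈-nbrs⁺ (All.lookup as x∈)))

  another-nbr : ∀ v xs → length xs < 3 → ∃[ r ] (Adj G v r × r ∉ xs)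
  another-nbr v xs l with Fin.any? (λ r → adj? G v r ×-dec ¬? (r ∈?ᶠ xs))
  ... | yes e = e
  ... | no none = contradiction l (≤⇒≯ (subst (_≤ length xs) (length-nbrs v)
      (Unique-⊆⇒length≤ (Unique.filter⁺ (adj? G v) (Unique.allFin⁺ n)) sub)))
    where
    sub : ∀ {x} → x ∈ nbrs v → x ∈ xs
    sub {x} x∈ with x ∈?ᶠ xs
    ... | yes p = p
    ... | no ¬p = contradiction (x , ∈-nbrs⁻ x∈ , ¬p) none

  nbr-dichotomy : ∀ {v p q r u} → p ≢ q → p ≢ r → q ≢ r → Adj G v p → Adj G v q → Adj G v r →
                  Adj G v u → u ≡ p ⊎ u ≡ q ⊎ u ≡ r
  nbr-dichotomy {v} {p} {q} {r} {u} pq pr qr ap aq ar au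
    with u Fin.≟ p | u Fin.≟ q | u Fin.≟ r
  ... | yes e | _ | _ = inj₁ e
  ... | no _ | yes e | _ = inj₂ (inj₁ e)
  ... | no _ | no _ | yes e = inj₂ (inj₂ e)
  ... | no up | no uq | no ur = contradiction
    (unique-nbrs-≤3 {v} {u ∷ p ∷ q ∷ r ∷ []}
      ((up ∷ uq ∷ ur ∷ []) ∷ (pq ∷ pr ∷ []) ∷ (qr ∷ []) ∷ [] ∷ []) (au ∷ ap ∷ aq ∷ ar ∷ []))
    λ { (s≤s (s≤s (s≤s ()))) }

  has-nbr? : {P : Fin n → Set} → (∀ v → Dec (P v)) → ∀ v → Dec (∃[ z ] (Adj G v z × P z))
  has-nbr? P? v = Fin.any? (λ z → adj? G v z ×-dec P? z)

  count-has-nbr : {P : Fin n → Set} (P? : ∀ v → Dec (P v)) →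
                  countᶠ (has-nbr? P?) ≤ 3 * countᶠ P?
  count-has-nbr P? = begin
    countᶠ (has-nbr? P?)
      ≤⟨ ∑-mono′ (allFin n) pointwise ⟩
    ∑ (allFin n) (λ v → ∑ (allFin n) (λ z → ind (adj? G z v) * ind (P? z)))
      ≡⟨ ∑-swap (allFin n) (allFin n) _ ⟩
    ∑ (allFin n) (λ z → ∑ (allFin n) (λ v → ind (adj? G z v) * ind (P? z)))
      ≡⟨ ∑-cong (allFin n) (λ z → trans (∑-*ʳ (allFin n) (ind (P? z)) _) (cong (_* ind (P? z)) (degree z))) ⟩
    ∑ (allFin n) (λ z → 3 * ind (P? z))
      ≡⟨ ∑-*ˡ (allFin n) 3 _ ⟩
    3 * countᶠ P? ∎
    where
    open ≤-Reasoning
    pointwise : ∀ v → ind (has-nbr? P? v) ≤ ∑ (allFin n) (λ z → ind (adj? G z v) * ind (P? z))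
    pointwise v with has-nbr? P? v
    ... | no _ = z≤n
    ... | yes (z , a , p) = ≤-trans
      (≤-reflexive (sym (cong₂ _*_ (ind-yes (adj? G z v) (adj-sym a)) (ind-yes (P? z) p))))
      (∈⇒≤∑ (λ z → ind (adj? G z v) * ind (P? z)) (∈-allFin z))

-- A path whose head closes a cycle with a later vertex: a cycle with a tail.
Lollipop : ∀ {n} → Graph n → List (Fin n) → Set
Lollipop G (a ∷ b ∷ cs) = Unique (a ∷ b ∷ cs) × Linked (Adj G) (a ∷ b ∷ cs) × Any (Adj G a) cs
Lollipop G _ = ⊥

lollipop? : ∀ {n} (G : Graph n) xs → Dec (Lollipop G xs)
lollipop? G [] = no λ ()
lollipop? G (a ∷ []) = no λ ()
lollipop? G (a ∷ b ∷ cs) =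
  unique? (a ∷ b ∷ cs) ×-dec linked? (adj? G) (a ∷ b ∷ cs) ×-dec any? (adj? G a) cs
  where open import Data.List.Relation.Unary.Unique.DecPropositional Fin._≟_ using (unique?)

listsUpTo : (n L : ℕ) → List (List (Fin n))
listsUpTo n zero = [] ∷ []
listsUpTo n (suc L) = [] ∷ concatMap (λ v → map (v ∷_) (listsUpTo n L)) (allFin n)

∈-listsUpTo : ∀ {n} L (xs : List (Fin n)) → length xs ≤ L → xs ∈ listsUpTo n L
∈-listsUpTo zero [] l = here refl
∈-listsUpTo (suc L) [] l = here refl
∈-listsUpTo {n} (suc L) (x ∷ xs) (s≤s l) =
  there (∈-concatMap⁺ (λ v → map (v ∷_) (listsUpTo n L))
    (Any.map (λ { refl → ∈-map⁺ (x ∷_) (∈-listsUpTo L xs l) }) (∈-allFin x)))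

length-listsUpTo : ∀ {n} L {xs : List (Fin n)} → xs ∈ listsUpTo n L → length xs ≤ L
length-listsUpTo zero (here refl) = z≤n
length-listsUpTo (suc L) (here refl) = z≤n
length-listsUpTo {n} (suc L) (there xs∈)
  with Any.satisfied (∈-concatMap⁻ (λ v → map (v ∷_) (listsUpTo n L)) {xs = allFin n} xs∈)
... | v , p with ∈-map⁻ (v ∷_) p
... | ys , ys∈ , refl = s≤s (length-listsUpTo L ys∈)

-- Vertices on the tail of a lollipop count as bad too, so that from a good vertex no cycle can be
-- reached within the length bound. Ranging over an explicit finite list makes badness decidable and
-- bounds it by a sum over lists.
Bad : ∀ {n} → ℕ → Graph n → Fin n → Set
Bad {n} L G v = Any (λ xs → v ∈ xs × Lollipop G xs) (listsUpTo n L)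

bad? : ∀ {n} L (G : Graph n) v → Dec (Bad L G v)
bad? {n} L G v = any? (λ xs → v ∈?ᶠ xs ×-dec lollipop? G xs) (listsUpTo n L)

bad : ∀ {n} L (G : Graph n) {v} xs → length xs ≤ L → v ∈ xs → Lollipop G xs → Bad L G v
bad L G xs l v∈ lol = Any.map (λ { refl → v∈ , lol }) (∈-listsUpTo L xs l)

#bad : ∀ {n} → ℕ → Graph n → ℕ
#bad L G = countᶠ (bad? L G)

-- Non-backtracking walks from `v`, the newest vertex first.
data NBWalk {n} (G : Graph n) (v : Fin n) : List (Fin n) → Set where
  start : NBWalk G v (v ∷ [])
  step₁ : ∀ {x} → Adj G x v → NBWalk G v (x ∷ v ∷ [])
  step : ∀ {x y z xs} → NBWalk G v (y ∷ z ∷ xs) → Adj G x y → x ≢ z → NBWalk G v (x ∷ y ∷ z ∷ xs)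

NBWalk-linked : ∀ {n} {G : Graph n} {v xs} → NBWalk G v xs → Linked (Adj G) xs
NBWalk-linked start = [-]
NBWalk-linked (step₁ a) = a ∷ [-]
NBWalk-linked (step w a _) = a ∷ NBWalk-linked w

NBWalk-∈ : ∀ {n} {G : Graph n} {v xs} → NBWalk G v xs → v ∈ xs
NBWalk-∈ start = here refl
NBWalk-∈ (step₁ _) = there (here refl)
NBWalk-∈ (step w _ _) = there (NBWalk-∈ w)

-- The first repetition in the walk closes a cycle, and the part of the walk leading back to `v` is
-- its tail: a lollipop through `v`.
NBWalk-unique : ∀ {n} {G : Graph n} → Cubic G → ∀ {L v xs} → ¬ Bad L G v → length xs ≤ L →
                NBWalk G v xs → Unique xs
NBWalk-unique {G = G} cubic good l start = [] ∷ []
NBWalk-unique {G = G} cubic good l (step₁ a) = (CubicGraph.adj-≢ G cubic a ∷ []) ∷ [] ∷ []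
NBWalk-unique {G = G} cubic {L} good l (step {x} {y} {z} {xs} w a x≢z) =
  All.¬Any⇒All¬ (y ∷ z ∷ xs) fresh ∷ u
  where
  open CubicGraph G cubic
  u = NBWalk-unique cubic good (<⇒≤ l) w
  -- Revisiting a vertex of the path below z closes a cycle at the previous tip y.
  fresh : ¬ (x ∈ y ∷ z ∷ xs)
  fresh (here refl) = adj-irrefl a
  fresh (there (here refl)) = x≢z refl
  fresh (there (there x∈)) = good (bad L G (y ∷ z ∷ xs) (<⇒≤ l) (NBWalk-∈ w)
    (u , NBWalk-linked w , Any.map (λ { refl → adj-sym a }) x∈))

-- Switchings

SameEdge : ∀ {n} → Fin n → Fin n → Fin n → Fin n → Set
SameEdge a b u v = (u ≡ a × v ≡ b) ⊎ (u ≡ b × v ≡ a)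

sameEdge? : ∀ {n} (a b u v : Fin n) → Dec (SameEdge a b u v)
sameEdge? a b u v = (u Fin.≟ a ×-dec v Fin.≟ b) ⊎-dec (u Fin.≟ b ×-dec v Fin.≟ a)

sameEdge-sym : ∀ {n} {a b u v : Fin n} → SameEdge a b u v → SameEdge a b v u
sameEdge-sym (inj₁ (p , q)) = inj₂ (q , p)
sameEdge-sym (inj₂ (p , q)) = inj₁ (q , p)

graph-ext : ∀ {n} {G H : Graph n} →
            (∀ u v → Vec.lookup (Vec.lookup G u) v ≡ Vec.lookup (Vec.lookup H u) v) → G ≡ H
graph-ext {G = G} {H} h = vec-ext (λ u → vec-ext (h u))
  where
  vec-ext : ∀ {A : Set} {m} {xs ys : Vec A m} → (∀ i → Vec.lookup xs i ≡ Vec.lookup ys i) → xs ≡ ys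
  vec-ext {xs = xs} {ys} e =
    trans (sym (Vec.tabulate∘lookup xs)) (trans (Vec.tabulate-cong e) (Vec.tabulate∘lookup ys))

true⇒Adj : ∀ {n} {G : Graph n} {u v} → Vec.lookup (Vec.lookup G u) v ≡ true → Adj G u v
true⇒Adj {G = G} {u} {v} = Vec.lookup⇒[]= v (Vec.lookup G u)

Adj⇒true : ∀ {n} {G : Graph n} {u v} → Adj G u v → Vec.lookup (Vec.lookup G u) v ≡ true
Adj⇒true = Vec.[]=⇒lookup

module Switch {n : ℕ} (a b c d : Fin n) where

  Toggled : Fin n → Fin n → Set
  Toggled u v = (SameEdge a b u v ⊎ SameEdge c d u v) ⊎ (SameEdge a c u v ⊎ SameEdge b d u v)

  toggled? : ∀ u v → Dec (Toggled u v)
  toggled? u v = (sameEdge? a b u v ⊎-dec sameEdge? c d u v) ⊎-dec (sameEdge? a c u v ⊎-dec sameEdge? b d u v)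

  toggled-sym : ∀ {u v} → Toggled u v → Toggled v u
  toggled-sym (inj₁ (inj₁ e)) = inj₁ (inj₁ (sameEdge-sym e))
  toggled-sym (inj₁ (inj₂ e)) = inj₁ (inj₂ (sameEdge-sym e))
  toggled-sym (inj₂ (inj₁ e)) = inj₂ (inj₁ (sameEdge-sym e))
  toggled-sym (inj₂ (inj₂ e)) = inj₂ (inj₂ (sameEdge-sym e))

  -- Flipping the four pairs by `xor`, whether or not they are edges, makes the switching an
  -- involution for all `a`, `b`, `c`, `d`. It is thus injective on all graphs, and validity matters
  -- only for staying cubic.
  entry : Graph n → Fin n → Fin n → Bool
  entry G u v = does (toggled? u v) xor Vec.lookup (Vec.lookup G u) v

  switch : Graph n → Graph n
  switch G = Vec.tabulate (λ u → Vec.tabulate (entry G u))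

  lookup-switch : ∀ G u v → Vec.lookup (Vec.lookup (switch G) u) v ≡ entry G u v
  lookup-switch G u v = trans
    (cong (λ r → Vec.lookup r v) (Vec.lookup∘tabulate (λ u → Vec.tabulate (entry G u)) u))
    (Vec.lookup∘tabulate (entry G u) v)

  switch-involutive : ∀ G → switch (switch G) ≡ G
  switch-involutive G = graph-ext λ u v → trans (lookup-switch (switch G) u v)
    (trans (cong (does (toggled? u v) xor_) (lookup-switch G u v)) (xor-xor (does (toggled? u v)) _))
    where
    xor-xor : ∀ x y → x xor (x xor y) ≡ y
    xor-xor true true = refl
    xor-xor true false = refl
    xor-xor false y = refl

  switch-injective : ∀ {G H} → switch G ≡ switch H → G ≡ H
  switch-injective {G} {H} e =
    trans (sym (switch-involutive G)) (trans (cong switch e) (switch-involutive H))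

  kept⁺ : ∀ G {u v} → ¬ Toggled u v → Adj G u v → Adj (switch G) u v
  kept⁺ G {u} {v} ¬t p = true⇒Adj {G = switch G} (trans (lookup-switch G u v)
    (trans (cong (_xor _) (dec-false (toggled? u v) ¬t)) (Adj⇒true {G = G} p)))

  kept⁻ : ∀ G {u v} → ¬ Toggled u v → Adj (switch G) u v → Adj G u v
  kept⁻ G {u} {v} ¬t p =
    subst (λ H → Adj H u v) (switch-involutive G) (kept⁺ (switch G) ¬t p)

  toggled⁺ : ∀ G {u v} → Toggled u v → ¬ Adj G u v → Adj (switch G) u v
  toggled⁺ G {u} {v} t ¬p = true⇒Adj {G = switch G} (trans (lookup-switch G u v)
    (trans (cong (_xor _) (dec-true (toggled? u v) t)) (not-true _ (λ e → ¬p (true⇒Adj {G = G} e)))))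
    where
    not-true : ∀ x → x ≢ true → not x ≡ true
    not-true true h = contradiction refl h
    not-true false h = refl

  toggled⁻ : ∀ G {u v} → Toggled u v → Adj (switch G) u v → ¬ Adj G u v
  toggled⁻ G {u} {v} t p q = not-both _ (Adj⇒true {G = G} q)
    (trans (sym (trans (lookup-switch G u v) (cong (_xor _) (dec-true (toggled? u v) t))))
      (Adj⇒true {G = switch G} p))
    where
    not-both : ∀ x → x ≡ true → not x ≡ true → ⊥
    not-both true _ ()
    not-both false ()

  module Valid {G : Graph n} (cubic : Cubic G) (ab : Adj G a b) (cd : Adj G c d)
               (c≢a : c ≢ a) (c≢b : c ≢ b) (d≢a : d ≢ a) (d≢b : d ≢ b)
               (¬ac : ¬ Adj G a c) (¬bd : ¬ Adj G b d) where
    open CubicGraph G cubic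

    a≢b : a ≢ b
    a≢b = adj-≢ ab

    c≢d : c ≢ d
    c≢d = adj-≢ cd

    toggled-irrefl : ∀ {v} → ¬ Toggled v v
    toggled-irrefl (inj₁ (inj₁ (inj₁ (refl , e)))) = a≢b e
    toggled-irrefl (inj₁ (inj₁ (inj₂ (refl , e)))) = a≢b (sym e)
    toggled-irrefl (inj₁ (inj₂ (inj₁ (refl , e)))) = c≢d e
    toggled-irrefl (inj₁ (inj₂ (inj₂ (refl , e)))) = c≢d (sym e)
    toggled-irrefl (inj₂ (inj₁ (inj₁ (refl , e)))) = c≢a (sym e)
    toggled-irrefl (inj₂ (inj₁ (inj₂ (refl , e)))) = c≢a e
    toggled-irrefl (inj₂ (inj₂ (inj₁ (refl , e)))) = d≢b (sym e)
    toggled-irrefl (inj₂ (inj₂ (inj₂ (refl , e)))) = d≢b e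

    -- At each of its four vertices a switching trades one neighbour `x` for one new neighbour `y`;
    -- deleting `y` from the new row and `x` from the old leaves the same set.
    row-swap : ∀ {u x y} → Adj G u x → ¬ Adj G u y → Toggled u x → Toggled u y →
               (∀ {v} → Toggled u v → v ≡ x ⊎ v ≡ y) → countᶠ (adj? (switch G) u) ≡ 3
    row-swap {u} {x} {y} ux ¬uy tx ty only = trans
      (trans (count-≢ Fin._≟_ (adj? (switch G) u) (Unique.allFin⁺ n) (∈-allFin y) (toggled⁺ G ty ¬uy))
        (trans (cong suc (∑-cong (allFin n) λ v → ind-cong
            (adj? (switch G) u v ×-dec ¬? (v Fin.≟ y)) (adj? G u v ×-dec ¬? (v Fin.≟ x)) to from))
          (sym (count-≢ Fin._≟_ (adj? G u) (Unique.allFin⁺ n) (∈-allFin x) ux))))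
      (degree u)
      where
      away : ∀ {v} → v ≢ x → v ≢ y → ¬ Toggled u v
      away p q t with only t
      ... | inj₁ e = p e
      ... | inj₂ e = q e
      to : ∀ {v} → Adj (switch G) u v × v ≢ y → Adj G u v × v ≢ x
      to {v} (p , v≢y) = kept⁻ G (away v≢x v≢y) p , v≢x
        where
        v≢x : v ≢ x
        v≢x refl = toggled⁻ G tx p ux
      from : ∀ {v} → Adj G u v × v ≢ x → Adj (switch G) u v × v ≢ y
      from {v} (p , v≢x) = kept⁺ G (away v≢x v≢y) p , v≢y
        where
        v≢y : v ≢ y
        v≢y refl = ¬uy p

    degree-switch : ∀ u → countᶠ (adj? (switch G) u) ≡ 3
    degree-switch u with u Fin.≟ a | u Fin.≟ b | u Fin.≟ c | u Fin.≟ d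
    ... | yes refl | _ | _ | _ =
      row-swap ab ¬ac (inj₁ (inj₁ (inj₁ (refl , refl)))) (inj₂ (inj₁ (inj₁ (refl , refl)))) λ where
        (inj₁ (inj₁ (inj₁ (_ , e)))) → inj₁ e
        (inj₁ (inj₁ (inj₂ (e , _)))) → contradiction e a≢b
        (inj₁ (inj₂ (inj₁ (e , _)))) → contradiction (sym e) c≢a
        (inj₁ (inj₂ (inj₂ (e , _)))) → contradiction (sym e) d≢a
        (inj₂ (inj₁ (inj₁ (_ , e)))) → inj₂ e
        (inj₂ (inj₁ (inj₂ (e , _)))) → contradiction (sym e) c≢a
        (inj₂ (inj₂ (inj₁ (e , _)))) → contradiction e a≢b
        (inj₂ (inj₂ (inj₂ (e , _)))) → contradiction (sym e) d≢a
    ... | no _ | yes refl | _ | _ =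
      row-swap (adj-sym ab) ¬bd (inj₁ (inj₁ (inj₂ (refl , refl)))) (inj₂ (inj₂ (inj₁ (refl , refl)))) λ where
        (inj₁ (inj₁ (inj₁ (e , _)))) → contradiction (sym e) a≢b
        (inj₁ (inj₁ (inj₂ (_ , e)))) → inj₁ e
        (inj₁ (inj₂ (inj₁ (e , _)))) → contradiction (sym e) c≢b
        (inj₁ (inj₂ (inj₂ (e , _)))) → contradiction (sym e) d≢b
        (inj₂ (inj₁ (inj₁ (e , _)))) → contradiction (sym e) a≢b
        (inj₂ (inj₁ (inj₂ (e , _)))) → contradiction (sym e) c≢b
        (inj₂ (inj₂ (inj₁ (_ , e)))) → inj₂ e
        (inj₂ (inj₂ (inj₂ (e , _)))) → contradiction (sym e) d≢b
    ... | no _ | no _ | yes refl | _ =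
      row-swap cd (¬ac ∘ adj-sym) (inj₁ (inj₂ (inj₁ (refl , refl)))) (inj₂ (inj₁ (inj₂ (refl , refl)))) λ where
        (inj₁ (inj₁ (inj₁ (e , _)))) → contradiction e c≢a
        (inj₁ (inj₁ (inj₂ (e , _)))) → contradiction e c≢b
        (inj₁ (inj₂ (inj₁ (_ , e)))) → inj₁ e
        (inj₁ (inj₂ (inj₂ (e , _)))) → contradiction e c≢d
        (inj₂ (inj₁ (inj₁ (e , _)))) → contradiction e c≢a
        (inj₂ (inj₁ (inj₂ (_ , e)))) → inj₂ e
        (inj₂ (inj₂ (inj₁ (e , _)))) → contradiction e c≢b
        (inj₂ (inj₂ (inj₂ (e , _)))) → contradiction e c≢d
    ... | no _ | no _ | no _ | yes refl =
      row-swap (adj-sym cd) (¬bd ∘ adj-sym) (inj₁ (inj₂ (inj₂ (refl , refl)))) (inj₂ (inj₂ (inj₂ (refl , refl)))) λ where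
        (inj₁ (inj₁ (inj₁ (e , _)))) → contradiction e d≢a
        (inj₁ (inj₁ (inj₂ (e , _)))) → contradiction e d≢b
        (inj₁ (inj₂ (inj₁ (e , _)))) → contradiction (sym e) c≢d
        (inj₁ (inj₂ (inj₂ (_ , e)))) → inj₁ e
        (inj₂ (inj₁ (inj₁ (e , _)))) → contradiction e d≢a
        (inj₂ (inj₁ (inj₂ (e , _)))) → contradiction (sym e) c≢d
        (inj₂ (inj₂ (inj₁ (e , _)))) → contradiction e d≢b
        (inj₂ (inj₂ (inj₂ (_ , e)))) → inj₂ e
    ... | no ua | no ub | no uc | no ud =
      trans (∑-cong (allFin n) λ v → ind-cong (adj? (switch G) u v) (adj? G u v) (kept⁻ G away) (kept⁺ G away))
        (degree u)
      where
      away : ∀ {v} → ¬ Toggled u v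
      away (inj₁ (inj₁ (inj₁ (e , _)))) = ua e
      away (inj₁ (inj₁ (inj₂ (e , _)))) = ub e
      away (inj₁ (inj₂ (inj₁ (e , _)))) = uc e
      away (inj₁ (inj₂ (inj₂ (e , _)))) = ud e
      away (inj₂ (inj₁ (inj₁ (e , _)))) = ua e
      away (inj₂ (inj₁ (inj₂ (e , _)))) = uc e
      away (inj₂ (inj₂ (inj₁ (e , _)))) = ub e
      away (inj₂ (inj₂ (inj₂ (e , _)))) = ud e

    cubic-switch : Cubic (switch G)
    cubic-switch = symm , (λ v p → adj-irrefl (kept⁻ G toggled-irrefl p)) ,
                   (λ v → trans (∣∣≡countᶠ (Vec.lookup (switch G) v)) (degree-switch v))
      where
      symm : ∀ u v → Adj (switch G) u v → Adj (switch G) v u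
      symm u v p = case toggled? u v of λ where
        (yes t) → toggled⁺ G (toggled-sym t) (toggled⁻ G t p ∘ adj-sym)
        (no ¬t) → kept⁺ G (¬t ∘ toggled-sym) (adj-sym (kept⁻ G ¬t p))

    ac-switch : Adj (switch G) a c
    ac-switch = toggled⁺ G (inj₂ (inj₁ (inj₁ (refl , refl)))) ¬ac

    bd-switch : Adj (switch G) b d
    bd-switch = toggled⁺ G (inj₂ (inj₂ (inj₁ (refl , refl)))) ¬bd

    -- Of the four flipped pairs, `cd` and `ac` contain `c`, `ab` is excluded by hypothesis, and
    -- `bd` is no edge of `G` and so cannot be lost. A path avoiding `c` and the edge `ab` therefore
    -- survives, even if it meets `d`.
    edge-kept : ∀ {u v} → Adj G u v → ¬ SameEdge a b u v → u ≢ c → v ≢ c → Adj (switch G) u v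
    edge-kept {u} {v} p ¬ab u≢c v≢c = kept⁺ G ¬t p
      where
      ¬t : ¬ Toggled u v
      ¬t (inj₁ (inj₁ e)) = ¬ab e
      ¬t (inj₁ (inj₂ (inj₁ (e , _)))) = u≢c e
      ¬t (inj₁ (inj₂ (inj₂ (_ , e)))) = v≢c e
      ¬t (inj₂ (inj₁ (inj₁ (_ , e)))) = v≢c e
      ¬t (inj₂ (inj₁ (inj₂ (e , _)))) = u≢c e
      ¬t (inj₂ (inj₂ (inj₁ (refl , refl)))) = ¬bd p
      ¬t (inj₂ (inj₂ (inj₂ (refl , refl)))) = ¬bd (adj-sym p)

    linked-switch : ∀ {xs} → Linked (Adj G) xs → Linked (λ u v → ¬ SameEdge a b u v) xs → c ∉ xs →
                    Linked (Adj (switch G)) xs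
    linked-switch [] _ _ = []
    linked-switch [-] _ _ = [-]
    linked-switch (p ∷ ps) (e ∷ es) c∉ =
      edge-kept p e (λ { refl → c∉ (here refl) }) (λ { refl → c∉ (there (here refl)) })
      ∷ linked-switch ps es (c∉ ∘ there)

∈-allVecs : ∀ {A : Set} {xs : List A} → (∀ x → x ∈ xs) → ∀ {m} (v : Vec A m) → v ∈ allVecs xs m
∈-allVecs all [] = here refl
∈-allVecs {xs = xs} all {suc m} (x ∷ v) =
  ∈-concatMap⁺ (λ x → map (x ∷_) (allVecs xs m))
    (Any.map (λ { refl → ∈-map⁺ (x ∷_) (∈-allVecs all v) }) (all x))

allVecs-unique : ∀ {A : Set} {xs : List A} → Unique xs → ∀ m → Unique (allVecs xs m)
allVecs-unique u zero = [] ∷ []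
allVecs-unique {A} {xs} u (suc m) = go xs u
  where
  vs = allVecs xs m
  go : ∀ ys → Unique ys → Unique (concatMap (λ x → map (x ∷_) vs) ys)
  go [] [] = []
  go (y ∷ ys) (y∉ ∷ uys) = Unique.++⁺
    (Unique.map⁺ {f = y ∷_} Vec.∷-injectiveʳ (allVecs-unique u m)) (go ys uys) disjoint
    where
    disjoint : ∀ {v} → ¬ (v ∈ map (y ∷_) vs × v ∈ concatMap (λ x → map (x ∷_) vs) ys)
    disjoint (p , q) with ∈-map⁻ (y ∷_) p | find (∈-concatMap⁻ (λ x → map (x ∷_) vs) {xs = ys} q)
    ... | _ , _ , refl | z , z∈ , q′ with ∈-map⁻ (z ∷_) q′
    ... | _ , _ , refl = All.lookup y∉ z∈ refl

∈-allGraphs : ∀ {n} (G : Graph n) → G ∈ allGraphs n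
∈-allGraphs = ∈-allVecs (∈-allVecs (λ { true → here refl ; false → there (here refl) }))

allGraphs-unique : ∀ n → Unique (allGraphs n)
allGraphs-unique n = allVecs-unique (allVecs-unique (((λ ()) ∷ []) ∷ [] ∷ []) n) n

length-concatMap : ∀ {A B : Set} (f : A → List B) k → (∀ x → length (f x) ≡ k) →
                   ∀ xs → length (concatMap f xs) ≡ length xs * k
length-concatMap f k h [] = refl
length-concatMap f k h (x ∷ xs) =
  trans (List.length-++ (f x)) (cong₂ _+_ (h x) (length-concatMap f k h xs))

count-∈-≤ : ∀ {n} (xs : List (Fin n)) → countᶠ (λ v → v ∈?ᶠ xs) ≤ length xs
count-∈-≤ {n} xs = ≤-trans (≤-reflexive (sym (length-filter-count (_∈?ᶠ xs) (allFin n))))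
  (Unique-⊆⇒length≤ (Unique.filter⁺ (_∈?ᶠ xs) (Unique.allFin⁺ n))
    (λ v∈ → proj₂ (∈-filter⁻ (_∈?ᶠ xs) {xs = allFin n} v∈)))

count-∉-≥ : ∀ {n} (xs : List (Fin n)) → n ∸ length xs ≤ countᶠ (λ v → ¬? (v ∈?ᶠ xs))
count-∉-≥ {n} xs = m≤n+o⇒m∸n≤o n (length xs) (begin
  n                                        ≡⟨ sym (trans (∑-const (allFin n) 1) (trans (*-identityʳ _) (length-allFin n))) ⟩
  ∑ (allFin n) (λ _ → 1)                   ≤⟨ ∑-mono′ (allFin n) split ⟩
  ∑ (allFin n) (λ v → ind (v ∈?ᶠ xs) + ind (¬? (v ∈?ᶠ xs)))  ≡⟨ ∑-+ (allFin n) _ _ ⟩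
  countᶠ (λ v → v ∈?ᶠ xs) + countᶠ (λ v → ¬? (v ∈?ᶠ xs))      ≤⟨ +-monoˡ-≤ _ (count-∈-≤ xs) ⟩
  length xs + countᶠ (λ v → ¬? (v ∈?ᶠ xs)) ∎)
  where
  open ≤-Reasoning
  split : ∀ v → 1 ≤ ind (v ∈?ᶠ xs) + ind (¬? (v ∈?ᶠ xs))
  split v with v ∈?ᶠ xs
  ... | yes _ = ≤-refl
  ... | no _ = ≤-refl

module SwitchCount {n : ℕ} (a b : Fin n) (xs : List (Fin n))
                   (¬edge : Linked (λ u v → ¬ SameEdge a b u v) xs) where

  Before After : Graph n → Set
  Before G = Cubic G × Linked (Adj G) xs × Adj G a b
  After G = Cubic G × Linked (Adj G) xs

  before? : ∀ G → Dec (Before G)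
  before? G = cubic? G ×-dec linked? (adj? G) xs ×-dec adj? G a b

  after? : ∀ G → Dec (After G)
  after? G = cubic? G ×-dec linked? (adj? G) xs

  Valid : Graph n → Fin n → Fin n → Set
  Valid G c d = Adj G c d × c ≢ a × c ≢ b × d ≢ a × d ≢ b × ¬ Adj G a c × ¬ Adj G b d × c ∉ xs

  valid? : ∀ G c d → Dec (Valid G c d)
  valid? G c d = adj? G c d ×-dec ¬? (c Fin.≟ a) ×-dec ¬? (c Fin.≟ b) ×-dec ¬? (d Fin.≟ a)
    ×-dec ¬? (d Fin.≟ b) ×-dec ¬? (adj? G a c) ×-dec ¬? (adj? G b d) ×-dec ¬? (c ∈?ᶠ xs)

  -- 17 = 2 + 3 + 3 + 9: the vertices `a` and `b`, their neighbours, and the neighbours of the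
  -- neighbours of `b`.
  excluded : ℕ
  excluded = 17 + length xs

  -- Every condition on `d` is implied by one on `c`: if `c` is no neighbour of `a` or `b`, then `d`
  -- is neither of them, and if `c` is not two steps from `b`, then `bd` is no edge. So any
  -- neighbour `d` of an allowed `c` will do.
  many-valid : ∀ G → Cubic G → n ∸ excluded ≤ ∑ (allFin n) (λ c → ∑ (allFin n) (λ d → ind (valid? G c d)))
  many-valid G cubic = ≤-trans (subst (λ k → n ∸ k ≤ countᶠ (λ c → ¬? (c ∈?ᶠ forbidden))) length-forbidden
    (count-∉-≥ forbidden)) (∑-mono′ (allFin n) λ c → pointwise c)
    where
    open CubicGraph G cubic
    forbidden = a ∷ b ∷ nbrs a ++ nbrs b ++ concatMap nbrs (nbrs b) ++ xs
    length-forbidden : length forbidden ≡ excluded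
    length-forbidden = cong (2 +_) (trans (List.length-++ (nbrs a)) (cong₂ _+_ (length-nbrs a)
      (trans (List.length-++ (nbrs b)) (cong₂ _+_ (length-nbrs b)
        (trans (List.length-++ (concatMap nbrs (nbrs b))) (cong (_+ length xs)
          (trans (length-concatMap nbrs 3 length-nbrs (nbrs b)) (cong (_* 3) (length-nbrs b)))))))))
    pointwise : ∀ c → ind (¬? (c ∈?ᶠ forbidden)) ≤ ∑ (allFin n) (λ d → ind (valid? G c d))
    pointwise c = ind-≤ (¬? (c ∈?ᶠ forbidden)) λ c∉ → case another-nbr c [] (s≤s z≤n) of λ where
      (d , cd , _) → 1≤countᶠ (valid? G c) {d}
        (cd , (λ { refl → c∉ (here refl) }) , (λ { refl → c∉ (there (here refl)) })
        , (λ { refl → c∉ (there (there (∈-++⁺ˡ (∈-nbrs⁺ (adj-sym cd))))) })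
        , (λ { refl → c∉ (there (there (∈-++⁺ʳ (nbrs a) (∈-++⁺ˡ (∈-nbrs⁺ (adj-sym cd)))))) })
        , (λ ac → c∉ (there (there (∈-++⁺ˡ (∈-nbrs⁺ ac)))))
        , (λ bd → c∉ (there (there (∈-++⁺ʳ (nbrs a) (∈-++⁺ʳ (nbrs b) (∈-++⁺ˡ
            (∈-concatMap⁺ nbrs (Any.map (λ { refl → ∈-nbrs⁺ (adj-sym cd) }) (∈-nbrs⁺ bd)))))))))
        , (λ c∈ → c∉ (there (there (∈-++⁺ʳ (nbrs a) (∈-++⁺ʳ (nbrs b) (∈-++⁺ʳ (concatMap nbrs (nbrs b)) c∈)))))))

  all = allGraphs n
  V = allFin n

  -- Double counting of the switchings {ab, cd} → {ac, bd}: a graph on the left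
  -- admits at least n − excluded of them, and one on the right arises from at most 9.
  switch-count : count before? all * (n ∸ excluded) ≤ 9 * count after? all
  switch-count = begin
    count before? all * (n ∸ excluded)
      ≡⟨ sym (∑-*ʳ all (n ∸ excluded) _) ⟩
    ∑ all (λ G → ind (before? G) * (n ∸ excluded))
      ≤⟨ ∑-mono′ all left ⟩
    ∑ all (λ G → ∑ V (λ c → ∑ V (λ d → ind (before? G) * ind (valid? G c d))))
      ≡⟨ rearrange _ ⟩
    ∑ V (λ c → ∑ V (λ d → ∑ all (λ G → ind (before? G) * ind (valid? G c d))))
      ≤⟨ ∑-mono′ V (λ c → ∑-mono′ V (inject c)) ⟩
    ∑ V (λ c → ∑ V (λ d → ∑ all (λ G → ind (after? G) * (ind (adj? G a c) * ind (adj? G b d)))))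
      ≡⟨ sym (rearrange _) ⟩
    ∑ all (λ G → ∑ V (λ c → ∑ V (λ d → ind (after? G) * (ind (adj? G a c) * ind (adj? G b d)))))
      ≡⟨ ∑-cong all right ⟩
    ∑ all (λ G → 9 * ind (after? G))
      ≡⟨ ∑-*ˡ all 9 _ ⟩
    9 * count after? all ∎
    where
    open ≤-Reasoning
    rearrange : (f : Graph n → Fin n → Fin n → ℕ) →
                ∑ all (λ G → ∑ V (λ c → ∑ V (λ d → f G c d))) ≡ ∑ V (λ c → ∑ V (λ d → ∑ all (λ G → f G c d)))
    rearrange f = trans (∑-swap all V _) (∑-cong V λ c → ∑-swap all V (λ G d → f G c d))

    left : ∀ G → ind (before? G) * (n ∸ excluded) ≤
                 ∑ V (λ c → ∑ V (λ d → ind (before? G) * ind (valid? G c d)))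
    left G = ind-elim
      (λ k → k * (n ∸ excluded) ≤ ∑ V (λ c → ∑ V (λ d → k * ind (valid? G c d)))) (before? G)
      (λ (cubic , _) → ≤-trans (≤-reflexive (+-identityʳ _)) (≤-trans (many-valid G cubic)
        (≤-reflexive (∑-cong V λ c → ∑-cong V λ d → sym (+-identityʳ _)))))
      (λ _ → z≤n)

    inject : ∀ c d → ∑ all (λ G → ind (before? G) * ind (valid? G c d)) ≤
                     ∑ all (λ G → ind (after? G) * (ind (adj? G a c) * ind (adj? G b d)))
    inject c d = begin
      ∑ all (λ G → ind (before? G) * ind (valid? G c d))
        ≡⟨ ∑-cong all (λ G → sym (ind-× (before? G) (valid? G c d))) ⟩
      count (λ G → before? G ×-dec valid? G c d) all
        ≤⟨ count-injection (λ G → before? G ×-dec valid? G c d) (λ G → after? G ×-dec (adj? G a c ×-dec adj? G b d)) switch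
             (allGraphs-unique n) image (λ G H _ _ → switch-injective) ⟩
      count (λ G → after? G ×-dec (adj? G a c ×-dec adj? G b d)) all
        ≡⟨ ∑-cong all (λ G → trans (ind-× (after? G) (adj? G a c ×-dec adj? G b d))
             (cong (ind (after? G) *_) (ind-× (adj? G a c) (adj? G b d)))) ⟩
      ∑ all (λ G → ind (after? G) * (ind (adj? G a c) * ind (adj? G b d))) ∎
      where
      open Switch a b c d
      image : ∀ G → G ∈ all → Before G × Valid G c d →
              switch G ∈ all × After (switch G) × Adj (switch G) a c × Adj (switch G) b d
      image G _ ((cubic , linked , ab) , cd , c≢a , c≢b , d≢a , d≢b , ¬ac , ¬bd , c∉) =
        ∈-allGraphs _ , (cubic-switch , linked-switch linked ¬edge c∉) , ac-switch , bd-switch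
        where open Valid {G} cubic ab cd c≢a c≢b d≢a d≢b ¬ac ¬bd

    right : ∀ G → ∑ V (λ c → ∑ V (λ d → ind (after? G) * (ind (adj? G a c) * ind (adj? G b d)))) ≡
                  9 * ind (after? G)
    right G = ind-elim
      (λ k → ∑ V (λ c → ∑ V (λ d → k * (ind (adj? G a c) * ind (adj? G b d)))) ≡ 9 * k) (after? G)
      (λ (cubic , _) → let open CubicGraph G cubic in begin-equality
        ∑ V (λ c → ∑ V (λ d → ind (adj? G a c) * ind (adj? G b d) + 0))
          ≡⟨ ∑-cong V (λ c → trans (∑-cong V λ d → +-identityʳ _)
               (trans (∑-*ˡ V (ind (adj? G a c)) _) (cong (ind (adj? G a c) *_) (degree b)))) ⟩
        ∑ V (λ c → ind (adj? G a c) * 3)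
          ≡⟨ trans (∑-*ʳ V 3 _) (cong (_* 3) (degree a)) ⟩
        9 ∎)
      (λ _ → trans (∑-cong V λ c → ∑-zero V) (∑-zero V))

-- Almost all cubic graphs have few vertices near short cycles

ind-any : ∀ {A : Set} {P : A → Set} (P? : ∀ x → Dec (P x)) xs → ind (any? P? xs) ≤ ∑ xs (ind ∘ P?)
ind-any P? xs = ind-≤ (any? P? xs) λ p → case find p of λ where
  (x , x∈ , px) → ≤-trans (≤-reflexive (sym (ind-yes (P? x) px))) (∈⇒≤∑ (ind ∘ P?) x∈)

module LollipopCount (n L : ℕ) where

  all = allGraphs n
  lists = listsUpTo n L

  -- Since `c` comes after `b`, the closing edge `ac` is not an edge of the path, so a switching can
  -- remove it and leave the path intact.
  closing-edge-off-path : ∀ {a b c : Fin n} {cs} → Unique (a ∷ b ∷ cs) → c ∈ cs →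
                          Linked (λ u v → ¬ SameEdge a c u v) (a ∷ b ∷ cs)
  closing-edge-off-path {a} {b} {c} ((a≢b ∷ a≢cs) ∷ b≢cs ∷ _) c∈ = first ∷ rest (a≢b ∷ a≢cs)
    where
    first : ¬ SameEdge a c a b
    first (inj₁ (_ , e)) = All.lookup b≢cs c∈ e
    first (inj₂ (_ , e)) = a≢b (sym e)
    rest : ∀ {ys} → All (a ≢_) ys → Linked (λ u v → ¬ SameEdge a c u v) ys
    rest [] = []
    rest (_ ∷ []) = [-]
    rest (p ∷ q ∷ ps) = (λ { (inj₁ (e , _)) → p (sym e) ; (inj₂ (_ , e)) → q (sym e) }) ∷ rest (q ∷ ps)

  cubic-lollipop? : ∀ (xs : List (Fin n)) (G : Graph n) → Dec (Cubic G × Lollipop G xs)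
  cubic-lollipop? xs G = cubic? G ×-dec lollipop? G xs

  cubic-linked? : ∀ (xs : List (Fin n)) (G : Graph n) → Dec (Cubic G × Linked (Adj G) xs)
  cubic-linked? xs G = cubic? G ×-dec linked? (adj? G) xs

  count-none : ∀ {xs} {k} → (∀ G → ¬ Lollipop G xs) → count (cubic-lollipop? xs) all * k ≡ 0
  count-none {xs} {k} none = cong (_* k)
    (trans (∑-cong all λ G → ind-no (cubic-lollipop? xs G) (none G ∘ proj₂)) (∑-zero all))

  -- A union bound over the vertex `c` where the head closes the cycle: given the path, each closing
  -- edge is present with conditional probability at most 9 / (n - 17 - L).
  lollipop-count : ∀ xs → length xs ≤ L →
    count (cubic-lollipop? xs) all * (n ∸ (17 + L)) ≤ L * (9 * count (cubic-linked? xs) all)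
  lollipop-count [] l = ≤-trans (≤-reflexive (count-none {[]} (λ _ ()))) z≤n
  lollipop-count (a ∷ []) l = ≤-trans (≤-reflexive (count-none {a ∷ []} (λ _ ()))) z≤n
  lollipop-count xs@(a ∷ b ∷ cs) l with unique? xs
    where open import Data.List.Relation.Unary.Unique.DecPropositional Fin._≟_ using (unique?)
  ... | no ¬u = ≤-trans (≤-reflexive (count-none {xs} (λ _ → ¬u ∘ proj₁))) z≤n
  ... | yes u = begin
    count (cubic-lollipop? xs) all * m
      ≤⟨ *-monoˡ-≤ m (∑-mono′ all by-closing-edge) ⟩
    ∑ all (λ G → ∑ cs (λ c → ind (before? c G))) * m
      ≡⟨ cong (_* m) (∑-swap all cs _) ⟩
    ∑ cs (λ c → count (before? c) all) * m
      ≡⟨ sym (∑-*ʳ cs m _) ⟩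
    ∑ cs (λ c → count (before? c) all * m)
      ≤⟨ ∑-mono cs (λ c c∈ → ≤-trans (*-monoʳ-≤ (count (before? c) all) (∸-monoʳ-≤ n (+-monoʳ-≤ 17 l)))
           (SwitchCount.switch-count a c xs (closing-edge-off-path u c∈))) ⟩
    ∑ cs (λ c → 9 * count (cubic-linked? xs) all)
      ≡⟨ ∑-const cs _ ⟩
    length cs * (9 * count (cubic-linked? xs) all)
      ≤⟨ *-monoˡ-≤ _ (≤-trans (n≤1+n _) (≤-trans (n≤1+n _) l)) ⟩
    L * (9 * count (cubic-linked? xs) all) ∎
    where
    open ≤-Reasoning
    m = n ∸ (17 + L)
    before? : ∀ c G → Dec (Cubic G × Linked (Adj G) xs × Adj G a c)
    before? c G = cubic? G ×-dec linked? (adj? G) xs ×-dec adj? G a c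
    by-closing-edge : ∀ G → ind (cubic-lollipop? xs G) ≤ ∑ cs (λ c → ind (before? c G))
    by-closing-edge G = ind-≤ (cubic-lollipop? xs G) λ (cubic , _ , linked , closing) →
      case find closing of λ where
        (c , c∈ , ac) → ≤-trans (≤-reflexive (sym (ind-yes (before? c G) (cubic , linked , ac))))
          (∈⇒≤∑ (λ c → ind (before? c G)) c∈)

  -- The list is empty or continues with one of three neighbours. Base 4 instead of 3 absorbs the
  -- shorter lists, as 1 + 3 · 4^k ≤ 4^(k+1).
  walks-from : ∀ {G : Graph n} → Cubic G → ∀ k a →
               count (λ xs → linked? (adj? G) (a ∷ xs)) (listsUpTo n k) ≤ 4 ^ k
  walks-from {G} cubic zero a = ≤-trans (+-monoˡ-≤ 0 (ind-≤1 (linked? (adj? G) (a ∷ [])))) ≤-refl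
  walks-from {G} cubic (suc k) a = begin
    ind (linked? (adj? G) (a ∷ [])) + ∑ (concatMap (λ v → map (v ∷_) (listsUpTo n k)) (allFin n)) w
      ≤⟨ +-monoˡ-≤ _ (ind-≤1 (linked? (adj? G) (a ∷ []))) ⟩
    1 + ∑ (concatMap (λ v → map (v ∷_) (listsUpTo n k)) (allFin n)) w
      ≡⟨ cong (1 +_) (trans (∑-concatMap (λ v → map (v ∷_) (listsUpTo n k)) (allFin n) w)
           (∑-cong (allFin n) λ v → ∑-map (v ∷_) (listsUpTo n k) w)) ⟩
    1 + ∑ (allFin n) (λ v → ∑ (listsUpTo n k) (λ xs → w (v ∷ xs)))
      ≤⟨ +-monoʳ-≤ 1 (∑-mono′ (allFin n) λ v → ≤-trans (∑-mono′ (listsUpTo n k) (λ xs → w-∷ v xs))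
           (≤-trans (≤-reflexive (∑-*ˡ (listsUpTo n k) (ind (adj? G a v)) _))
             (*-monoʳ-≤ (ind (adj? G a v)) (walks-from {G} cubic k v)))) ⟩
    1 + ∑ (allFin n) (λ v → ind (adj? G a v) * 4 ^ k)
      ≡⟨ cong (1 +_) (trans (∑-*ʳ (allFin n) (4 ^ k) _) (cong (_* 4 ^ k) (degree a))) ⟩
    1 + 3 * 4 ^ k
      ≤⟨ +-monoˡ-≤ (3 * 4 ^ k) (m^n>0 4 k) ⟩
    4 ^ suc k ∎
    where
    open ≤-Reasoning
    open CubicGraph G cubic
    w : List (Fin n) → ℕ
    w xs = ind (linked? (adj? G) (a ∷ xs))
    w-∷ : ∀ v xs → w (v ∷ xs) ≤ ind (adj? G a v) * ind (linked? (adj? G) (v ∷ xs))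
    w-∷ v xs = ≤-trans (ind-mono (linked? (adj? G) (a ∷ v ∷ xs)) (adj? G a v ×-dec linked? (adj? G) (v ∷ xs))
        (λ { (p ∷ ps) → p , ps }))
      (≤-reflexive (ind-× (adj? G a v) (linked? (adj? G) (v ∷ xs))))

  walks : ∀ {G : Graph n} → Cubic G → ∀ k → count (linked? (adj? G)) (listsUpTo n k) ≤ suc n * 4 ^ k
  walks {G} cubic zero = s≤s z≤n
  walks {G} cubic (suc k) = begin
    1 + ∑ (concatMap (λ v → map (v ∷_) (listsUpTo n k)) (allFin n)) w
      ≡⟨ cong (1 +_) (trans (∑-concatMap (λ v → map (v ∷_) (listsUpTo n k)) (allFin n) w)
           (∑-cong (allFin n) λ v → ∑-map (v ∷_) (listsUpTo n k) w)) ⟩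
    1 + ∑ (allFin n) (λ v → ∑ (listsUpTo n k) (λ xs → w (v ∷ xs)))
      ≤⟨ +-monoʳ-≤ 1 (∑-mono′ (allFin n) (walks-from {G} cubic k)) ⟩
    1 + ∑ (allFin n) (λ _ → 4 ^ k)
      ≡⟨ cong (1 +_) (trans (∑-const (allFin n) (4 ^ k)) (cong (_* 4 ^ k) (length-allFin n))) ⟩
    1 + n * 4 ^ k
      ≤⟨ +-mono-≤ (m^n>0 4 (suc k)) (*-monoʳ-≤ n (^-monoʳ-≤ 4 (n≤1+n k))) ⟩
    suc n * 4 ^ suc k ∎
    where
    open ≤-Reasoning
    w : List (Fin n) → ℕ
    w xs = ind (linked? (adj? G) xs)

  #bad-≤ : (G : Graph n) → #bad L G ≤ L * count (lollipop? G) lists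
  #bad-≤ G = begin
    ∑ (allFin n) (λ v → ind (bad? L G v))
      ≤⟨ ∑-mono′ (allFin n) (λ v → ind-any (λ xs → v ∈?ᶠ xs ×-dec lollipop? G xs) lists) ⟩
    ∑ (allFin n) (λ v → ∑ lists (λ xs → ind (v ∈?ᶠ xs ×-dec lollipop? G xs)))
      ≡⟨ ∑-swap (allFin n) lists _ ⟩
    ∑ lists (λ xs → ∑ (allFin n) (λ v → ind (v ∈?ᶠ xs ×-dec lollipop? G xs)))
      ≤⟨ ∑-mono lists (λ xs xs∈ → ≤-trans (≤-reflexive (trans
             (∑-cong (allFin n) (λ v → ind-× (v ∈?ᶠ xs) (lollipop? G xs)))
             (∑-*ʳ (allFin n) (ind (lollipop? G xs)) _)))
           (*-monoˡ-≤ (ind (lollipop? G xs)) (≤-trans (count-∈-≤ xs) (length-listsUpTo L xs∈)))) ⟩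
    ∑ lists (λ xs → L * ind (lollipop? G xs))
      ≡⟨ ∑-*ˡ lists L _ ⟩
    L * count (lollipop? G) lists ∎
    where open ≤-Reasoning

  total-bad : ℕ
  total-bad = ∑ all (λ G → ind (cubic? G) * #bad L G)

  -- First moment: a cubic graph has of order n · 4^L paths to consider, and each closes up with
  -- probability of order 1/n. So for fixed `L` the average of `#bad` stays bounded. One factor `L`
  -- counts the vertices on a lollipop, the other its possible closing edges.
  total-bad-≤ : total-bad * (n ∸ (17 + L)) ≤ 9 * L * L * 4 ^ L * suc n * numCubic n
  total-bad-≤ = begin
    total-bad * m
      ≤⟨ *-monoˡ-≤ m (∑-mono′ all λ G → *-monoʳ-≤ (ind (cubic? G)) (#bad-≤ G)) ⟩
    ∑ all (λ G → ind (cubic? G) * (L * count (lollipop? G) lists)) * m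
      ≡⟨ cong (_* m) (trans (∑-cong all λ G → trans (swap-factor (ind (cubic? G)) L _)
           (cong (L *_) (expand G (λ xs → lollipop? G xs)))) (∑-*ˡ all L _)) ⟩
    L * ∑ all (λ G → ∑ lists (λ xs → ind (cubic-lollipop? xs G))) * m
      ≡⟨ trans (*-assoc L _ m) (cong (L *_) (trans (cong (_* m) (∑-swap all lists _)) (sym (∑-*ʳ lists m _)))) ⟩
    L * ∑ lists (λ xs → count (cubic-lollipop? xs) all * m)
      ≤⟨ *-monoʳ-≤ L (∑-mono lists (λ xs xs∈ → lollipop-count xs (length-listsUpTo L xs∈))) ⟩
    L * ∑ lists (λ xs → L * (9 * count (cubic-linked? xs) all))
      ≡⟨ cong (L *_) (trans (∑-*ˡ lists L _) (cong (L *_) (∑-*ˡ lists 9 _))) ⟩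
    L * (L * (9 * ∑ lists (λ xs → count (cubic-linked? xs) all)))
      ≡⟨ cong (λ k → L * (L * (9 * k))) (trans (∑-swap lists all _) (∑-cong all λ G → sym (expand G (linked? (adj? G))))) ⟩
    L * (L * (9 * ∑ all (λ G → ind (cubic? G) * count (linked? (adj? G)) lists)))
      ≤⟨ *-monoʳ-≤ L (*-monoʳ-≤ L (*-monoʳ-≤ 9 (∑-mono′ all λ G →
           ind-elim (λ k → k * count (linked? (adj? G)) lists ≤ k * (suc n * 4 ^ L)) (cubic? G)
             (λ cubic → *-monoʳ-≤ 1 (walks {G} cubic L)) (λ _ → z≤n)))) ⟩
    L * (L * (9 * ∑ all (λ G → ind (cubic? G) * (suc n * 4 ^ L))))
      ≡⟨ cong (λ k → L * (L * (9 * k))) (trans (∑-*ʳ all _ _)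
           (cong (_* (suc n * 4 ^ L)) (sym (length-filter-count cubic? all)))) ⟩
    L * (L * (9 * (numCubic n * (suc n * 4 ^ L))))
      ≡⟨ shuffle L (numCubic n) (suc n) (4 ^ L) ⟩
    9 * L * L * 4 ^ L * suc n * numCubic n ∎
    where
    open ≤-Reasoning
    m = n ∸ (17 + L)
    swap-factor : ∀ x y z → x * (y * z) ≡ y * (x * z)
    swap-factor = solve-∀
    shuffle : ∀ L N s p → L * (L * (9 * (N * (s * p)))) ≡ 9 * L * L * p * s * N
    shuffle = solve-∀
    expand : ∀ G {P : List (Fin n) → Set} (P? : ∀ xs → Dec (P xs)) →
             ind (cubic? G) * count P? lists ≡ ∑ lists (λ xs → ind (cubic? G ×-dec P? xs))
    expand G P? = trans (sym (∑-*ˡ lists (ind (cubic? G)) _))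
      (∑-cong lists λ xs → sym (ind-× (cubic? G) (P? xs)))

few-bad? : ∀ (q L : ℕ) {n} (G : Graph n) → Dec (Cubic G × q * #bad L G ≤ n)
few-bad? q L {n} G = cubic? G ×-dec (q * #bad L G ≤? n)

-- Markov's inequality: the average of `#bad` is bounded, so `#bad` exceeds n/q only for a
-- proportion O(1/n) of the cubic graphs.
most-cubic-graphs-have-few-bad : ∀ q L b → ∃[ N ] (∀ n → N ≤ n →
  b * numCubic n ≤ suc b * length (filter (few-bad? q L) (allGraphs n)))
most-cubic-graphs-have-few-bad q L b = 17 + L + E , bound
  where
  -- `D` is the constant of `total-bad-≤` times `q`. It is doubled because suc n ≤ 2n, the successor
  -- keeps the factor cancelled in `many-rare` positive, and `suc b` is the rarity asked for.
  D = 9 * L * L * 4 ^ L * q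
  E = suc (2 * D) * suc b
  bound : ∀ n → 17 + L + E ≤ n → b * numCubic n ≤ suc b * length (filter (few-bad? q L) (allGraphs n))
  bound n N≤n = +-cancelʳ-≤ N₀ _ _ (begin
    b * N₀ + N₀                ≡⟨ +-comm (b * N₀) N₀ ⟩
    suc b * N₀                 ≤⟨ *-monoʳ-≤ (suc b) split ⟩
    suc b * (good + many)      ≡⟨ *-distribˡ-+ (suc b) good many ⟩
    suc b * good + suc b * many ≤⟨ +-monoʳ-≤ (suc b * good) many-rare ⟩
    suc b * good + N₀          ∎)
    where
    open ≤-Reasoning
    open LollipopCount n L
    N₀ = numCubic n
    good = length (filter (few-bad? q L) all)
    many-bad? : ∀ G → Dec (Cubic G × ¬ q * #bad L G ≤ n)
    many-bad? G = cubic? G ×-dec ¬? (q * #bad L G ≤? n)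
    many = count many-bad? all
    split : N₀ ≤ good + many
    split = begin
      N₀ ≡⟨ length-filter-count cubic? all ⟩
      count cubic? all ≤⟨ count-⊎ cubic? (few-bad? q L) many-bad? all (λ G cubic →
        case q * #bad L G ≤? n of λ where
          (yes p) → inj₁ (cubic , p)
          (no ¬p) → inj₂ (cubic , ¬p)) ⟩
      count (few-bad? q L) all + many ≡⟨ cong (_+ many) (sym (length-filter-count (few-bad? q L) all)) ⟩
      good + many ∎
    m = n ∸ (17 + L)
    E≤m : E ≤ m
    E≤m = m+n≤o⇒m≤o∸n E (≤-trans (≤-reflexive (+-comm E (17 + L))) N≤n)
    1≤n : 1 ≤ n
    1≤n = ≤-trans (s≤s z≤n) N≤n
    markov : many * n ≤ q * total-bad
    markov = begin
      many * n ≡⟨ sym (∑-*ʳ all n _) ⟩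
      ∑ all (λ G → ind (many-bad? G) * n) ≤⟨ ∑-mono′ all (λ G →
        ind-elim (λ k → k * n ≤ q * (ind (cubic? G) * #bad L G)) (many-bad? G)
          (λ (cubic , ¬few) → begin
            n + 0 ≡⟨ +-identityʳ n ⟩
            n ≤⟨ <⇒≤ (≰⇒> ¬few) ⟩
            q * #bad L G ≡⟨ cong (q *_) (sym (trans (cong (_* #bad L G) (ind-yes (cubic? G) cubic)) (+-identityʳ _))) ⟩
            q * (ind (cubic? G) * #bad L G) ∎)
          (λ _ → z≤n)) ⟩
      ∑ all (λ G → q * (ind (cubic? G) * #bad L G)) ≡⟨ ∑-*ˡ all q _ ⟩
      q * total-bad ∎
    many-rare : suc b * many ≤ N₀
    many-rare = *-cancelˡ-≤ (suc (2 * D) * n) {{>-nonZero (*-mono-≤ {1} {suc (2 * D)} (s≤s z≤n) 1≤n)}} (begin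
      suc (2 * D) * n * (suc b * many)  ≡⟨ shuffle₁ (suc (2 * D)) n (suc b) many ⟩
      many * n * E                      ≤⟨ *-mono-≤ markov E≤m ⟩
      q * total-bad * m                 ≡⟨ *-assoc q total-bad m ⟩
      q * (total-bad * m)               ≤⟨ *-monoʳ-≤ q total-bad-≤ ⟩
      q * (9 * L * L * 4 ^ L * suc n * N₀) ≡⟨ shuffle₂ q L (4 ^ L) (suc n) N₀ ⟩
      D * suc n * N₀                    ≤⟨ *-monoˡ-≤ N₀ (*-monoʳ-≤ D (+-monoˡ-≤ n 1≤n)) ⟩
      D * (n + n) * N₀                  ≡⟨ shuffle₃ D n N₀ ⟩
      2 * D * n * N₀                    ≤⟨ *-monoˡ-≤ N₀ (*-monoˡ-≤ n (n≤1+n (2 * D))) ⟩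
      suc (2 * D) * n * N₀              ∎)
      where
      shuffle₁ : ∀ d n s m → d * n * (s * m) ≡ m * n * (d * s)
      shuffle₁ = solve-∀
      shuffle₂ : ∀ q L p s N → q * (9 * L * L * p * s * N) ≡ 9 * L * L * p * q * s * N
      shuffle₂ = solve-∀
      shuffle₃ : ∀ D n N → D * (n + n) * N ≡ 2 * D * n * N
      shuffle₃ = solve-∀

-- Ordering the segments

∑-≤⇒∃≤ : ∀ {A : Set} {x : A} (xs : List A) (f g : A → ℕ) → ∑ (x ∷ xs) f ≤ ∑ (x ∷ xs) g →
         ∃[ y ] (y ∈ x ∷ xs × f y ≤ g y)
∑-≤⇒∃≤ {x = x} xs f g h with f x ≤? g x
... | yes p = x , here refl , p
∑-≤⇒∃≤ {x = x} [] f g h | no ¬p =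
  contradiction (subst₂ _≤_ (+-identityʳ (f x)) (+-identityʳ (g x)) h) ¬p
∑-≤⇒∃≤ {x = x} (y ∷ ys) f g h | no ¬p
  with ∑-≤⇒∃≤ ys f g (≮⇒≥ λ lt → <⇒≱ (+-mono-< (≰⇒> ¬p) lt) h)
... | z , z∈ , q = z , there z∈ , q

module Ordering {K : ℕ} where

  Triple : Set
  Triple = Fin K × Fin K × Fin K

  Distinct : Triple → Set
  Distinct (a , b , c) = a ≢ b × a ≢ c × b ≢ c

  Within : List (Fin K) → Triple → Set
  Within S (a , b , c) = a ∈ S × b ∈ S × c ∈ S

  first? : ∀ s (t : Triple) → Dec (proj₁ t ≡ s)
  first? s (a , _) = a Fin.≟ s

  Contains : Fin K → Triple → Set
  Contains s (a , b , c) = a ≡ s ⊎ b ≡ s ⊎ c ≡ s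

  contains? : ∀ s t → Dec (Contains s t)
  contains? s (a , b , c) = a Fin.≟ s ⊎-dec b Fin.≟ s ⊎-dec c Fin.≟ s

  Precedes : (Fin K → ℕ) → Triple → Set
  Precedes prio (a , b , c) = prio a < prio b × prio a < prio c

  precedes? : ∀ prio t → Dec (Precedes prio t)
  precedes? prio (a , b , c) = prio a <? prio b ×-dec prio a <? prio c

  -- Averaging over the labels: summed over `s`, each triple is counted once for its first entry and
  -- three times for its three distinct entries.
  good-first : ∀ {x S} → Unique (x ∷ S) → ∀ T → (∀ {t} → t ∈ T → Distinct t × Within (x ∷ S) t) →
               ∃[ s ] (s ∈ x ∷ S × 3 * count (first? s) T ≤ count (contains? s) T)
  good-first {x} {S₀} u T h = ∑-≤⇒∃≤ S₀ _ _ (begin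
    ∑ S (λ s → 3 * count (first? s) T)        ≡⟨ ∑-*ˡ S 3 (λ s → count (first? s) T) ⟩
    3 * ∑ S (λ s → count (first? s) T)        ≡⟨ cong (3 *_) (∑-swap S T _) ⟩
    3 * ∑ T (λ t → count (λ s → first? s t) S) ≤⟨ *-monoʳ-≤ 3 (∑-mono T (λ t _ → once t)) ⟩
    3 * ∑ T (λ _ → 1)                         ≡⟨ sym (∑-*ˡ T 3 _) ⟩
    ∑ T (λ _ → 3)                             ≤⟨ ∑-mono T thrice ⟩
    ∑ T (λ t → count (λ s → contains? s t) S) ≡⟨ ∑-swap T S _ ⟩
    ∑ S (λ s → count (contains? s) T)         ∎)
    where
    open ≤-Reasoning
    S = x ∷ S₀
    once : ∀ t → count (λ s → first? s t) S ≤ 1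
    once t@(a , _) = subst (_≤ 1) (length-filter-count (λ s → first? s t) S)
      (Unique-⊆⇒length≤ {ys = a ∷ []} (Unique.filter⁺ (λ s → first? s t) u)
        (λ s∈ → here (sym (proj₂ (∈-filter⁻ (λ s → first? s t) {xs = S} s∈)))))
    thrice : ∀ t → t ∈ T → 3 ≤ count (λ s → contains? s t) S
    thrice t@(a , b , c) t∈ with h t∈
    ... | (ab , ac , bc) , a∈ , b∈ , c∈ = subst (3 ≤_) (length-filter-count (λ s → contains? s t) S)
      (Unique-⊆⇒length≤ {xs = a ∷ b ∷ c ∷ []} ((ab ∷ ac ∷ []) ∷ (bc ∷ []) ∷ [] ∷ []) λ where
        (here refl) → ∈-filter⁺ (λ s → contains? s t) a∈ (inj₁ refl)
        (there (here refl)) → ∈-filter⁺ (λ s → contains? s t) b∈ (inj₂ (inj₁ refl))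
        (there (there (here refl))) → ∈-filter⁺ (λ s → contains? s t) c∈ (inj₂ (inj₂ refl)))

  -- Derandomises the uniformly random order: the next label s is one that is the
  -- first entry of at most a third of the remaining triples containing s.
  order-within : ∀ k S → length S ≤ k → Unique S → ∀ T → (∀ {t} → t ∈ T → Distinct t × Within S t) →
    ∃[ prio ] ((∀ {x y} → x ∈ S → y ∈ S → prio x ≡ prio y → x ≡ y) ×
               3 * count (precedes? prio) T ≤ length T)
  order-within k [] l u [] h = (λ _ → 0) , (λ ()) , z≤n
  order-within k [] l u (t ∷ T) h = contradiction (proj₁ (proj₂ (h (here refl)))) λ ()
  order-within (suc k) S@(x ∷ S₀) l u T h with good-first u T h
  ... | s , s∈ , few
    with order-within k (filter other? S) shorter (Unique.filter⁺ other? u) (filter rest? T) h′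
    where
    other? : ∀ y → Dec (y ≢ s)
    other? y = ¬? (y Fin.≟ s)
    rest? : ∀ t → Dec (¬ Contains s t)
    rest? t = ¬? (contains? s t)
    shorter : length (filter other? S) ≤ k
    shorter = s≤s⁻¹ (≤-trans (List.filter-notAll other? S (Any.map (λ { refl ¬p → ¬p refl }) s∈)) l)
    h′ : ∀ {t} → t ∈ filter rest? T → Distinct t × Within (filter other? S) t
    h′ t∈ with ∈-filter⁻ rest? {xs = T} t∈
    ... | t∈T , ¬c with h t∈T
    ... | d , a∈ , b∈ , c∈ = d , ∈-filter⁺ other? a∈ (¬c ∘ inj₁) ,
      ∈-filter⁺ other? b∈ (¬c ∘ inj₂ ∘ inj₁) , ∈-filter⁺ other? c∈ (¬c ∘ inj₂ ∘ inj₂)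
  ... | prio′ , inj′ , third′ = prio , inj , third
    where
    other? : ∀ y → Dec (y ≢ s)
    other? y = ¬? (y Fin.≟ s)
    rest? : ∀ t → Dec (¬ Contains s t)
    rest? t = ¬? (contains? s t)
    prio : Fin K → ℕ
    prio y with y Fin.≟ s
    ... | yes _ = 0
    ... | no _ = suc (prio′ y)
    inj : ∀ {y z} → y ∈ S → z ∈ S → prio y ≡ prio z → y ≡ z
    inj {y} {z} y∈ z∈ e with y Fin.≟ s | z Fin.≟ s
    ... | yes p | yes q = trans p (sym q)
    ... | no p | no q = inj′ (∈-filter⁺ other? y∈ p) (∈-filter⁺ other? z∈ q) (suc-injective e)
    inj y∈ z∈ () | yes p | no q
    inj y∈ z∈ () | no p | yes q
    -- As `s` gets priority 0, nothing precedes it: a triple with `s` in second or third place is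
    -- settled favourably, one starting with `s` is paid for by `few`, and the others pass to the
    -- recursive order.
    cases : ∀ t → Precedes prio t → proj₁ t ≡ s ⊎ (¬ Contains s t × Precedes prio′ t)
    cases (a , b , c) p with a Fin.≟ s | b Fin.≟ s | c Fin.≟ s
    ... | yes e | _ | _ = inj₁ e
    ... | no a≢ | no b≢ | no c≢ = inj₂ ((λ { (inj₁ e) → a≢ e ; (inj₂ (inj₁ e)) → b≢ e ; (inj₂ (inj₂ e)) → c≢ e }) ,
      s≤s⁻¹ (proj₁ p) , s≤s⁻¹ (proj₂ p))
    cases t (() , _) | no _ | yes _ | _
    cases t (_ , ()) | no _ | no _ | yes _
    third : 3 * count (precedes? prio) T ≤ length T
    third = begin
      3 * count (precedes? prio) T
        ≤⟨ *-monoʳ-≤ 3 (count-⊎ (precedes? prio) (first? s) (λ t → rest? t ×-dec precedes? prio′ t) T cases) ⟩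
      3 * (count (first? s) T + count (λ t → rest? t ×-dec precedes? prio′ t) T)
        ≡⟨ *-distribˡ-+ 3 (count (first? s) T) _ ⟩
      3 * count (first? s) T + 3 * count (λ t → rest? t ×-dec precedes? prio′ t) T
        ≡⟨ cong (λ m → 3 * count (first? s) T + 3 * m)
             (trans (∑-cong T λ t → ind-× (rest? t) (precedes? prio′ t)) (sym (∑-filter rest? T _))) ⟩
      3 * count (first? s) T + 3 * count (precedes? prio′) (filter rest? T)
        ≤⟨ +-mono-≤ few third′ ⟩
      count (contains? s) T + length (filter rest? T)
        ≡⟨ cong (count (contains? s) T +_) (length-filter-count rest? T) ⟩
      count (contains? s) T + count rest? T
        ≡⟨ count-complement (contains? s) T ⟩
      length T ∎
      where open ≤-Reasoning

  order : ∀ T → (∀ {t} → t ∈ T → Distinct t) →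
          ∃[ prio ] ((∀ {x y} → prio x ≡ prio y → x ≡ y) × 3 * count (precedes? prio) T ≤ length T)
  order T h with order-within (length (allFin K)) (allFin K) ≤-refl (Unique.allFin⁺ K) T
                   (λ t∈ → h t∈ , ∈-allFin _ , ∈-allFin _ , ∈-allFin _)
  ... | prio , inj , third = prio , inj (∈-allFin _) (∈-allFin _) , third

-- Maximum matchings

module Matchings {n : ℕ} (G : Graph n) (cubic : Cubic G) where
  open CubicGraph G cubic

  -- A matching is given by the involution exchanging matched vertices and
  -- fixing the unmatched ones.
  Matching : (Fin n → Fin n) → Set
  Matching m = (∀ v → m (m v) ≡ v) × (∀ v → m v ≢ v → Adj G v (m v))

  unmatched : (Fin n → Fin n) → ℕ
  unmatched m = countᶠ (λ v → m v Fin.≟ v)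

  matching? : ∀ m → Dec (Matching m)
  matching? m = Fin.all? (λ v → m (m v) Fin.≟ v) ×-dec Fin.all? (λ v → ¬? (m v Fin.≟ v) →-dec adj? G v (m v))

  maximum-matching : ∃[ m ] (Matching m × (∀ m′ → Matching m′ → unmatched m ≤ unmatched m′))
  maximum-matching = Vec.lookup best , best-matching , minimal
    where
    size : Vec (Fin n) n → ℕ
    size v = unmatched (Vec.lookup v)
    matchings : List (Vec (Fin n) n)
    matchings = filter (λ v → matching? (Vec.lookup v)) (allVecs (allFin n) n)
    best : Vec (Fin n) n
    -- The identity, which is the empty matching, serves as the default of `argmin`. Tabulating the
    -- involutions as vectors makes the candidates a finite list.
    best = argmin size (Vec.tabulate id) matchings
    transport : ∀ {m m′} → (∀ v → m v ≡ m′ v) → Matching m → Matching m′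
    transport {m} {m′} e (inv , adj) =
      (λ v → trans (sym (trans (cong m (e v)) (e (m′ v)))) (inv v)) ,
      (λ v ≢v → subst (Adj G v) (e v) (adj v (λ p → ≢v (trans (sym (e v)) p))))
    tabulated : ∀ {m} → Matching m → Matching (Vec.lookup (Vec.tabulate m))
    tabulated {m} = transport (λ v → sym (Vec.lookup∘tabulate m v))
    best-matching : Matching (Vec.lookup best)
    best-matching = argmin-all size {P = Matching ∘ Vec.lookup} (tabulated ((λ _ → refl) , λ v p → contradiction refl p))
      (All.all-filter (λ v → matching? (Vec.lookup v)) (allVecs (allFin n) n))
    minimal : ∀ m → Matching m → size best ≤ unmatched m
    minimal m match = ≤-trans
      (All.lookup (f[argmin]≤f[xs] {f = size} (Vec.tabulate id) matchings)
        (∈-filter⁺ (λ v → matching? (Vec.lookup v)) (∈-allVecs ∈-allFin (Vec.tabulate m)) (tabulated match)))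
      (≤-reflexive (∑-cong (allFin n) λ v → ind-cong (Vec.lookup (Vec.tabulate m) v Fin.≟ v) (m v Fin.≟ v)
        (trans (sym (Vec.lookup∘tabulate m v))) (trans (Vec.lookup∘tabulate m v))))

  module Link (x y : Fin n) (xy : Adj G x y) {m : Fin n → Fin n} (match : Matching m) where

    -- Adds the edge `xy` and drops whatever matching edges met `x` or `y`, leaving their partners
    -- unmatched. If only `x` was unmatched, the defect moves to the old partner of `y`; if both
    -- were, the matching grows.
    link : Fin n → Fin n
    link v with v Fin.≟ x | v Fin.≟ y | m v Fin.≟ x | m v Fin.≟ y
    ... | yes _ | _ | _ | _ = y
    ... | no _ | yes _ | _ | _ = x
    ... | no _ | no _ | yes _ | _ = v
    ... | no _ | no _ | no _ | yes _ = v
    ... | no _ | no _ | no _ | no _ = m v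

    link-x : link x ≡ y
    link-x with x Fin.≟ x
    ... | yes _ = refl
    ... | no p = contradiction refl p

    link-y : link y ≡ x
    link-y with y Fin.≟ x | y Fin.≟ y
    ... | yes p | _ = p
    ... | no _ | yes _ = refl
    ... | no _ | no p = contradiction refl p

    link-freed : ∀ {v} → v ≢ x → v ≢ y → m v ≡ x ⊎ m v ≡ y → link v ≡ v
    link-freed {v} p q r with v Fin.≟ x | v Fin.≟ y | m v Fin.≟ x | m v Fin.≟ y
    ... | yes e | _ | _ | _ = contradiction e p
    ... | no _ | yes e | _ | _ = contradiction e q
    ... | no _ | no _ | yes _ | _ = refl
    ... | no _ | no _ | no _ | yes _ = refl
    link-freed p q (inj₁ e) | no _ | no _ | no ¬e | no _ = contradiction e ¬e
    link-freed p q (inj₂ e) | no _ | no _ | no _ | no ¬e = contradiction e ¬e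

    link-else : ∀ {v} → v ≢ x → v ≢ y → m v ≢ x → m v ≢ y → link v ≡ m v
    link-else {v} p q r s with v Fin.≟ x | v Fin.≟ y | m v Fin.≟ x | m v Fin.≟ y
    ... | yes e | _ | _ | _ = contradiction e p
    ... | no _ | yes e | _ | _ = contradiction e q
    ... | no _ | no _ | yes e | _ = contradiction e r
    ... | no _ | no _ | no _ | yes e = contradiction e s
    ... | no _ | no _ | no _ | no _ = refl

    data View (v : Fin n) : Set where
      is-x : v ≡ x → link v ≡ y → View v
      is-y : v ≡ y → link v ≡ x → View v
      freed : v ≢ x → v ≢ y → m v ≡ x ⊎ m v ≡ y → link v ≡ v → View v
      else : v ≢ x → v ≢ y → m v ≢ x → m v ≢ y → link v ≡ m v → View v

    view : ∀ v → View v
    view v with v Fin.≟ x | v Fin.≟ y | m v Fin.≟ x | m v Fin.≟ y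
    ... | yes refl | _ | _ | _ = is-x refl link-x
    ... | no _ | yes refl | _ | _ = is-y refl link-y
    ... | no p | no q | yes r | _ = freed p q (inj₁ r) (link-freed p q (inj₁ r))
    ... | no p | no q | no _ | yes r = freed p q (inj₂ r) (link-freed p q (inj₂ r))
    ... | no p | no q | no r | no s = else p q r s (link-else p q r s)

    link-matching : Matching link
    link-matching = involutive , adjacent
      where
      involutive : ∀ v → link (link v) ≡ v
      involutive v with view v
      ... | is-x refl e = trans (cong link e) link-y
      ... | is-y refl e = trans (cong link e) link-x
      ... | freed _ _ _ e = trans (cong link e) e
      ... | else p q r s e = trans (cong link e) (trans
        (link-else r s (p ∘ trans (sym (proj₁ match v))) (q ∘ trans (sym (proj₁ match v)))) (proj₁ match v))
      adjacent : ∀ v → link v ≢ v → Adj G v (link v)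
      adjacent v ≢v with view v
      ... | is-x refl e = subst (Adj G x) (sym e) xy
      ... | is-y refl e = subst (Adj G y) (sym e) (adj-sym xy)
      ... | freed _ _ _ e = contradiction e ≢v
      ... | else _ _ _ _ e = subst (Adj G v) (sym e) (proj₂ match v (≢v ∘ trans e))

    unmatched-link : ∀ {v} → link v ≡ v → v ≢ x × v ≢ y × (m v ≡ x ⊎ m v ≡ y ⊎ m v ≡ v)
    unmatched-link {v} fixed with view v
    ... | is-x refl e = contradiction (trans (sym fixed) e) (adj-≢ xy)
    ... | is-y refl e = contradiction (trans (sym e) fixed) (adj-≢ xy)
    ... | freed p q (inj₁ r) e = p , q , inj₁ r
    ... | freed p q (inj₂ r) e = p , q , inj₂ (inj₁ r)
    ... | else p q _ _ e = p , q , inj₂ (inj₂ (trans (sym e) fixed))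

  module Alternating {m : Fin n → Fin n} (match : Matching m) where

    m-involutive : ∀ v → m (m v) ≡ v
    m-involutive = proj₁ match

    -- Alternating walks from an unmatched vertex `u`, newest vertex first. Each step takes a
    -- non-matching edge and then a matching edge, so the head is always at even distance along the
    -- walk.
    data Alt (u : Fin n) : List (Fin n) → Set where
      start : m u ≡ u → Alt u (u ∷ [])
      grow : ∀ {x xs y} → Alt u (x ∷ xs) → Adj G x y → y ≢ m x → m y ≢ y → Alt u (m y ∷ y ∷ x ∷ xs)

    -- Consecutive edges of an alternating walk are of different kinds, hence never the same edge
    -- traversed back.
    extend-NB : ∀ {u x xs y} → Alt u (x ∷ xs) → Adj G x y → y ≢ m x → NBWalk G u (y ∷ x ∷ xs)
    extend-NB (start _) xy _ = step₁ (adj-sym xy)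
    extend-NB {y = y} (grow {x} {xs} {z} alt xz z≢mx mz≢z) mzy y≢mmz =
      step (step (extend-NB alt xz z≢mx) (adj-sym (proj₂ match z mz≢z)) mz≢x)
        (adj-sym mzy) (λ y≡z → y≢mmz (trans y≡z (sym (m-involutive z))))
      where
      mz≢x : m z ≢ x
      mz≢x e = z≢mx (trans (sym (m-involutive z)) (cong m e))

    source-unmatched : ∀ {u xs} → Alt u xs → m u ≡ u
    source-unmatched (start e) = e
    source-unmatched (grow alt _ _ _) = source-unmatched alt

    -- Exchanging the edges along the path moves the defect from `u` to `x`, one `link` per step.
    -- Agreement with `m` off the path is carried along because the next step must know that `y` and
    -- `m y` are still partners.
    shift : ∀ {u x xs} → Alt u (x ∷ xs) → Unique (x ∷ xs) →
      ∃[ m′ ] (Matching m′ × m′ x ≡ x × (∀ v → v ∉ x ∷ xs → m′ v ≡ m v) ×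
               (∀ v → m′ v ≡ v → v ≡ x ⊎ (m v ≡ v × v ≢ u)))
    shift {u} (start e) _ = m , match , e , (λ _ _ → refl) , unm
      where
      unm : ∀ v → m v ≡ v → v ≡ u ⊎ (m v ≡ v × v ≢ u)
      unm v p with v Fin.≟ u
      ... | yes q = inj₁ q
      ... | no q = inj₂ (p , q)
    shift {u} (grow {x} {xs} {y} alt xy y≢mx my≢y) ((z≢y ∷ z≢) ∷ y≢ ∷ uxs) with shift alt uxs
    ... | m′ , match′ , m′x , off , unm = link , link-matching , link-freed z≢x z≢y (inj₂ m′z) , off″ , unm″
      where
      open Link x y xy match′
      z = m y
      z≢x : z ≢ x
      z≢x = All.lookup z≢ (here refl)
      m′y : m′ y ≡ z
      m′y = off y (λ y∈ → All.lookup y≢ y∈ refl)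
      m′z : m′ z ≡ y
      m′z = trans (off z (λ z∈ → All.lookup z≢ z∈ refl)) (m-involutive y)
      off″ : ∀ v → v ∉ z ∷ y ∷ x ∷ xs → link v ≡ m v
      off″ v v∉ = trans (link-else (λ { refl → v∉ (there (there (here refl))) }) (λ { refl → v∉ (there (here refl)) })
          (λ e → v∉ (there (there (here (trans (sym (proj₁ match′ v)) (trans (cong m′ e) m′x))))))
          (λ e → v∉ (here (trans (sym (proj₁ match′ v)) (trans (cong m′ e) m′y)))))
        (off v (λ v∈ → v∉ (there (there v∈))))
      unm″ : ∀ v → link v ≡ v → v ≡ z ⊎ (m v ≡ v × v ≢ u)
      unm″ v e with unmatched-link e
      ... | v≢x , _ , inj₁ p = contradiction (trans (sym (proj₁ match′ v)) (trans (cong m′ p) m′x)) v≢x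
      ... | _ , _ , inj₂ (inj₁ p) = inj₁ (trans (sym (proj₁ match′ v)) (trans (cong m′ p) m′y))
      ... | v≢x , _ , inj₂ (inj₂ p) with unm v p
      ... | inj₁ q = contradiction q v≢x
      ... | inj₂ q = inj₂ q

    module Maximum (maximum : ∀ m′ → Matching m′ → unmatched m ≤ unmatched m′) (L : ℕ) where

      -- Up to length L an alternating walk from a good vertex is automatically a
      -- path, so no blossoms occur and reaching an unmatched vertex augments m.
      no-augmentation : ∀ {u x xs y} → ¬ Bad L G u → Alt u (x ∷ xs) → 2 + length xs ≤ L →
                        Adj G x y → y ≢ m x → m y ≢ y
      no-augmentation {u} {x} {xs} {y} good alt short xy y≢mx my≡y
        with NBWalk-unique cubic good short (extend-NB alt xy y≢mx)
      ... | y≢ ∷ uxs with shift alt uxs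
      ... | m′ , match′ , m′x , off , unm = <⇒≱ fewer (maximum link link-matching)
        where
        open Link x y xy match′
        m′y : m′ y ≡ y
        m′y = trans (off y (λ y∈ → All.lookup y≢ y∈ refl)) my≡y
        sub : ∀ v → link v ≡ v → m v ≡ v × v ≢ u
        sub v e with unmatched-link e
        ... | v≢x , _ , inj₁ p = contradiction (trans (sym (proj₁ match′ v)) (trans (cong m′ p) m′x)) v≢x
        ... | _ , v≢y , inj₂ (inj₁ p) = contradiction (trans (sym (proj₁ match′ v)) (trans (cong m′ p) m′y)) v≢y
        ... | v≢x , _ , inj₂ (inj₂ p) with unm v p
        ... | inj₁ q = contradiction q v≢x
        ... | inj₂ q = q
        fewer : unmatched link < unmatched m
        fewer = subst (unmatched link <_)
          (sym (count-≢ Fin._≟_ (λ v → m v Fin.≟ v) (Unique.allFin⁺ n) (∈-allFin u) (source-unmatched alt)))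
          (s≤s (countᶠ-mono (λ v → link v Fin.≟ v) (λ v → (m v Fin.≟ v) ×-dec ¬? (v Fin.≟ u)) sub))

      Source : Fin n → Set
      Source x = m x ≡ x × ¬ Bad L G x

      source? : ∀ x → Dec (Source x)
      source? x = m x Fin.≟ x ×-dec ¬? (bad? L G x)

      -- Vertices at even and at odd positions of alternating walks from good unmatched vertices,
      -- with at most `j` full steps before them.
      Outer Inner : ℕ → Fin n → Set
      Outer zero x = Source x
      Outer (suc j) x = Source x ⊎ Inner j (m x)
      Inner j y = m y ≢ y × ∃[ x ] (Outer j x × Adj G x y × y ≢ m x)

      outer? : ∀ j x → Dec (Outer j x)
      inner? : ∀ j y → Dec (Inner j y)
      outer? zero x = source? x
      outer? (suc j) x = source? x ⊎-dec inner? j (m x)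
      inner? j y = ¬? (m y Fin.≟ y) ×-dec Fin.any? (λ x → outer? j x ×-dec adj? G x y ×-dec ¬? (y Fin.≟ m x))

      outer-reached : ∀ j x → Outer j x → ∃[ u ] ∃[ xs ] (¬ Bad L G u × Alt u (x ∷ xs) × length xs ≤ j + j)
      outer-reached zero x (mx , good) = x , [] , good , start mx , z≤n
      outer-reached (suc j) x (inj₁ (mx , good)) = x , [] , good , start mx , z≤n
      outer-reached (suc j) x (inj₂ (≢y , x′ , out , x′y , y≢)) with outer-reached j x′ out
      ... | u , xs , good , alt , short = u , m x ∷ x′ ∷ xs , good ,
        subst (λ z → Alt u (z ∷ m x ∷ x′ ∷ xs)) (m-involutive x) (grow alt x′y y≢ ≢y) ,
        s≤s (≤-trans (s≤s short) (≤-reflexive (sym (+-suc j j))))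

      two-exits : ∀ x → 2 ≤ countᶠ (λ y → adj? G x y ×-dec ¬? (y Fin.≟ m x))
      two-exits x = +-cancelˡ-≤ 1 _ _ (begin
        3 ≡⟨ sym (degree x) ⟩
        countᶠ (adj? G x) ≤⟨ count-⊎ (adj? G x) (λ y → y ∈?ᶠ (m x ∷ [])) (λ y → adj? G x y ×-dec ¬? (y Fin.≟ m x))
          (allFin n) (λ y xy → case y Fin.≟ m x of λ where
            (yes e) → inj₁ (here e)
            (no ¬e) → inj₂ (xy , ¬e)) ⟩
        countᶠ (λ y → y ∈?ᶠ (m x ∷ [])) + E ≤⟨ +-monoˡ-≤ E (count-∈-≤ (m x ∷ [])) ⟩
        1 + E ∎)
        where
        open ≤-Reasoning
        E = countᶠ (λ y → adj? G x y ×-dec ¬? (y Fin.≟ m x))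

      two-entrances : ∀ y → m y ≢ y → countᶠ (λ x → adj? G x y ×-dec ¬? (y Fin.≟ m x)) ≤ 2
      two-entrances y ≢y = ≤-trans
        (countᶠ-mono (λ x → adj? G x y ×-dec ¬? (y Fin.≟ m x)) (λ x → adj? G y x ×-dec ¬? (x Fin.≟ m y))
          (λ x (xy , y≢) → adj-sym xy , λ e → y≢ (trans (sym (m-involutive y)) (cong m (sym e)))))
        (≤-reflexive (suc-injective (trans
          (sym (count-≢ Fin._≟_ (adj? G y) (Unique.allFin⁺ n) (∈-allFin (m y)) (proj₂ match y ≢y))) (degree y))))

      -- Double counting of non-matching edges: at least two leave each outer vertex, all of them
      -- end at matched vertices by `no-augmentation`, and at most two enter each inner vertex. A
      -- walk of `j` full steps plus one more vertex has at most 2 + 2j vertices.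
      outer≤inner : ∀ j → 2 + (j + j) ≤ L → countᶠ (outer? j) ≤ countᶠ (inner? j)
      outer≤inner j short = *-cancelˡ-≤ 2 (begin
        2 * countᶠ (outer? j)
          ≡⟨ trans (*-comm 2 (countᶠ (outer? j))) (sym (∑-*ʳ V 2 (λ x → ind (outer? j x)))) ⟩
        ∑ V (λ x → ind (outer? j x) * 2)
          ≤⟨ ∑-mono′ V (λ x → *-monoʳ-≤ (ind (outer? j x)) (two-exits x)) ⟩
        ∑ V (λ x → ind (outer? j x) * countᶠ (exit? x))
          ≡⟨ trans (∑-cong V λ x → sym (∑-*ˡ V (ind (outer? j x)) _)) (∑-swap V V _) ⟩
        ∑ V (λ y → ∑ V (λ x → ind (outer? j x) * ind (exit? x y)))
          ≤⟨ ∑-mono′ V into ⟩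
        ∑ V (λ y → 2 * ind (inner? j y))
          ≡⟨ ∑-*ˡ V 2 _ ⟩
        2 * countᶠ (inner? j) ∎)
        where
        open ≤-Reasoning
        V = allFin n
        exit? : ∀ x y → Dec (Adj G x y × y ≢ m x)
        exit? x y = adj? G x y ×-dec ¬? (y Fin.≟ m x)
        matched : ∀ {x y} → Outer j x → Adj G x y × y ≢ m x → m y ≢ y
        matched {x} out (xy , y≢) with outer-reached j x out
        ... | u , xs , good , alt , l =
          no-augmentation good alt (≤-trans (s≤s (s≤s l)) short) xy y≢
        into : ∀ y → ∑ V (λ x → ind (outer? j x) * ind (exit? x y)) ≤ 2 * ind (inner? j y)
        into y = ind-elim (λ k → ∑ V (λ x → ind (outer? j x) * ind (exit? x y)) ≤ 2 * k) (inner? j y)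
          (λ (≢y , _) → ≤-trans (∑-mono′ V λ x → ≤-trans (*-monoˡ-≤ (ind (exit? x y)) (ind-≤1 (outer? j x)))
            (≤-reflexive (+-identityʳ _))) (two-entrances y ≢y))
          (λ ¬inner → ≤-reflexive (trans (∑-cong V λ x → trans (sym (ind-× (outer? j x) (exit? x y)))
            (ind-no (outer? j x ×-dec exit? x y) (λ (out , e) → ¬inner (matched out e , x , out , e)))) (∑-zero V)))

      -- The partners of inner vertices are matched and so disjoint from the sources; each round
      -- therefore gains the number of sources once more. Linear growth is enough: after k rounds
      -- the sources number at most n / (k + 1).
      outer-grows : ∀ j → j + j ≤ L → suc j * countᶠ source? ≤ countᶠ (outer? j)
      outer-grows zero _ = ≤-reflexive (+-identityʳ _)
      outer-grows (suc j) short = begin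
        countᶠ source? + suc j * countᶠ source?
          ≤⟨ +-monoʳ-≤ (countᶠ source?) (≤-trans (outer-grows j (≤-trans (m≤n+m _ 2) short′)) (outer≤inner j short′)) ⟩
        countᶠ source? + countᶠ (inner? j)
          ≤⟨ +-monoʳ-≤ (countᶠ source?) (countᶠ-injection (inner? j) (λ x → inner? j (m x)) m
               (λ y inn → subst (Inner j) (sym (m-involutive y)) inn)
               (λ y z _ _ e → trans (sym (m-involutive y)) (trans (cong m e) (m-involutive z)))) ⟩
        countᶠ source? + countᶠ (λ x → inner? j (m x))
          ≡⟨ sym (∑-+ (allFin n) _ _) ⟩
        ∑ (allFin n) (λ x → ind (source? x) + ind (inner? j (m x)))
          ≤⟨ ∑-mono′ (allFin n) disjoint ⟩
        countᶠ (outer? (suc j)) ∎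
        where
        open ≤-Reasoning
        short′ : 2 + (j + j) ≤ L
        short′ = ≤-trans (≤-reflexive (cong suc (sym (+-suc j j)))) short
        disjoint : ∀ x → ind (source? x) + ind (inner? j (m x)) ≤ ind (outer? (suc j) x)
        disjoint x = ind-elim (λ k → k + ind (inner? j (m x)) ≤ ind (outer? (suc j) x)) (source? x)
          (λ s → ≤-reflexive (trans (cong (1 +_) (ind-no (inner? j (m x))
              (λ (≢y , _) → ≢y (cong m (proj₁ s))))) (sym (ind-yes (outer? (suc j) x) (inj₁ s)))))
          (λ _ → ind-mono (inner? j (m x)) (outer? (suc j) x) inj₂)

      few-unmatched : ∀ k → k + k ≤ L → suc k * unmatched m ≤ n + suc k * #bad L G
      few-unmatched k short = begin
        suc k * unmatched m ≤⟨ *-monoʳ-≤ (suc k) (count-⊎ (λ v → m v Fin.≟ v) source? (bad? L G) (allFin n)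
          (λ v e → case bad? L G v of λ where
            (yes b) → inj₂ b
            (no g) → inj₁ (e , g))) ⟩
        suc k * (countᶠ source? + #bad L G) ≡⟨ *-distribˡ-+ (suc k) (countᶠ source?) _ ⟩
        suc k * countᶠ source? + suc k * #bad L G
          ≤⟨ +-monoˡ-≤ _ (≤-trans (outer-grows k short) (countᶠ-≤ (outer? k))) ⟩
        n + suc k * #bad L G ∎
        where open ≤-Reasoning

-- Path partitions

linked-ʳ++ : ∀ {A : Set} {R : A → A → Set} → (∀ {x y} → R x y → R y x) → ∀ {x} xs {ys} →
             Linked R (x ∷ xs) → Linked R (x ∷ ys) → Linked R (xs ʳ++ (x ∷ ys))
linked-ʳ++ s [] p q = q
linked-ʳ++ s (y ∷ xs) (r ∷ p) q = linked-ʳ++ s xs p (s r ∷ q)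

unique-ʳ++ : ∀ {A : Set} (xs : List A) {ys} → Unique xs → Unique ys → (∀ {x} → x ∈ xs → x ∉ ys) →
             Unique (xs ʳ++ ys)
unique-ʳ++ [] _ v _ = v
unique-ʳ++ (x ∷ xs) (x∉ ∷ u) v d = unique-ʳ++ xs u (All.¬Any⇒All¬ _ (d (here refl)) ∷ v) λ where
  y∈ (here refl) → All.lookup x∉ y∈ refl
  y∈ (there y∈′) → d (there y∈) y∈′

∈-ʳ++⁻ : ∀ {A : Set} {v : A} xs {ys} → v ∈ xs ʳ++ ys → v ∈ xs ⊎ v ∈ ys
∈-ʳ++⁻ [] p = inj₂ p
∈-ʳ++⁻ (x ∷ xs) p with ∈-ʳ++⁻ xs p
... | inj₁ q = inj₁ (there q)
... | inj₂ (here e) = inj₁ (here e)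
... | inj₂ (there q) = inj₂ q

∈-ʳ++⁺ : ∀ {A : Set} {v : A} xs {ys} → v ∈ xs ⊎ v ∈ ys → v ∈ xs ʳ++ ys
∈-ʳ++⁺ [] (inj₂ p) = p
∈-ʳ++⁺ (x ∷ xs) (inj₁ (here e)) = ∈-ʳ++⁺ xs (inj₂ (here e))
∈-ʳ++⁺ (x ∷ xs) (inj₁ (there p)) = ∈-ʳ++⁺ xs (inj₁ p)
∈-ʳ++⁺ (x ∷ xs) (inj₂ p) = ∈-ʳ++⁺ xs (inj₂ (there p))

unique-length : ∀ {n} {xs : List (Fin n)} → Unique xs → length xs ≤ n
unique-length {n} {xs} u = subst (length xs ≤_) (length-allFin n) (Unique-⊆⇒length≤ u (λ _ → ∈-allFin _))

-- For a maximum matching almost all vertices of H = G − M have degree 2, so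
-- extracting maximal paths of H one by one yields few short ones.
module PathPartition {n : ℕ} (G : Graph n) (cubic : Cubic G) {m : Fin n → Fin n}
                     (match : Matchings.Matching G cubic m) (L : ℕ) where
  open CubicGraph G cubic
  open Matchings G cubic using (unmatched)

  V = Fin n

  H : V → V → Set
  H u v = Adj G u v × v ≢ m u

  H? : ∀ u v → Dec (H u v)
  H? u v = adj? G u v ×-dec ¬? (v Fin.≟ m u)

  H-sym : ∀ {u v} → H u v → H v u
  H-sym (uv , v≢) = adj-sym uv , λ e → v≢ (trans (sym (proj₁ match _)) (cong m (sym e)))

  Stuck : List V → V → Set
  Stuck xs v = ∀ z → H v z → z ∈ xs

  Inner : List V → V → Set
  Inner xs v = ∃[ p ] ∃[ q ] (p ≢ q × p ∈ xs × q ∈ xs × H v p × H v q)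

  inner-⊆ : ∀ {xs ys v} → (∀ {z} → z ∈ xs → z ∈ ys) → Inner xs v → Inner ys v
  inner-⊆ sub (p , q , p≢q , p∈ , q∈ , hp , hq) = p , q , p≢q , sub p∈ , sub q∈ , hp , hq

  trichotomy : ∀ {x xs z} → Unique (x ∷ xs) → Linked H (x ∷ xs) → z ∈ x ∷ xs →
               z ≡ x ⊎ (∃[ pre ] (x ∷ xs ≡ pre ++ z ∷ [])) ⊎ Inner (x ∷ xs) z
  trichotomy u l (here e) = inj₁ e
  trichotomy {x} {y ∷ xs} (x≢ ∷ u) (h ∷ l) (there z∈) with trichotomy u l z∈
  ... | inj₂ (inj₁ (pre , e)) = inj₂ (inj₁ (x ∷ pre , cong (x ∷_) e))
  ... | inj₂ (inj₂ inner) = inj₂ (inj₂ (inner-⊆ there inner))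
  trichotomy {x} {y ∷ []} (x≢ ∷ u) (h ∷ l) (there z∈) | inj₁ refl = inj₂ (inj₁ (x ∷ [] , refl))
  trichotomy {x} {y ∷ w ∷ xs} (x≢ ∷ u) (h ∷ k ∷ l) (there z∈) | inj₁ refl =
    inj₂ (inj₂ (x , w , All.lookup x≢ (there (here refl)) , here refl , there (there (here refl)) , H-sym h , k))

  Fresh : List V → List V → Set
  Fresh F xs = ∀ z → z ∈ xs → z ∉ F

  -- Greedy extension at the head. The fuel `k` cannot run out early, since a path has at most `n`
  -- vertices. The old path is recorded as a suffix so that its last vertex is known to remain the
  -- end.
  extend : ∀ F k x xs → n ≤ k + length (x ∷ xs) → Unique (x ∷ xs) → Linked H (x ∷ xs) →
    Fresh F (x ∷ xs) →
    ∃[ y ] ∃[ ys ] (Unique (y ∷ ys) × Linked H (y ∷ ys) × Fresh F (y ∷ ys) ×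
      (∃[ pre ] (y ∷ ys ≡ pre ++ x ∷ xs)) × Stuck ((y ∷ ys) ++ F) y)
  extend F k x xs long u l d
    with Fin.any? (λ z → H? x z ×-dec ¬? (z ∈?ᶠ ((x ∷ xs) ++ F)))
  ... | no none = x , xs , u , l , d , ([] , refl) , stuck
    where
    stuck : Stuck ((x ∷ xs) ++ F) x
    stuck z h with z ∈?ᶠ ((x ∷ xs) ++ F)
    ... | yes z∈ = z∈
    ... | no z∉ = contradiction (z , h , z∉) none
  ... | yes (z , h , z∉) = continue k long
    where
    u′ : Unique (z ∷ x ∷ xs)
    u′ = All.¬Any⇒All¬ (x ∷ xs) (z∉ ∘ ∈-++⁺ˡ) ∷ u
    continue : ∀ k → n ≤ k + length (x ∷ xs) → _
    continue zero long = contradiction long (<⇒≱ (unique-length u′))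
    continue (suc k) long with extend F k z (x ∷ xs) (≤-trans long (≤-reflexive (sym (+-suc k _)))) u′ (H-sym h ∷ l)
      (λ { _ (here refl) → z∉ ∘ ∈-++⁺ʳ (x ∷ xs) ; w (there w∈) → d w w∈ })
    ... | y , ys , u″ , l″ , d″ , (pre , e) , stuck =
      y , ys , u″ , l″ , d″ , (pre ++ z ∷ [] , trans e (sym (List.++-assoc pre (z ∷ []) (x ∷ xs)))) , stuck

  record MaximalPath (F : List V) (h : V) (t : List V) : Set where
    field
      unique : Unique (h ∷ t)
      linked : Linked H (h ∷ t)
      fresh : Fresh F (h ∷ t)
      head-stuck : Stuck ((h ∷ t) ++ F) h
      stuck-or-inner : ∀ {z} → z ∈ h ∷ t → Stuck ((h ∷ t) ++ F) z ⊎ Inner (h ∷ t) z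

  -- Extend at one end, reverse, and extend at the other. The first end `y` stays stuck because the
  -- path only grows afterwards, and it stays the last vertex because extension happens at the head.
  maximal-path : ∀ F v → v ∉ F → ∃[ h ] ∃[ t ] (MaximalPath F h t × v ∈ h ∷ t)
  maximal-path F v v∉
    with extend F n v [] (m≤m+n n 1) ([] ∷ []) [-] (λ { _ (here refl) → v∉ })
  ... | y , ys , u , l , d , (pre , e) , stuck = turn (ys ʳ++ (y ∷ [])) refl
    where
    turn : ∀ r → r ≡ ys ʳ++ (y ∷ []) → ∃[ h ] ∃[ t ] (MaximalPath F h t × v ∈ h ∷ t)
    turn [] e′ with subst (y ∈_) (sym e′) (∈-ʳ++⁺ ys (inj₂ (here refl)))
    ... | ()
    turn (w ∷ ws) e′ = build (extend F n w ws (m≤m+n n _) (subst Unique (sym e′) u′) (subst (Linked H) (sym e′) l′)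
        (λ z z∈ → d z (back (subst (z ∈_) e′ z∈))))
      where
      back : ∀ {z} → z ∈ ys ʳ++ (y ∷ []) → z ∈ y ∷ ys
      back z∈ with ∈-ʳ++⁻ ys z∈
      ... | inj₁ p = there p
      ... | inj₂ (here p) = here p
      forth : ∀ {z} → z ∈ y ∷ ys → z ∈ w ∷ ws
      forth (here p) = subst (_ ∈_) (sym e′) (∈-ʳ++⁺ ys (inj₂ (here p)))
      forth (there p) = subst (_ ∈_) (sym e′) (∈-ʳ++⁺ ys (inj₁ p))
      u′ : Unique (ys ʳ++ (y ∷ []))
      u′ = reverse-unique u
        where
        reverse-unique : Unique (y ∷ ys) → Unique (ys ʳ++ (y ∷ []))
        reverse-unique (y≢ ∷ uys) = unique-ʳ++ ys uys ([] ∷ []) λ { x∈ (here refl) → All.lookup y≢ x∈ refl }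
      l′ : Linked H (ys ʳ++ (y ∷ []))
      l′ = linked-ʳ++ H-sym ys l [-]
      build : _ → _
      build (h , t , u″ , l″ , d″ , (pre′ , e″) , stuck″) = h , t , record
        { unique = u″ ; linked = l″ ; fresh = d″ ; head-stuck = stuck″ ; stuck-or-inner = ends }
        , sub (forth (subst (v ∈_) (sym e) (∈-++⁺ʳ pre (here refl))))
        where
        sub : ∀ {z} → z ∈ w ∷ ws → z ∈ h ∷ t
        sub z∈ = subst (_ ∈_) (sym e″) (∈-++⁺ʳ pre′ z∈)
        ends : ∀ {z} → z ∈ h ∷ t → Stuck ((h ∷ t) ++ F) z ⊎ Inner (h ∷ t) z
        ends {z} z∈ with trichotomy u″ l″ z∈
        ... | inj₁ refl = inj₁ stuck″
        ... | inj₂ (inj₂ inner) = inj₂ inner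
        ... | inj₂ (inj₁ (pre″ , eq)) = inj₁ (subst (Stuck ((h ∷ t) ++ F)) (sym z≡y) y-stuck)
          where
          y-stuck : Stuck ((h ∷ t) ++ F) y
          y-stuck x hx with ∈-++⁻ (y ∷ ys) (stuck x hx)
          ... | inj₁ p = ∈-++⁺ˡ (sub (forth p))
          ... | inj₂ p = ∈-++⁺ʳ (h ∷ t) p
          z≡y : z ≡ y
          z≡y = List.∷ʳ-injectiveʳ pre″ (pre′ ++ List.reverse ys) (trans (sym eq) (trans e″
            (trans (cong (pre′ ++_) (trans e′ (List.ʳ++-defn ys))) (sym (List.++-assoc pre′ (List.reverse ys) (y ∷ []))))))

  data Extracted : List (List V) → Set where
    [] : Extracted []
    _∷_ : ∀ {Ps h t} → MaximalPath (concat Ps) h t → Extracted Ps → Extracted ((h ∷ t) ∷ Ps)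

  extract : ∀ vs → ∃[ Ps ] (Extracted Ps × (∀ {v} → v ∈ vs → v ∈ concat Ps))
  extract [] = [] , [] , λ ()
  extract (v ∷ vs) with extract vs
  ... | Ps , ex , cover with v ∈?ᶠ concat Ps
  ... | yes v∈ = Ps , ex , λ { (here refl) → v∈ ; (there z∈) → cover z∈ }
  ... | no v∉ with maximal-path (concat Ps) v v∉
  ... | h , t , mp , v∈ = (h ∷ t) ∷ Ps , mp ∷ ex ,
    λ { (here refl) → ∈-++⁺ˡ v∈ ; (there z∈) → ∈-++⁺ʳ (h ∷ t) (cover z∈) }

  extracted-unique : ∀ {Ps} → Extracted Ps → Unique (concat Ps)
  extracted-unique [] = []
  extracted-unique (mp ∷ ex) =
    Unique.++⁺ (MaximalPath.unique mp) (extracted-unique ex) (λ (p , q) → MaximalPath.fresh mp _ p q)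

  extracted-linked : ∀ {Ps} → Extracted Ps → All (Linked H) Ps
  extracted-linked [] = []
  extracted-linked (mp ∷ ex) = MaximalPath.linked mp ∷ extracted-linked ex

  -- Both alternatives are monotone in the vertex set, so what held when a path was extracted still
  -- holds after later ones are added.
  extracted-ends : ∀ {Ps z} → Extracted Ps → z ∈ concat Ps → Stuck (concat Ps) z ⊎ Inner (concat Ps) z
  extracted-ends {Q ∷ Ps} (mp ∷ ex) z∈ with ∈-++⁻ Q z∈
  ... | inj₁ z∈Q with MaximalPath.stuck-or-inner mp z∈Q
  ... | inj₁ stuck = inj₁ stuck
  ... | inj₂ inner = inj₂ (inner-⊆ ∈-++⁺ˡ inner)
  extracted-ends {Q ∷ Ps} (mp ∷ ex) z∈ | inj₂ z∈Ps with extracted-ends ex z∈Ps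
  ... | inj₁ stuck = inj₁ (λ x h → ∈-++⁺ʳ Q (stuck x h))
  ... | inj₂ inner = inj₂ (inner-⊆ (∈-++⁺ʳ Q) inner)

  Exceptional : V → Set
  Exceptional v = Bad L G v ⊎ ∃[ z ] (Adj G v z × m z ≡ z)

  exceptional? : ∀ v → Dec (Exceptional v)
  exceptional? v = bad? L G v ⊎-dec has-nbr? (λ z → m z Fin.≟ z) v

  -- The head of a short path has an H-neighbour z off the path and hence, by
  -- maximality, on an earlier path; but there z already has two H-neighbours.
  short-path-exceptional : ∀ {Ps h t} → Extracted Ps → MaximalPath (concat Ps) h t →
                           length (h ∷ t) ≤ L → Exceptional h
  short-path-exceptional {Ps} {h} {t} ex mp short with exceptional? h
  ... | yes e = e
  ... | no ¬e = contradiction (off-path t unique linked short) (λ (z , hz , z∉) → earlier z hz (on-earlier z hz z∉))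
    where
    open MaximalPath mp
    off-path : ∀ t → Unique (h ∷ t) → Linked H (h ∷ t) → length (h ∷ t) ≤ L → ∃[ z ] (H h z × z ∉ h ∷ t)
    off-path [] _ _ _ with another-nbr h (m h ∷ []) (s≤s (s≤s z≤n))
    ... | z , hz , z∉ = z , (hz , z∉ ∘ here) , λ { (here refl) → adj-irrefl hz }
    -- The third neighbour of `h`, besides its partner and `t₀`: if it lay further along this short
    -- path, it would close a short cycle and make `h` bad.
    off-path (t₀ ∷ ts) u l short with another-nbr h (m h ∷ t₀ ∷ []) (s≤s (s≤s (s≤s z≤n)))
    ... | z , hz , z∉ = z , (hz , z∉ ∘ here) , λ where
      (here refl) → adj-irrefl hz
      (there (here e)) → z∉ (there (here e))
      (there (there z∈)) → ¬e (inj₁ (bad L G (h ∷ t₀ ∷ ts) short (here refl)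
        (u , Linked.map proj₁ l , Any.map (λ { refl → hz }) z∈)))
    on-earlier : ∀ z → H h z → z ∉ h ∷ t → z ∈ concat Ps
    on-earlier z hz z∉ with ∈-++⁻ (h ∷ t) (head-stuck z hz)
    ... | inj₁ p = contradiction p z∉
    ... | inj₂ p = p
    h∉ : h ∉ concat Ps
    h∉ = fresh h (here refl)
    earlier : ∀ z → H h z → z ∉ concat Ps
    earlier z hz z∈ with extracted-ends ex z∈
    ... | inj₁ stuck = h∉ (stuck h (H-sym hz))
    ... | inj₂ (p , q , p≢q , p∈ , q∈ , hp , hq) = contradiction
      (unique-nbrs-≤3 {z} {m z ∷ h ∷ p ∷ q ∷ []}
        (((λ e → proj₂ (H-sym hz) (sym e)) ∷ (λ e → proj₂ hp (sym e)) ∷ (λ e → proj₂ hq (sym e)) ∷ [])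
          ∷ ((λ { refl → h∉ p∈ }) ∷ (λ { refl → h∉ q∈ }) ∷ []) ∷ (p≢q ∷ []) ∷ [] ∷ [])
        (proj₂ match z (λ mz → ¬e (inj₂ (z , proj₁ hz , mz)))
          ∷ proj₁ (H-sym hz) ∷ proj₁ hp ∷ proj₁ hq ∷ []))
      λ { (s≤s (s≤s (s≤s ()))) }

  -- Each path pays `ℓ` either with its own vertices or, if it is shorter than that, with its
  -- exceptional head.
  count-paths : ∀ {Ps} ℓ → ℓ ≤ L → Extracted Ps →
                ℓ * length Ps ≤ length (concat Ps) + ℓ * count exceptional? (concat Ps)
  count-paths ℓ ℓ≤L [] = ≤-reflexive refl
  count-paths {Q@(h ∷ t) ∷ Ps} ℓ ℓ≤L (mp ∷ ex) = begin
    ℓ * suc (length Ps) ≡⟨ *-suc ℓ _ ⟩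
    ℓ + ℓ * length Ps ≤⟨ +-mono-≤ one (count-paths ℓ ℓ≤L ex) ⟩
    (length Q + ℓ * cQ) + (length (concat Ps) + ℓ * c) ≡⟨ interchange (length Q) (ℓ * cQ) _ _ ⟩
    (length Q + length (concat Ps)) + (ℓ * cQ + ℓ * c)
      ≡⟨ cong₂ _+_ (sym (List.length-++ Q)) (trans (sym (*-distribˡ-+ ℓ cQ c)) (cong (ℓ *_) (sym (∑-++ Q (concat Ps) _)))) ⟩
    length (Q ++ concat Ps) + ℓ * count exceptional? (Q ++ concat Ps) ∎
    where
    open ≤-Reasoning
    cQ = count exceptional? Q
    c = count exceptional? (concat Ps)
    one : ℓ ≤ length Q + ℓ * cQ
    one with ℓ ≤? length Q
    ... | yes p = ≤-trans p (m≤m+n _ _)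
    ... | no p = ≤-trans (≤-trans (≤-reflexive (sym (*-identityʳ ℓ))) (*-monoʳ-≤ ℓ
      (≤-trans (≤-reflexive (sym (ind-yes (exceptional? h) (short-path-exceptional ex mp (≤-trans (<⇒≤ (≰⇒> p)) ℓ≤L)))))
        (m≤m+n _ _)))) (m≤n+m _ _)

  path-partition : ∀ ℓ → ℓ ≤ L → ∃[ Ps ] (Unique (concat Ps) × (∀ v → v ∈ concat Ps) ×
    All (Linked (Adj G)) Ps × ℓ * length Ps ≤ n + ℓ * (#bad L G + 3 * unmatched m))
  path-partition ℓ ℓ≤L with extract (allFin n)
  ... | Ps , ex , cover = Ps , u , (λ v → cover (∈-allFin v)) ,
    All.map (Linked.map proj₁) (extracted-linked ex) , ≤-trans (count-paths ℓ ℓ≤L ex)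
      (+-mono-≤ (unique-length u) (*-monoʳ-≤ ℓ (begin
        count exceptional? (concat Ps)
          ≤⟨ count-injection exceptional? exceptional? {ys = allFin n} id u (λ v _ e → ∈-allFin v , e) (λ _ _ _ _ e → e) ⟩
        countᶠ exceptional?
          ≤⟨ count-⊎ exceptional? (bad? L G) (has-nbr? (λ z → m z Fin.≟ z)) (allFin n) (λ _ e → e) ⟩
        #bad L G + countᶠ (has-nbr? (λ z → m z Fin.≟ z))
          ≤⟨ +-monoʳ-≤ (#bad L G) (count-has-nbr (λ z → m z Fin.≟ z)) ⟩
        #bad L G + 3 * unmatched m ∎)))
    where
    open ≤-Reasoning
    u = extracted-unique ex

-- Segmentations

linked-++⁻ : ∀ {A : Set} {R : A → A → Set} xs {ys} → Linked R (xs ++ ys) → Linked R xs × Linked R ys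
linked-++⁻ [] l = [] , l
linked-++⁻ (x ∷ []) {[]} l = [-] , []
linked-++⁻ (x ∷ []) {y ∷ ys} (r ∷ l) = [-] , l
linked-++⁻ (x ∷ y ∷ xs) (r ∷ l) with linked-++⁻ (y ∷ xs) l
... | p , q = r ∷ p , q

linked-concat⁻ : ∀ {A : Set} {R : A → A → Set} xss → Linked R (concat xss) → All (Linked R) xss
linked-concat⁻ [] l = []
linked-concat⁻ (xs ∷ xss) l with linked-++⁻ xs l
... | p , q = p ∷ linked-concat⁻ xss q

module Cut {A : Set} (c : ℕ) where

  -- k is the room left in the first piece; later pieces have room for suc c.
  cut : ℕ → List A → List A × List (List A)
  cut k [] = [] , []
  cut zero (x ∷ xs) = [] , (x ∷ proj₁ (cut c xs)) ∷ proj₂ (cut c xs)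
  cut (suc k) (x ∷ xs) = x ∷ proj₁ (cut k xs) , proj₂ (cut k xs)

  concat-cut : ∀ k xs → proj₁ (cut k xs) ++ concat (proj₂ (cut k xs)) ≡ xs
  concat-cut k [] = refl
  concat-cut zero (x ∷ xs) = cong (x ∷_) (concat-cut c xs)
  concat-cut (suc k) (x ∷ xs) = cong (x ∷_) (concat-cut k xs)

  cut-lengths : ∀ k xs → k ≤ c → length (proj₁ (cut k xs)) ≤ k × All (λ ys → length ys ≤ suc c) (proj₂ (cut k xs))
  cut-lengths k [] l = z≤n , []
  cut-lengths zero (x ∷ xs) l with cut-lengths c xs ≤-refl
  ... | p , q = z≤n , s≤s p ∷ q
  cut-lengths (suc k) (x ∷ xs) l with cut-lengths k xs (≤-trans (n≤1+n k) l)
  ... | p , q = s≤s p , q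

  -- A new piece is opened only when the current one is full, so with `k = c` the pieces after the
  -- first number at most length / (c + 1). The term `k` credits the room still free in the first
  -- piece.
  cut-count : ∀ k xs → k ≤ c → suc c * length (proj₂ (cut k xs)) + k ≤ length xs + c
  cut-count k [] l = ≤-trans (≤-reflexive (cong (_+ k) (*-zeroʳ (suc c)))) l
  cut-count zero (x ∷ xs) l = begin
    suc c * suc (length t) + 0 ≡⟨ shuffle c (length t) ⟩
    suc (suc c * length t + c) ≤⟨ s≤s (cut-count c xs ≤-refl) ⟩
    suc (length xs + c) ∎
    where
    open ≤-Reasoning
    t = proj₂ (cut c xs)
    shuffle : ∀ c t → suc c * suc t + 0 ≡ suc (suc c * t + c)
    shuffle = solve-∀
  cut-count (suc k) (x ∷ xs) l = ≤-trans (≤-reflexive (+-suc _ k)) (s≤s (cut-count k xs (≤-trans (n≤1+n k) l)))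

  pieces : List A → List (List A)
  pieces xs = proj₁ (cut c xs) ∷ proj₂ (cut c xs)

  cut-all : List (List A) → List (List A)
  cut-all = concatMap pieces

  concat-cut-all : ∀ xss → concat (cut-all xss) ≡ concat xss
  concat-cut-all [] = refl
  concat-cut-all (xs ∷ xss) = trans (sym (List.concat-++ (pieces xs) (cut-all xss)))
    (cong₂ _++_ (concat-cut c xs) (concat-cut-all xss))

  cut-all-linked : ∀ {R : A → A → Set} {xss} → All (Linked R) xss → All (Linked R) (cut-all xss)
  cut-all-linked [] = []
  cut-all-linked {xss = xs ∷ _} (l ∷ ls) =
    All.++⁺ (linked-concat⁻ (pieces xs) (subst (Linked _) (sym (concat-cut c xs)) l)) (cut-all-linked ls)

  cut-all-lengths : ∀ xss → All (λ ys → length ys ≤ suc c) (cut-all xss)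
  cut-all-lengths [] = []
  cut-all-lengths (xs ∷ xss) with cut-lengths c xs ≤-refl
  ... | p , q = All.++⁺ (≤-trans p (n≤1+n c) ∷ q) (cut-all-lengths xss)

  cut-all-count : ∀ xss → suc c * length (cut-all xss) ≤ length (concat xss) + suc c * length xss
  cut-all-count [] = ≤-refl
  cut-all-count (xs ∷ xss) = begin
    suc c * suc (length (t ++ cut-all xss)) ≡⟨ cong (λ k → suc c * suc k) (List.length-++ t) ⟩
    suc c * suc (length t + length (cut-all xss)) ≡⟨ shuffle₁ (suc c) (length t) _ ⟩
    suc c * length t + suc c * length (cut-all xss) + suc c
      ≤⟨ +-monoˡ-≤ (suc c) (+-mono-≤ (+-cancelʳ-≤ c _ _ (cut-count c xs ≤-refl)) (cut-all-count xss)) ⟩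
    length xs + (length (concat xss) + suc c * length xss) + suc c ≡⟨ shuffle₂ (length xs) _ (suc c) _ ⟩
    (length xs + length (concat xss)) + suc c * suc (length xss)
      ≡⟨ cong (_+ suc c * suc (length xss)) (sym (List.length-++ xs)) ⟩
    length (xs ++ concat xss) + suc c * suc (length xss) ∎
    where
    open ≤-Reasoning
    t = proj₂ (cut c xs)
    shuffle₁ : ∀ s t r → s * suc (t + r) ≡ s * t + s * r + s
    shuffle₁ = solve-∀
    shuffle₂ : ∀ x y s k → x + (y + s * k) + s ≡ (x + y) + s * suc k
    shuffle₂ = solve-∀

data Nth {A : Set} : List A → ℕ → A → Set where
  zero : ∀ {x xs} → Nth (x ∷ xs) zero x
  suc : ∀ {x xs y i} → Nth xs i y → Nth (x ∷ xs) (suc i) y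

∈⇒Nth : ∀ {A : Set} {xs : List A} {x} → x ∈ xs → ∃[ i ] (i < length xs × Nth xs i x)
∈⇒Nth (here refl) = 0 , s≤s z≤n , zero
∈⇒Nth (there x∈) with ∈⇒Nth x∈
... | i , i< , p = suc i , s≤s i< , suc p

Nth⇒∈ : ∀ {A : Set} {xs : List A} {i x} → Nth xs i x → x ∈ xs
Nth⇒∈ zero = here refl
Nth⇒∈ (suc p) = there (Nth⇒∈ p)

Nth-functional : ∀ {A : Set} {xs : List A} {i x y} → Nth xs i x → Nth xs i y → x ≡ y
Nth-functional zero zero = refl
Nth-functional (suc p) (suc q) = Nth-functional p q

Nth-injective : ∀ {A : Set} {xs : List A} {i j x} → Unique xs → Nth xs i x → Nth xs j x → i ≡ j
Nth-injective u zero zero = refl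
Nth-injective (x∉ ∷ u) zero (suc q) = contradiction refl (All.lookup x∉ (Nth⇒∈ q))
Nth-injective (x∉ ∷ u) (suc p) zero = contradiction refl (All.lookup x∉ (Nth⇒∈ p))
Nth-injective (x∉ ∷ u) (suc p) (suc q) = cong suc (Nth-injective u p q)

Nth-linked : ∀ {A : Set} {R : A → A → Set} {xs j v} → Linked R xs → Nth xs (suc j) v →
             ∃[ u ] (Nth xs j u × R u v)
Nth-linked (r ∷ l) (suc zero) = _ , zero , r
Nth-linked (r ∷ l) (suc (suc p)) with Nth-linked l (suc p)
... | u , q , s = u , suc q , s

unique-++⁻ : ∀ {A : Set} (xs : List A) {ys} → Unique (xs ++ ys) →
             Unique xs × Unique ys × (∀ {v} → v ∈ xs → v ∉ ys)
unique-++⁻ [] u = [] , u , λ ()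
unique-++⁻ (x ∷ xs) (x∉ ∷ u) with unique-++⁻ xs u
... | uxs , uys , d = All.++⁻ˡ xs x∉ ∷ uxs , uys , λ where
  (here refl) v∈ → All.lookup (All.++⁻ʳ xs x∉) v∈ refl
  (there v∈) → d v∈

concat-unique⁻ : ∀ {A : Set} {xss : List (List A)} {i xs} → Unique (concat xss) → Nth xss i xs → Unique xs
concat-unique⁻ {xss = ys ∷ xss} u zero = proj₁ (unique-++⁻ ys u)
concat-unique⁻ {xss = ys ∷ xss} u (suc p) = concat-unique⁻ (proj₁ (proj₂ (unique-++⁻ ys u))) p

concat-block : ∀ {A : Set} {xss : List (List A)} {i j xs ys v} → Unique (concat xss) →
               Nth xss i xs → Nth xss j ys → v ∈ xs → v ∈ ys → i ≡ j
concat-block u zero zero _ _ = refl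
concat-block {xss = zs ∷ xss} u zero (suc q) v∈ v∈′ =
  contradiction (∈-concat⁺′ v∈′ (Nth⇒∈ q)) (proj₂ (proj₂ (unique-++⁻ zs u)) v∈)
concat-block {xss = zs ∷ xss} u (suc p) zero v∈ v∈′ =
  contradiction (∈-concat⁺′ v∈ (Nth⇒∈ p)) (proj₂ (proj₂ (unique-++⁻ zs u)) v∈′)
concat-block {xss = zs ∷ xss} u (suc p) (suc q) v∈ v∈′ =
  cong suc (concat-block (proj₁ (proj₂ (unique-++⁻ zs u))) p q v∈ v∈′)

-- A partition into paths given by coordinates: number of the segment and position on it. Only the
-- step backwards is data; it rules out gaps in the positions, and a successor is unique by
-- injectivity.
record Segmentation {n : ℕ} (G : Graph n) (K ℓ : ℕ) : Set where
  field
    seg : Fin n → Fin K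
    idx : Fin n → ℕ
    idx<ℓ : ∀ v → idx v < ℓ
    seg-idx-injective : ∀ {u v} → seg u ≡ seg v → idx u ≡ idx v → u ≡ v
    predecessor : ∀ v j → idx v ≡ suc j → ∃[ u ] (seg u ≡ seg v × idx u ≡ j × Adj G u v)

segmentation : ∀ {n} {G : Graph n} {ℓ} xss → Unique (concat xss) → (∀ v → v ∈ concat xss) →
               All (Linked (Adj G)) xss → All (λ xs → length xs ≤ ℓ) xss → Segmentation G (length xss) ℓ
segmentation {n} {G} {ℓ} xss u cover linked short = record
  { seg = λ v → fromℕ< (i< v)
  ; idx = j
  ; idx<ℓ = λ v → ≤-trans (j< v) (All.lookup short (Nth⇒∈ (at-i v)))
  ; seg-idx-injective = λ {v} {w} → inj v w
  ; predecessor = pred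
  }
  where
  V = Fin n
  locate : ∀ v → ∃[ xs ] (v ∈ xs × xs ∈ xss)
  locate v = ∈-concat⁻′ xss (cover v)
  block : V → List V
  block v = proj₁ (locate v)
  in-block : ∀ v → v ∈ block v
  in-block v = proj₁ (proj₂ (locate v))
  i j : V → ℕ
  i v = proj₁ (∈⇒Nth (proj₂ (proj₂ (locate v))))
  i< : ∀ v → i v < length xss
  i< v = proj₁ (proj₂ (∈⇒Nth (proj₂ (proj₂ (locate v)))))
  at-i : ∀ v → Nth xss (i v) (block v)
  at-i v = proj₂ (proj₂ (∈⇒Nth (proj₂ (proj₂ (locate v)))))
  j v = proj₁ (∈⇒Nth (in-block v))
  j< : ∀ v → j v < length (block v)
  j< v = proj₁ (proj₂ (∈⇒Nth (in-block v)))
  at-j : ∀ v → Nth (block v) (j v) v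
  at-j v = proj₂ (proj₂ (∈⇒Nth (in-block v)))
  same-block : ∀ v w → i v ≡ i w → block v ≡ block w
  same-block v w e = Nth-functional (at-i v) (subst (λ k → Nth xss k (block w)) (sym e) (at-i w))
  inj : ∀ v w → fromℕ< (i< v) ≡ fromℕ< (i< w) → j v ≡ j w → v ≡ w
  inj v w e f = Nth-functional (at-j v)
    (subst₂ (λ b k → Nth b k w) (sym (same-block v w (Fin.fromℕ<-injective _ _ (i< v) (i< w) e))) (sym f) (at-j w))
  pred : ∀ v k → j v ≡ suc k → ∃[ w ] (fromℕ< (i< w) ≡ fromℕ< (i< v) × j w ≡ k × Adj G w v)
  pred v k e with Nth-linked (All.lookup linked (Nth⇒∈ (at-i v))) (subst (λ k → Nth (block v) k v) e (at-j v))
  ... | w , at , wv = w , Fin.fromℕ<-cong _ _ same (i< w) (i< v) , jw , wv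
    where
    same : i w ≡ i v
    same = concat-block u (at-i w) (at-i v) (in-block w) (Nth⇒∈ at)
    jw : j w ≡ k
    jw = Nth-injective (concat-unique⁻ u (at-i v))
      (subst (λ b → Nth b (j w) w) (same-block w v same) (at-j w)) at

-- With B bad and U unmatched vertices there are at most n/ℓ + B + 3U paths, cutting adds n/ℓ
-- pieces, and U ≤ n/ℓ + B by `few-unmatched`: in total 5n/ℓ + 4B.
few-segments : ∀ {n} (G : Graph n) → Cubic G → ∀ c L → c + c ≤ L → suc c ≤ L →
               ∃[ K ] (Segmentation G K (suc c) × suc c * K ≤ 5 * n + 4 * (suc c * #bad L G))
few-segments {n} G cubic c L 2c≤L ℓ≤L
  with Matchings.maximum-matching G cubic
... | m , match , maximum with PathPartition.path-partition G cubic match L (suc c) ℓ≤L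
... | Ps , u , cover , linked , few = length (cut-all Ps) ,
  segmentation (cut-all Ps) (subst Unique (sym (concat-cut-all Ps)) u)
    (λ v → subst (v ∈_) (sym (concat-cut-all Ps)) (cover v)) (cut-all-linked linked) (cut-all-lengths Ps) ,
  (begin
    ℓ * length (cut-all Ps) ≤⟨ cut-all-count Ps ⟩
    length (concat Ps) + ℓ * length Ps ≤⟨ +-mono-≤ (unique-length u) few ⟩
    n + (n + ℓ * (B + 3 * U)) ≡⟨ shuffle₁ n ℓ B U ⟩
    2 * n + ℓ * B + 3 * (ℓ * U)
      ≤⟨ +-monoʳ-≤ (2 * n + ℓ * B) (*-monoʳ-≤ 3 (Matchings.Alternating.Maximum.few-unmatched G cubic match maximum L c 2c≤L)) ⟩
    2 * n + ℓ * B + 3 * (n + ℓ * B) ≡⟨ shuffle₂ n (ℓ * B) ⟩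
    5 * n + 4 * (ℓ * B) ∎)
  where
  open ≤-Reasoning
  open Cut c
  ℓ = suc c
  B = #bad L G
  U = Matchings.unmatched G cubic m
  shuffle₁ : ∀ n ℓ B U → n + (n + ℓ * (B + 3 * U)) ≡ 2 * n + ℓ * B + 3 * (ℓ * U)
  shuffle₁ = solve-∀
  shuffle₂ : ∀ n b → 2 * n + b + 3 * (n + b) ≡ 5 * n + 4 * b
  shuffle₂ = solve-∀

-- Hopping along a segmentation

-- A schedule: `hop w` is the vertex that forces `w`, and `rank` orders the forces. A white vertex
-- of minimal rank can be forced, since its forcer and the neighbours of the forcer have smaller
-- rank and are blue already; injectivity of `hop` gives each vertex at most one force.
module Certificate {n : ℕ} (G : Graph n) (B : Subset n) (rank : Fin n → ℕ) (hop : Fin n → Maybe (Fin n))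
  (paid : ∀ w → hop w ≡ nothing → w ∈ₛ B)
  (legal : ∀ {w b} → hop w ≡ just b →
           Dist2 G b w × rank b < rank w × (∀ u → Adj G b u → rank u < rank w))
  (injective : ∀ {w w′ b} → hop w ≡ just b → hop w′ ≡ just b → w ≡ w′) where

  white : Subset n → ℕ
  white blue = countᶠ (λ v → ¬? (v ∈?ₛ blue))

  -- Always colour a white vertex of minimal rank.
  finish : ∀ k blue used → white blue ≤ k → (∀ {v} → v ∈ₛ B → v ∈ₛ blue) →
           (∀ {b} → b ∈ₛ used → ∃[ w ] (hop w ≡ just b × w ∈ₛ blue)) → CanFinish G blue used
  finish k blue used wk B⊆ hopped with Fin.any? (λ v → ¬? (v ∈?ₛ blue))
  ... | no none = done all-blue
    where
    all-blue : ∀ v → v ∈ₛ blue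
    all-blue v with v ∈?ₛ blue
    ... | yes p = p
    ... | no p = contradiction (v , p) none
  finish zero blue used wk B⊆ hopped | yes (v , v∉) =
    contradiction wk (<⇒≱ (1≤countᶠ (λ v → ¬? (v ∈?ₛ blue)) v∉))
  finish (suc k) blue used wk B⊆ hopped | yes (v , v∉) with hop w in eq
    where
    w = argmin rank v (filter (λ v → ¬? (v ∈?ₛ blue)) (allFin n))
  ... | nothing = contradiction (B⊆ (paid _ eq))
    (argmin-all rank {P = _∉ₛ blue} v∉ (All.all-filter (λ v → ¬? (v ∈?ₛ blue)) (allFin n)))
  ... | just b = step b w (earlier (proj₁ (proj₂ (legal eq)))) (λ u bu → earlier (proj₂ (proj₂ (legal eq)) u bu))
    b∉used w∉ (proj₁ (legal eq))
    (finish k (blue ∪ ⁅ w ⁆) (used ∪ ⁅ b ⁆) (s≤s⁻¹ (≤-trans fewer wk)) (x∈p∪q⁺ ∘ inj₁ ∘ B⊆) hopped′)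
    where
    whites = filter (λ v → ¬? (v ∈?ₛ blue)) (allFin n)
    w = argmin rank v whites
    w∉ : w ∉ₛ blue
    w∉ = argmin-all rank {P = _∉ₛ blue} v∉ (All.all-filter (λ v → ¬? (v ∈?ₛ blue)) (allFin n))
    earlier : ∀ {u} → rank u < rank w → u ∈ₛ blue
    earlier {u} lt with u ∈?ₛ blue
    ... | yes p = p
    ... | no u∉ = contradiction lt (≤⇒≯ (All.lookup (f[argmin]≤f[xs] {f = rank} v whites)
      (∈-filter⁺ (λ v → ¬? (v ∈?ₛ blue)) (∈-allFin u) u∉)))
    -- Had `b` forced before, its target would be blue, but by injectivity that target is the white
    -- `w`.
    b∉used : b ∉ₛ used
    b∉used b∈ with hopped b∈
    ... | w′ , eq′ , w′∈ = w∉ (subst (_∈ₛ blue) (injective eq′ eq) w′∈)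
    hopped′ : ∀ {b′} → b′ ∈ₛ used ∪ ⁅ b ⁆ → ∃[ w′ ] (hop w′ ≡ just b′ × w′ ∈ₛ blue ∪ ⁅ w ⁆)
    hopped′ b′∈ with x∈p∪q⁻ used ⁅ b ⁆ b′∈
    ... | inj₂ b′∈⁅b⁆ = w , trans eq (cong just (sym (x∈⁅y⁆⇒x≡y b b′∈⁅b⁆))) , x∈p∪q⁺ (inj₂ (x∈⁅x⁆ w))
    ... | inj₁ b′∈ with hopped b′∈
    ... | w′ , eq′ , w′∈ = w′ , eq′ , x∈p∪q⁺ (inj₁ w′∈)
    fewer : suc (white (blue ∪ ⁅ w ⁆)) ≤ white blue
    fewer = subst (suc (white (blue ∪ ⁅ w ⁆)) ≤_)
      (sym (count-≢ Fin._≟_ (λ v → ¬? (v ∈?ₛ blue)) (Unique.allFin⁺ n) (∈-allFin w) w∉))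
      (s≤s (countᶠ-mono (λ v → ¬? (v ∈?ₛ blue ∪ ⁅ w ⁆)) (λ v → ¬? (v ∈?ₛ blue) ×-dec ¬? (v Fin.≟ w))
        (λ u u∉ → (u∉ ∘ x∈p∪q⁺ ∘ inj₁) , λ { refl → u∉ (x∈p∪q⁺ (inj₂ (x∈⁅x⁆ w))) })))

  feasible : Feasible G B
  feasible = finish (white B) B _ ≤-refl id (λ b∈ → contradiction b∈ ∉⊥)

-- The 2 in `2 + ℓ ≤ L` is for the longest cycles that occur: two consecutive vertices together with
-- a stretch of another segment.
module SegmentGeometry {n : ℕ} (G : Graph n) (cubic : Cubic G) {K ℓ : ℕ} (S : Segmentation G K ℓ)
                       (L : ℕ) (2+ℓ≤L : 2 + ℓ ≤ L) where
  open CubicGraph G cubic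
  open Segmentation S

  V = Fin n

  -- The index is a separate argument tied to `idx v` by an equation, so that matching on it retains
  -- the equation that `predecessor` needs. The first vertex of a segment is its own `pre`.
  pre-at : ∀ v i → idx v ≡ i → V
  pre-at v zero e = v
  pre-at v (suc j) e = proj₁ (predecessor v j e)

  pre : V → V
  pre v = pre-at v (idx v) refl

  pre-spec : ∀ {v} → idx v ≢ 0 → seg (pre v) ≡ seg v × suc (idx (pre v)) ≡ idx v × Adj G (pre v) v
  pre-spec {v} = at (idx v) refl
    where
    at : ∀ i (e : idx v ≡ i) → i ≢ 0 →
         seg (pre-at v i e) ≡ seg v × suc (idx (pre-at v i e)) ≡ idx v × Adj G (pre-at v i e) v
    at zero e ≢0 = contradiction refl ≢0
    at (suc j) e _ with predecessor v j e
    ... | u , same , idx-u , uv = same , trans (cong suc idx-u) (sym e) , uv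

  Next : V → V → Set
  Next v w = seg w ≡ seg v × idx w ≡ suc (idx v)

  next? : ∀ v w → Dec (Next v w)
  next? v w = seg w Fin.≟ seg v ×-dec idx w ≟ suc (idx v)

  next-≢0 : ∀ {v w} → Next v w → idx w ≢ 0
  next-≢0 (_ , e) z = case trans (sym e) z of λ ()

  next⇒pre : ∀ {v w} → Next v w → pre w ≡ v
  next⇒pre nx@(same , e) with pre-spec (next-≢0 nx)
  ... | same′ , e′ , _ = seg-idx-injective (trans same′ same) (suc-injective (trans e′ e))

  pre⇒next : ∀ {w} → idx w ≢ 0 → Next (pre w) w
  pre⇒next ≢0 with pre-spec ≢0
  ... | same , e , _ = sym same , sym e

  next-adj : ∀ {v w} → Next v w → Adj G v w
  next-adj nx = subst (λ u → Adj G u _) (next⇒pre nx) (proj₂ (proj₂ (pre-spec (next-≢0 nx))))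

  pre-injective : ∀ {w w′} → idx w ≢ 0 → idx w′ ≢ 0 → pre w ≡ pre w′ → w ≡ w′
  pre-injective p q e with pre-spec p | pre-spec q
  ... | s , i , _ | s′ , i′ , _ = seg-idx-injective
    (trans (sym s) (trans (cong seg e) s′)) (trans (sym i) (trans (cong (suc ∘ idx) e) i′))

  Interior : V → Set
  Interior v = idx v ≢ 0 × ∃[ w ] Next v w

  interior? : ∀ v → Dec (Interior v)
  interior? v = ¬? (idx v ≟ 0) ×-dec Fin.any? (next? v)

  third : ∀ v → Interior v → ∃[ r ] (Adj G v r × r ≢ pre v × ¬ Next v r)
  third v (≢0 , w , nx) with another-nbr v (pre v ∷ w ∷ []) (s≤s (s≤s (s≤s z≤n)))
  ... | r , vr , r∉ = r , vr , r∉ ∘ here ,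
    λ (s , i) → r∉ (there (here (seg-idx-injective (trans s (sym (proj₁ nx))) (trans i (sym (proj₂ nx))))))

  -- The neighbour of an interior vertex outside its segment path; junk otherwise.
  mate : V → V
  mate v with interior? v
  ... | yes i = proj₁ (third v i)
  ... | no _ = v

  mate-spec : ∀ {v} → Interior v → Adj G v (mate v) × mate v ≢ pre v × ¬ Next v (mate v)
  mate-spec {v} int with interior? v
  ... | yes i = proj₂ (third v i)
  ... | no ¬i = contradiction int ¬i

  nbr-cases : ∀ {v u} → Interior v → Adj G v u → u ≡ pre v ⊎ Next v u ⊎ u ≡ mate v
  nbr-cases {v} {u} int@(≢0 , w , nx) vu with mate-spec int
  ... | vr , r≢pre , ¬next
    with nbr-dichotomy {v} {pre v} {w} {mate v} {u}
           (λ e → <-irrefl (trans (cong idx e) (proj₂ nx))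
             (≤-trans (≤-reflexive (proj₁ (proj₂ (pre-spec ≢0)))) (n≤1+n _)))
           (λ e → r≢pre (sym e)) (λ e → ¬next (subst (Next v) e nx))
           (adj-sym (proj₂ (proj₂ (pre-spec ≢0)))) (next-adj nx) vr vu
  ... | inj₁ e = inj₁ e
  ... | inj₂ (inj₁ refl) = inj₂ (inj₁ nx)
  ... | inj₂ (inj₂ e) = inj₂ (inj₂ e)

  mate-involutive : ∀ {v} → Interior v → Interior (mate v) → mate (mate v) ≡ v
  mate-involutive {v} int int′ with mate-spec int
  ... | vr , r≢pre , ¬next with nbr-cases int′ (adj-sym vr)
  ... | inj₂ (inj₂ e) = sym e
  ... | inj₁ e = contradiction (subst (λ u → Next u (mate v)) (sym e) (pre⇒next (proj₁ int′))) ¬next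
  ... | inj₂ (inj₁ nx) = contradiction (sym (next⇒pre nx)) r≢pre

  -- The stretch of a segment from `y` back to `x`. The index bounds carry uniqueness through the
  -- induction, the segment labels later separate the stretch from other segments, and the last
  -- component exposes `pre y` as second vertex, as a lollipop requires.
  descend : ∀ d {x y} → seg x ≡ seg y → idx y ≡ d + idx x →
            ∃[ zs ] (Unique (y ∷ zs) × Linked (Adj G) (y ∷ zs) × x ∈ y ∷ zs × length zs ≡ d ×
                     All (λ z → seg z ≡ seg y × idx z ≤ idx y) (y ∷ zs) × (∀ {k} → d ≡ suc k → ∃[ cs ] zs ≡ pre y ∷ cs))
  descend zero {x} {y} s e with seg-idx-injective s (sym e)
  ... | refl = [] , ([] ∷ []) , [-] , here refl , refl , ((refl , ≤-refl) ∷ []) , λ ()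
  descend (suc d) {x} {y} s e with pre-spec {y} (λ z → case trans (sym z) e of λ ())
  ... | s′ , i′ , adj with descend d {x} {pre y} (trans s (sym s′)) (suc-injective (trans i′ e))
  ... | zs , u , l , x∈ , len , low , _ = pre y ∷ zs ,
    (All.map (λ (_ , le) y≡z → <⇒≱ (≤-reflexive i′) (subst (λ z → idx z ≤ idx (pre y)) (sym y≡z) le)) low ∷ u) ,
    adj-sym adj ∷ l , there x∈ , cong suc len ,
    (refl , ≤-refl) ∷ All.map (λ (s″ , le) → trans s″ s′ , ≤-trans le (≤-trans (n≤1+n _) (≤-reflexive i′))) low ,
    λ _ → zs , refl

  reach : ∀ d {y i} → idx y ≡ d + i → ∃[ z ] (seg z ≡ seg y × idx z ≡ i)
  reach zero {y} e = y , refl , e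
  reach (suc d) {y} e with pre-spec {y} (λ z → case trans (sym z) e of λ ())
  ... | s , i , _ with reach d (suc-injective (trans i e))
  ... | z , s′ , e′ = z , trans s′ s , e′

  difference : ∀ {i j} → i ≤ j → ∃[ d ] (j ≡ d + i × d ≤ j)
  difference {i} {j} le = j ∸ i , sym (m∸n+n≡m le) , m∸n≤m j i

  -- The chord and the stretch between its ends form a cycle on at most `ℓ` vertices; `x ≢ pre y`
  -- says that it is a chord and not an edge of the segment.
  short-chord-bad : ∀ {x y} → Adj G x y → seg x ≡ seg y → idx x < idx y → x ≢ pre y → Bad L G y
  short-chord-bad {x} {y} xy s lt x≢pre with difference (<⇒≤ lt)
  ... | zero , e , _ = contradiction (sym e) (<⇒≢ lt)
  ... | suc d , e , d≤ with descend (suc d) s e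
  ... | zs , u , l , x∈ , len , _ , tail with tail refl
  ... | cs , refl = bad L G (y ∷ pre y ∷ cs)
    (≤-trans (s≤s (≤-reflexive len)) (≤-trans (s≤s d≤) (≤-trans (idx<ℓ y) (≤-trans (m≤n+m ℓ 2) 2+ℓ≤L))))
    (here refl) (u , l , Any.map (λ { refl → adj-sym xy }) (beyond x∈))
    where
    beyond : x ∈ y ∷ pre y ∷ cs → x ∈ cs
    beyond (here e) = contradiction e (adj-≢ xy)
    beyond (there (here e)) = contradiction e x≢pre
    beyond (there (there p)) = p

  mate-other-segment : ∀ {v} → Interior v → ¬ Bad L G v → ¬ Bad L G (mate v) → seg v ≢ seg (mate v)
  mate-other-segment {v} int good good′ s with mate-spec int
  ... | vr , r≢pre , ¬next with <-cmp (idx v) (idx (mate v))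
  ... | tri< lt _ _ = good′ (short-chord-bad vr s lt
    (λ e → ¬next (subst (λ u → Next u (mate v)) (sym e) (pre⇒next (λ z → n≮0 (subst (idx v <_) z lt))))))
  ... | tri≈ _ e _ = adj-≢ vr (seg-idx-injective s e)
  ... | tri> _ _ gt = good (short-chord-bad (adj-sym vr) (sym s) gt r≢pre)

  -- Two consecutive chords v–r and u–q into the same segment close a short cycle.
  parallel-chords-bad : ∀ {u v q r} → Adj G u v → Adj G v r → Adj G u q → seg u ≡ seg v → seg v ≢ seg r →
                        seg q ≡ seg r → idx q ≤ idx r → Bad L G r
  parallel-chords-bad {u} {v} {q} {r} uv vr uq suv svr sqr le with difference le
  ... | d , e , d≤ with descend d sqr e
  ... | zs , un , l , q∈ , len , segs , _ = bad L G (u ∷ v ∷ r ∷ zs)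
    (≤-trans (s≤s (s≤s (s≤s (≤-reflexive len)))) (≤-trans (+-monoʳ-≤ 2 (≤-trans (s≤s d≤) (idx<ℓ r))) 2+ℓ≤L))
    (there (there (here refl)))
    ( (adj-≢ uv ∷ All.map (λ (s , _) u≡z → svr (trans (sym suv) (trans (cong seg u≡z) s))) segs)
      ∷ All.map (λ (s , _) v≡z → svr (trans (cong seg v≡z) s)) segs ∷ un
    , uv ∷ vr ∷ l
    , Any.map (λ { refl → uq }) q∈)

  -- Two chords into a common segment would be parallel. The mate further along that segment plays
  -- `r`, and the roles of `u` and `v` are exchanged to suit.
  mates-other-segments : ∀ {u v} → Next u v → Interior u → Interior v → seg v ≢ seg (mate v) →
    ¬ Bad L G (mate u) → ¬ Bad L G (mate v) → seg u ≢ seg (mate u) → seg (mate v) ≢ seg (mate u)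
  mates-other-segments {u} {v} nx iu iv sv gu gv su s with ≤-total (idx (mate u)) (idx (mate v))
  ... | inj₁ le = gv (parallel-chords-bad (next-adj nx) (proj₁ (mate-spec iv)) (proj₁ (mate-spec iu))
    (sym (proj₁ nx)) sv (sym s) le)
  ... | inj₂ ge = gu (parallel-chords-bad (adj-sym (next-adj nx)) (proj₁ (mate-spec iu)) (proj₁ (mate-spec iv))
    (proj₁ nx) su s ge)

  count-first : countᶠ (λ v → idx v ≟ 0) ≤ K
  count-first = ≤-trans (countᶠ-injection (λ v → idx v ≟ 0) (λ (_ : Fin K) → yes tt) seg (λ _ _ → tt)
    (λ v w p q e → seg-idx-injective e (trans p (sym q)))) (countᶠ-≤ (λ _ → yes tt))

  last? : ∀ v → Dec (¬ (∃[ w ] Next v w))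
  last? v = ¬? (Fin.any? (next? v))

  count-last : countᶠ last? ≤ K
  count-last = ≤-trans (countᶠ-injection last? (λ (_ : Fin K) → yes tt) seg (λ _ _ → tt) same)
    (countᶠ-≤ (λ _ → yes tt))
    where
    follow : ∀ {v w} → seg v ≡ seg w → idx v < idx w → ∃[ z ] Next v z
    follow s lt with difference lt
    ... | d , e , _ with reach d e
    ... | z , s′ , e′ = z , trans s′ (sym s) , e′
    same : ∀ v w → ¬ (∃[ z ] Next v z) → ¬ (∃[ z ] Next w z) → seg v ≡ seg w → v ≡ w
    same v w lv lw s with <-cmp (idx v) (idx w)
    ... | tri< lt _ _ = contradiction (follow s lt) lv
    ... | tri≈ _ e _ = seg-idx-injective s e
    ... | tri> _ _ gt = contradiction (follow (sym s) gt) lw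

  Exceptional : V → Set
  Exceptional v = ¬ Interior v ⊎ Bad L G v

  exceptional? : ∀ v → Dec (Exceptional v)
  exceptional? v = ¬? (interior? v) ⊎-dec bad? L G v

  count-exceptional : countᶠ exceptional? ≤ 2 * K + #bad L G
  count-exceptional = begin
    countᶠ exceptional? ≤⟨ count-⊎ exceptional? (λ v → ¬? (interior? v)) (bad? L G) (allFin n) (λ _ e → e) ⟩
    countᶠ (λ v → ¬? (interior? v)) + #bad L G
      ≤⟨ +-monoˡ-≤ (#bad L G) (count-⊎ (λ v → ¬? (interior? v)) (λ v → idx v ≟ 0) last? (allFin n)
           (λ v ¬int → case idx v ≟ 0 of λ where
             (yes p) → inj₁ p
             (no p) → inj₂ (λ nx → ¬int (p , nx)))) ⟩
    countᶠ (λ v → idx v ≟ 0) + countᶠ last? + #bad L G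
      ≤⟨ +-monoˡ-≤ (#bad L G) (+-mono-≤ count-first (≤-trans count-last (≤-reflexive (sym (+-identityʳ K))))) ⟩
    2 * K + #bad L G ∎
    where open ≤-Reasoning

  -- One step of closure, so that away from these vertices the mate is interior and good as well. It
  -- costs the factor 4 = 1 + 3 in `count-near`.
  NearExceptional : V → Set
  NearExceptional v = Exceptional v ⊎ ∃[ z ] (Adj G v z × Exceptional z)

  near? : ∀ v → Dec (NearExceptional v)
  near? v = exceptional? v ⊎-dec has-nbr? exceptional? v

  count-near : countᶠ near? ≤ 4 * (2 * K + #bad L G)
  count-near = ≤-trans (count-⊎ near? exceptional? (has-nbr? exceptional?) (allFin n) (λ _ e → e))
    (+-mono-≤ count-exceptional (≤-trans (count-has-nbr exceptional?) (*-monoʳ-≤ 3 count-exceptional)))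

module _ {P Q A : Set} where

  choose : Dec P → Dec Q → A → A → Maybe A
  choose d e x y = if does d then just x else if does e then just y else nothing

  choose-just : ∀ {x y z} (d : Dec P) (e : Dec Q) → choose d e x y ≡ just z → (P × z ≡ x) ⊎ (Q × z ≡ y)
  choose-just (yes p) e refl = inj₁ (p , refl)
  choose-just (no _) (yes q) refl = inj₂ (q , refl)
  choose-just (no _) (no _) ()

  choose-nothing : ∀ {x y} (d : Dec P) (e : Dec Q) → choose d e x y ≡ nothing → ¬ P × ¬ Q
  choose-nothing (no ¬p) (no ¬q) _ = ¬p , ¬q

does⁻ : {P : Set} (d : Dec P) → does d ≡ true → P
does⁻ (yes p) _ = p

module Hopping {n : ℕ} (G : Graph n) (cubic : Cubic G) {K ℓ : ℕ} (S : Segmentation G K ℓ)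
               (L : ℕ) (2+ℓ≤L : 2 + ℓ ≤ L) where
  open CubicGraph G cubic
  open Segmentation S
  open SegmentGeometry G cubic S L 2+ℓ≤L
  open Ordering {K}

  Regular : V → Set
  Regular w = idx w ≢ 0 × ¬ NearExceptional (pre w) × ¬ NearExceptional (pre (pre w))

  regular? : ∀ w → Dec (Regular w)
  regular? w = ¬? (idx w ≟ 0) ×-dec ¬? (near? (pre w)) ×-dec ¬? (near? (pre (pre w)))

  -- With `v = pre w` and `u = pre v`: the common segment of `u` and `v`, then the segments at the
  -- other ends of their chords. `Precedes` says that both chords go forward, the only case in which
  -- a regular `w` is paid for.
  triple : V → Triple
  triple w = seg (pre w) , seg (mate (pre w)) , seg (mate (pre (pre w)))

  triples : List Triple
  triples = map triple (filter regular? (allFin n))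

  interior : ∀ {v} → ¬ NearExceptional v → Interior v
  interior {v} ¬near with interior? v
  ... | yes i = i
  ... | no ¬i = contradiction (inj₁ (inj₁ ¬i)) ¬near

  good : ∀ {v} → ¬ NearExceptional v → ¬ Bad L G v
  good ¬near b = ¬near (inj₁ (inj₂ b))

  mate-good : ∀ {v} → ¬ NearExceptional v → ¬ Bad L G (mate v)
  mate-good ¬near b = ¬near (inj₂ (_ , proj₁ (mate-spec (interior ¬near)) , inj₂ b))

  mate-interior : ∀ {v} → ¬ NearExceptional v → Interior (mate v)
  mate-interior {v} ¬near with interior? (mate v)
  ... | yes i = i
  ... | no ¬i = contradiction (inj₂ (_ , proj₁ (mate-spec (interior ¬near)) , inj₁ ¬i)) ¬near

  distinct : ∀ {t} → t ∈ triples → Distinct t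
  distinct t∈ with ∈-map⁻ triple t∈
  ... | w , w∈ , refl with proj₂ (∈-filter⁻ regular? {xs = allFin n} w∈)
  ... | ≢0 , nv , nu = sv , (λ e → su (trans (proj₁ (pre-spec (proj₁ iv))) e)) ,
    mates-other-segments (pre⇒next (proj₁ iv)) iu iv sv (mate-good nu) (mate-good nv) su
    where
    iv = interior nv
    iu = interior nu
    sv = mate-other-segment iv (good nv) (mate-good nv)
    su = mate-other-segment iu (good nu) (mate-good nu)

  module Ordered (prio : Fin K → ℕ) (prio-injective : ∀ {x y} → prio x ≡ prio y → x ≡ y)
                 (third-first : 3 * count (precedes? prio) triples ≤ length triples) where

    -- The lexicographic order of segment priority and position, since positions are below `ℓ`.
    rank : V → ℕ
    rank v = prio (seg v) * ℓ + idx v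

    rank-< : ∀ {v w} → prio (seg v) < prio (seg w) → rank v < rank w
    rank-< {v} {w} lt = begin-strict
      prio (seg v) * ℓ + idx v <⟨ +-monoʳ-< (prio (seg v) * ℓ) (idx<ℓ v) ⟩
      prio (seg v) * ℓ + ℓ     ≡⟨ +-comm (prio (seg v) * ℓ) ℓ ⟩
      suc (prio (seg v)) * ℓ   ≤⟨ *-monoˡ-≤ ℓ lt ⟩
      prio (seg w) * ℓ         ≤⟨ m≤m+n _ (idx w) ⟩
      rank w                   ∎
      where open ≤-Reasoning

    rank-<-same : ∀ {v w} → seg v ≡ seg w → idx v < idx w → rank v < rank w
    rank-<-same {v} {w} s lt =
      subst (λ x → rank v < prio x * ℓ + idx w) s (+-monoʳ-< (prio (seg v) * ℓ) lt)

    -- When `mate v` is the one to hop, all its neighbours must be blue; its being interior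
    -- identifies them as its two neighbours on its own segment and `v`.
    Back : V → Set
    Back v = Interior v × Interior (mate v) × prio (seg (mate v)) < prio (seg v)

    back? : ∀ v → Dec (Back v)
    back? v = interior? v ×-dec interior? (mate v) ×-dec prio (seg (mate v)) <? prio (seg v)

    -- A back chord at the predecessor v of w lets mate v hop onto w; one at the
    -- predecessor u of v lets u hop onto w.
    ByMate BySelf : V → Set
    ByMate w = idx w ≢ 0 × Back (pre w)
    BySelf w = idx w ≢ 0 × Interior (pre w) × Back (pre (pre w))

    byMate? : ∀ w → Dec (ByMate w)
    byMate? w = ¬? (idx w ≟ 0) ×-dec back? (pre w)

    bySelf? : ∀ w → Dec (BySelf w)
    bySelf? w = ¬? (idx w ≟ 0) ×-dec interior? (pre w) ×-dec back? (pre (pre w))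

    hop : V → Maybe V
    hop w = choose (byMate? w) (bySelf? w) (mate (pre w)) (pre (pre w))

    hop-cases : ∀ {w b} → hop w ≡ just b → (ByMate w × b ≡ mate (pre w)) ⊎ (BySelf w × b ≡ pre (pre w))
    hop-cases {w} = choose-just (byMate? w) (bySelf? w)

    Paid : V → Set
    Paid w = ¬ ByMate w × ¬ BySelf w

    paid? : ∀ w → Dec (Paid w)
    paid? w = ¬? (byMate? w) ×-dec ¬? (bySelf? w)

    B : Subset n
    B = Vec.tabulate (does ∘ paid?)

    ∈B⁺ : ∀ {w} → Paid w → w ∈ₛ B
    ∈B⁺ {w} p = Vec.lookup⇒[]= w B (trans (Vec.lookup∘tabulate (does ∘ paid?) w) (dec-true (paid? w) p))

    ∈B⁻ : ∀ {w} → w ∈ₛ B → Paid w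
    ∈B⁻ {w} w∈ = does⁻ (paid? w) (trans (sym (Vec.lookup∘tabulate (does ∘ paid?) w)) (Vec.[]=⇒lookup w∈))

    hop-nothing : ∀ w → hop w ≡ nothing → w ∈ₛ B
    hop-nothing w e = ∈B⁺ (choose-nothing (byMate? w) (bySelf? w) e)

    -- Rank settles distance as well as colour: once `b` and all its neighbours rank below `w`, `w`
    -- is neither `b` nor a neighbour of `b`, and `pre w` is the common neighbour. A hopping mate
    -- has two neighbours on its own earlier segment and `pre w` as third; a hopping `u` has two on
    -- the segment of `w`, before `w`, and its mate on an earlier one.
    hop-legal : ∀ {w b} → hop w ≡ just b →
                Dist2 G b w × rank b < rank w × (∀ u → Adj G b u → rank u < rank w)
    hop-legal {w} e with hop-cases e
    ... | inj₁ ((≢0 , iv , ir , lt) , refl) = (r≢w , ¬rw , v , adj-sym vr , next-adj vw) , before refl , nbrs-before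
      where
      v = pre w
      r = mate v
      vw = pre⇒next ≢0
      vr = proj₁ (mate-spec iv)
      before : ∀ {u} → seg u ≡ seg r → rank u < rank w
      before s = rank-< (subst₂ (λ x y → prio x < prio y) (sym s) (sym (proj₁ vw)) lt)
      nbrs-before : ∀ u → Adj G r u → rank u < rank w
      nbrs-before u ru with nbr-cases ir ru
      ... | inj₁ refl = before (proj₁ (pre-spec (proj₁ ir)))
      ... | inj₂ (inj₁ nx) = before (proj₁ nx)
      ... | inj₂ (inj₂ refl) = rank-<-same (trans (cong seg (mate-involutive iv ir)) (sym (proj₁ vw)))
        (≤-reflexive (trans (cong (suc ∘ idx) (mate-involutive iv ir)) (sym (proj₂ vw))))
      r≢w : r ≢ w
      r≢w e = <-irrefl (cong rank e) (before refl)
      ¬rw : ¬ Adj G r w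
      ¬rw rw = <-irrefl refl (nbrs-before w rw)
    ... | inj₂ ((≢0 , iv , iu , ir , lt) , refl) = (u≢w , ¬uw , v , next-adj uv , next-adj vw) , u-before , nbrs-before
      where
      v = pre w
      u = pre v
      vw = pre⇒next ≢0
      uv = pre⇒next (proj₁ iv)
      uw : seg u ≡ seg w
      uw = trans (sym (proj₁ uv)) (sym (proj₁ vw))
      v<w : idx v < idx w
      v<w = ≤-reflexive (sym (proj₂ vw))
      u<v : idx u < idx v
      u<v = ≤-reflexive (sym (proj₂ uv))
      u-before : rank u < rank w
      u-before = rank-<-same uw (<-trans u<v v<w)
      nbrs-before : ∀ x → Adj G u x → rank x < rank w
      nbrs-before x ux with nbr-cases iu ux
      ... | inj₁ refl = rank-<-same (trans (proj₁ (pre-spec (proj₁ iu))) uw)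
        (<-trans (≤-reflexive (proj₁ (proj₂ (pre-spec (proj₁ iu))))) (<-trans u<v v<w))
      ... | inj₂ (inj₁ nx) = rank-<-same (trans (proj₁ nx) uw)
        (subst (_< idx w) (trans (proj₂ uv) (sym (proj₂ nx))) v<w)
      ... | inj₂ (inj₂ refl) = rank-< (subst (λ s → prio (seg (mate u)) < prio s) uw lt)
      u≢w : u ≢ w
      u≢w e = <-irrefl (cong rank e) u-before
      ¬uw : ¬ Adj G u w
      ¬uw a = <-irrefl refl (nbrs-before w a)

    -- A vertex hops onto at most one target: through its own chord if that chord
    -- goes forward, and along its segment if it goes back.
    hop-injective : ∀ {w w′ b} → hop w ≡ just b → hop w′ ≡ just b → w ≡ w′
    hop-injective {w} {w′} e e′ with hop-cases e | hop-cases e′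
    ... | inj₁ ((≢0 , iv , ir , _) , refl) | inj₁ ((≢0′ , iv′ , ir′ , _) , eq) = pre-injective ≢0 ≢0′
      (trans (sym (mate-involutive iv ir)) (trans (cong mate eq) (mate-involutive iv′ ir′)))
    ... | inj₂ ((≢0 , iv , _) , refl) | inj₂ ((≢0′ , iv′ , _) , eq) =
      pre-injective ≢0 ≢0′ (pre-injective (proj₁ iv) (proj₁ iv′) eq)
    ... | inj₁ ((≢0 , iv , ir , lt) , refl) | inj₂ ((≢0′ , _ , _ , _ , lt′) , eq) =
      contradiction lt (<-asym (subst₂ (λ x y → prio (seg x) < prio (seg y))
        (trans (cong mate (sym eq)) (mate-involutive iv ir)) (sym eq) lt′))
    ... | inj₂ ((≢0 , _ , _ , _ , lt) , refl) | inj₁ ((≢0′ , iv′ , ir′ , lt′) , eq) =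
      contradiction lt′ (<-asym (subst₂ (λ x y → prio (seg x) < prio (seg y))
        (trans (cong mate eq) (mate-involutive iv′ ir′)) eq lt))

    feasible : Feasible G B
    feasible = Certificate.feasible G B rank hop hop-nothing hop-legal hop-injective

    First? : ∀ w → Dec (idx w ≡ 0)
    First? w = idx w ≟ 0

    near-pre? : ∀ w → Dec (idx w ≢ 0 × NearExceptional (pre w))
    near-pre? w = ¬? (idx w ≟ 0) ×-dec near? (pre w)

    near-pre²? : ∀ w → Dec ((idx w ≢ 0 × idx (pre w) ≢ 0) × NearExceptional (pre (pre w)))
    near-pre²? w = (¬? (idx w ≟ 0) ×-dec ¬? (idx (pre w) ≟ 0)) ×-dec near? (pre (pre w))

    forward? : ∀ w → Dec (Regular w × Precedes prio (triple w))
    forward? w = regular? w ×-dec precedes? prio (triple w)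

    -- Failing both hops only says that no chord goes back; as its ends lie on distinct segments and
    -- `prio` is injective, each chord then goes forward. The other three cases are rare and are
    -- charged to ends of segments and bad vertices.
    paid-cases : ∀ w → Paid w → idx w ≡ 0 ⊎ (idx w ≢ 0 × NearExceptional (pre w)) ⊎
                 ((idx w ≢ 0 × idx (pre w) ≢ 0) × NearExceptional (pre (pre w))) ⊎
                 (Regular w × Precedes prio (triple w))
    paid-cases w (¬mate , ¬self) with idx w ≟ 0 | near? (pre w) | near? (pre (pre w))
    ... | yes e | _ | _ = inj₁ e
    ... | no ≢0 | yes near | _ = inj₂ (inj₁ (≢0 , near))
    ... | no ≢0 | no nv | yes near = inj₂ (inj₂ (inj₁ ((≢0 , proj₁ (interior nv)) , near)))
    ... | no ≢0 | no nv | no nu = inj₂ (inj₂ (inj₂ ((≢0 , nv , nu) , v-forward , u-forward)))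
      where
      iv = interior nv
      iu = interior nu
      before : ∀ {x y} → ¬ prio y < prio x → x ≢ y → prio x < prio y
      before ¬lt x≢y = ≤∧≢⇒< (≮⇒≥ ¬lt) (x≢y ∘ prio-injective)
      su = mate-other-segment iu (good nu) (mate-good nu)
      uv : seg (pre (pre w)) ≡ seg (pre w)
      uv = proj₁ (pre-spec (proj₁ iv))
      v-forward : prio (seg (pre w)) < prio (seg (mate (pre w)))
      v-forward = before (λ lt → ¬mate (≢0 , iv , mate-interior nv , lt)) (mate-other-segment iv (good nv) (mate-good nv))
      u-forward : prio (seg (pre w)) < prio (seg (mate (pre (pre w))))
      u-forward = subst (λ s → prio s < prio (seg (mate (pre (pre w))))) uv
        (before (λ lt → ¬self (≢0 , iv , iu , mate-interior nu , lt)) su)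

    count-forward : 3 * countᶠ forward? ≤ n
    count-forward = begin
      3 * countᶠ forward?
        ≡⟨ cong (3 *_) (trans (∑-cong (allFin n) λ w → ind-× (regular? w) (precedes? prio (triple w)))
             (trans (sym (∑-filter regular? (allFin n) _)) (sym (∑-map triple (filter regular? (allFin n)) _)))) ⟩
      3 * count (precedes? prio) triples ≤⟨ third-first ⟩
      length triples ≡⟨ trans (List.length-map triple (filter regular? (allFin n))) (length-filter-count regular? (allFin n)) ⟩
      countᶠ regular? ≤⟨ countᶠ-≤ regular? ⟩
      n ∎
      where open ≤-Reasoning

    -- With β bad vertices, first vertices cost K and each of the two near-exceptional cases 8K +
    -- 4β; three times 17K + 8β gives the constants.
    ∣B∣-≤ : 3 * ∣ B ∣ ≤ n + 51 * K + 24 * #bad L G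
    ∣B∣-≤ = begin
      3 * ∣ B ∣
        ≡⟨ cong (3 *_) (∣∣≡countᶠ B) ⟩
      3 * countᶠ (λ w → w ∈?ₛ B)
        ≤⟨ *-monoʳ-≤ 3 (begin
             countᶠ (λ w → w ∈?ₛ B)
               ≤⟨ count-⊎ (λ w → w ∈?ₛ B) First? rest₁? (allFin n) (λ w → paid-cases w ∘ ∈B⁻) ⟩
             countᶠ First? + countᶠ rest₁?
               ≤⟨ +-mono-≤ count-first (count-⊎ rest₁? near-pre? rest₂? (allFin n) (λ _ e → e)) ⟩
             K + (countᶠ near-pre? + countᶠ rest₂?)
               ≤⟨ +-monoʳ-≤ K (+-mono-≤ count₁ (count-⊎ rest₂? near-pre²? forward? (allFin n) (λ _ e → e))) ⟩
             K + (X + (countᶠ near-pre²? + countᶠ forward?))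
               ≤⟨ +-monoʳ-≤ K (+-monoʳ-≤ X (+-monoˡ-≤ _ count₂)) ⟩
             K + (X + (X + countᶠ forward?)) ∎) ⟩
      3 * (K + (X + (X + countᶠ forward?)))
        ≡⟨ shuffle K (#bad L G) (countᶠ forward?) ⟩
      3 * countᶠ forward? + 51 * K + 24 * #bad L G
        ≤⟨ +-monoˡ-≤ _ (+-monoˡ-≤ _ count-forward) ⟩
      n + 51 * K + 24 * #bad L G ∎
      where
      open ≤-Reasoning
      X = 4 * (2 * K + #bad L G)
      rest₂? : ∀ w → Dec (((idx w ≢ 0 × idx (pre w) ≢ 0) × NearExceptional (pre (pre w))) ⊎
                          (Regular w × Precedes prio (triple w)))
      rest₂? w = near-pre²? w ⊎-dec forward? w
      rest₁? : ∀ w → Dec ((idx w ≢ 0 × NearExceptional (pre w)) ⊎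
                          ((idx w ≢ 0 × idx (pre w) ≢ 0) × NearExceptional (pre (pre w))) ⊎
                          (Regular w × Precedes prio (triple w)))
      rest₁? w = near-pre? w ⊎-dec rest₂? w
      count₁ : countᶠ near-pre? ≤ X
      count₁ = ≤-trans (countᶠ-injection near-pre? near? pre (λ _ → proj₂)
        (λ _ _ p q → pre-injective (proj₁ p) (proj₁ q))) count-near
      count₂ : countᶠ near-pre²? ≤ X
      count₂ = ≤-trans (countᶠ-injection near-pre²? near? (pre ∘ pre) (λ _ → proj₂)
        (λ _ _ ((p , p′) , _) ((q , q′) , _) e → pre-injective p q (pre-injective p′ q′ e))) count-near
      shuffle : ∀ K b f → 3 * (K + (4 * (2 * K + b) + (4 * (2 * K + b) + f))) ≡ 3 * f + 51 * K + 24 * b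
      shuffle = solve-∀

  small-feasible : ∃[ B ] (Feasible G B × 3 * ∣ B ∣ ≤ n + 51 * K + 24 * #bad L G)
  small-feasible = let prio , inj , third-first = order triples distinct
                       open Ordered prio inj third-first
                   in B , feasible , ∣B∣-≤

-- Conclusion

-- After multiplication by 10 there is room for an error of 10n, half for segments and half for bad
-- vertices. 510 = 10 · 51 matches the coefficient of K, leaving 5n from `short`. The terms in β add
-- up to 4 · 510 + 240 = 2280 = 5 · 456, which gives the other 5n.
combine-bounds : ∀ A n K B ℓ q β → ℓ ≡ 510 * A → q ≡ 456 * A → ℓ * K ≤ 5 * n + 4 * (ℓ * β) →
                 3 * B ≤ n + 51 * K + 24 * β → q * β ≤ n → 3 * A * B ≤ (A + 1) * n
combine-bounds A n K B _ _ β refl refl short small few = *-cancelˡ-≤ 10 (begin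
  10 * (3 * A * B)                            ≡⟨ shuffle₁ A B ⟩
  10 * A * (3 * B)                            ≤⟨ *-monoʳ-≤ (10 * A) small ⟩
  10 * A * (n + 51 * K + 24 * β)              ≡⟨ shuffle₂ A n K β ⟩
  10 * A * n + 510 * A * K + 240 * A * β
    ≤⟨ +-monoˡ-≤ (240 * A * β) (+-monoʳ-≤ (10 * A * n) short) ⟩
  10 * A * n + (5 * n + 4 * (510 * A * β)) + 240 * A * β ≡⟨ shuffle₃ A n β ⟩
  10 * A * n + 5 * n + 5 * (456 * A * β)      ≤⟨ +-monoʳ-≤ (10 * A * n + 5 * n) (*-monoʳ-≤ 5 few) ⟩
  10 * A * n + 5 * n + 5 * n                  ≡⟨ shuffle₄ A n ⟩
  10 * ((A + 1) * n)                          ∎)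
  where
  open ≤-Reasoning
  shuffle₁ : ∀ A B → 10 * (3 * A * B) ≡ 10 * A * (3 * B)
  shuffle₁ = solve-∀
  shuffle₂ : ∀ A n K β → 10 * A * (n + 51 * K + 24 * β) ≡ 10 * A * n + 510 * A * K + 240 * A * β
  shuffle₂ = solve-∀
  shuffle₃ : ∀ A n β → 10 * A * n + (5 * n + 4 * (510 * A * β)) + 240 * A * β ≡ 10 * A * n + 5 * n + 5 * (456 * A * β)
  shuffle₃ = solve-∀
  shuffle₄ : ∀ A n → 10 * A * n + 5 * n + 5 * n ≡ 10 * ((A + 1) * n)
  shuffle₄ = solve-∀

-- L = 2ℓ meets three demands at once: c + c for the alternating walks, ℓ for short paths, and 2 + ℓ
-- for cycles through chords, the last by `1 ≤ c`.
small-feasible-set : ∀ {n} (G : Graph n) → Cubic G → ∀ A c q → suc c ≡ 510 * A → q ≡ 456 * A → 1 ≤ c →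
  q * #bad (suc c + suc c) G ≤ n → ∃[ B ] (Feasible G B × 3 * A * ∣ B ∣ ≤ (A + 1) * n)
small-feasible-set {n} G cubic A c q ℓ≡ q≡ 1≤c few = let
    K , S , short = few-segments G cubic c (suc c + suc c) (+-mono-≤ (n≤1+n c) (n≤1+n c)) (m≤m+n (suc c) (suc c))
    B , feasible , small = Hopping.small-feasible G cubic S (suc c + suc c) (+-monoˡ-≤ (suc c) (s≤s 1≤c))
  in B , feasible , combine-bounds A n K ∣ B ∣ (suc c) q (#bad (suc c + suc c) G) ℓ≡ q≡ short small few

most-have-small-feasible-set : ∀ A c q → suc c ≡ 510 * A → q ≡ 456 * A → 1 ≤ c → ∀ b →
  ∃[ N ] ((n : ℕ) → N ≤ n → ∃[ Gs ] (Unique Gs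
    × All (λ G → Cubic {n} G × (∃[ B ] (Feasible G B × 3 * A * ∣ B ∣ ≤ (A + 1) * n))) Gs
    × b * numCubic n ≤ (suc b) * length Gs))
most-have-small-feasible-set A c q ℓ≡ q≡ 1≤c b = proj₁ most , λ n N≤n →
  filter (few-bad? q (suc c + suc c)) (allGraphs n) ,
  Unique.filter⁺ (few-bad? q (suc c + suc c)) (allGraphs-unique n) ,
  All.map (λ {G} (cubic , few) → cubic , small-feasible-set G cubic A c q ℓ≡ q≡ 1≤c few)
    (All.all-filter (few-bad? q (suc c + suc c)) (allGraphs n)) ,
  proj₂ most n N≤n
  where
  most = most-cubic-graphs-have-few-bad q (suc c + suc c) b

theorem1p2 : (a b : ℕ) → ∃[ N ] ((n : ℕ) → N ≤ n → (∃[ k ] n ≡ k + k) →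
    ∃[ L ] (Unique L
    × All (λ G → Cubic {n} G × (∃[ B ] (Feasible G B × 3 * suc a * ∣ B ∣ ≤ (suc a + 1) * n))) L
    × b * numCubic n ≤ (suc b) * length L))
theorem1p2 a b = let
    -- 509 + 510a is the `c` with `suc c` equal to 510 · suc a.
    N , holds = most-have-small-feasible-set (suc a) (509 + 510 * a) (456 * suc a)
                  (sym (*-suc 510 a)) refl (s≤s z≤n) b
  in N , λ n N≤n _ → holds n N≤n
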